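{- Let $\mathbb K$ (the kite) be the graph with vertex set $\{1,2,3,4,5\}$ and edge set $\{12,23,24,34,35,45\}$. The problem $\mathbb K$-Induced Minor is solvable in polynomial time.
   Context: All graphs are finite and simple. A graph $G$ contains $H$ as an induced minor if $H$ can be obtained from $G$ by vertex deletions and edge contractions. The problem $H$-Induced Minor takes a graph $G$ as input and asks whether $G$ contains $H$ as an induced minor. -}

module Defs where

open import Data.Nat using (ℕ; zero; suc; _+_; _*_; _^_; _≤_)
open import Data.Fin using (Fin; zero; suc; punchIn; _≟_)
open import Data.Bool using (Bool; true; false; not; _∧_; _∨_)
open import Data.Bool.Properties using (∨-comm)
open import Data.List using (List; []; _∷_; _++_; replicate; concat; map; length; allFin)
open import Data.Maybe using (Maybe; just; nothing)
open import Data.Product using (Σ; _×_; _,_)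
open import Data.Sum using (_⊎_; inj₁; inj₂)
open import Function.Bundles using (_↔_; Inverse; _⇔_)
open import Relation.Nullary.Decidable using (isYes)
open import Relation.Binary.PropositionalEquality using (_≡_; refl)

Adj : ℕ → Set
Adj n = Fin n → Fin n → Bool

record Graph : Set where
  field
    size   : ℕ
    adj    : Adj size
    sym    : ∀ i j → adj i j ≡ adj j i
    irrefl : ∀ i → adj i i ≡ false

delete : ∀ {n} → Fin (suc n) → Adj (suc n) → Adj n
delete v A i j = A (punchIn v i) (punchIn v j)

-- Edge contraction of the edge uv (u ≠ v): vertex v is removed and u is
-- made adjacent to every (other) neighbour of u or of v.  No loops or
-- multi-edges arise (simple graphs).

contract : ∀ {n} → (u v : Fin (suc n)) → Adj (suc n) → Adj n
contract u v A i j =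
  not (isYes (i ≟ j)) ∧
  (A i' j' ∨ ((isYes (i' ≟ u) ∧ A v j') ∨ (isYes (j' ≟ u) ∧ A i' v)))
  where
  i' = punchIn v i
  j' = punchIn v j

Iso : ∀ {m n} → Adj m → Adj n → Set
Iso {m} {n} H G = Σ (Fin m ↔ Fin n) λ f →
  ∀ i j → H i j ≡ G (Inverse.to f i) (Inverse.to f j)

data IndMinor {m} (H : Adj m) : ∀ {n} → Adj n → Set where
  iso : ∀ {n} {G : Adj n} → Iso H G → IndMinor H G
  del : ∀ {n} {G : Adj (suc n)} (v : Fin (suc n)) →
        IndMinor H (delete v G) → IndMinor H G
  con : ∀ {n} {G : Adj (suc n)} (u v : Fin (suc n)) → G u v ≡ true →
        IndMinor H (contract u v G) → IndMinor H G

-- The kite K: vertices 1..5 (here 0..4), edges 12,23,24,34,35,45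
-- (here 01,12,13,23,24,34).

kiteE : Fin 5 → Fin 5 → Bool
kiteE zero (suc zero) = true
kiteE (suc zero) (suc (suc zero)) = true
kiteE (suc zero) (suc (suc (suc zero))) = true
kiteE (suc (suc zero)) (suc (suc (suc zero))) = true
kiteE (suc (suc zero)) (suc (suc (suc (suc zero)))) = true
kiteE (suc (suc (suc zero))) (suc (suc (suc (suc zero)))) = true
kiteE _ _ = false

kiteAdj : Adj 5
kiteAdj i j = kiteE i j ∨ kiteE j i

kite : Graph
kite = record
  { size = 5 ; adj = kiteAdj
  ; sym = λ i j → ∨-comm (kiteE i j) (kiteE j i)
  ; irrefl = λ { zero → refl ; (suc zero) → refl ; (suc (suc zero)) → refl
               ; (suc (suc (suc zero))) → refl
               ; (suc (suc (suc (suc zero)))) → refl } }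

-- Model of computation: deterministic single-tape Turing machines.
-- Tape alphabet Fin (3 + k): 0 = blank, 1 = bit false, 2 = bit true,
-- further symbols are auxiliary.  States Fin (suc q), start state 0.
-- A transition either halts with a Boolean answer, or writes a symbol,
-- moves the head and changes state.

data Move : Set where
  left right stay : Move

record TM : Set where
  field
    nStates : ℕ
    nExtra  : ℕ
    δ : Fin (suc nStates) → Fin (3 + nExtra) →
        Bool ⊎ (Fin (suc nStates) × Fin (3 + nExtra) × Move)

module _ (M : TM) where
  open TM M

  Sym = Fin (3 + nExtra)

  record Config : Set where
    constructor cfg
    field
      state : Fin (suc nStates)
      lft   : List Sym   -- cells left of the head, nearest first
      hd    : Sym
      rgt   : List Sym   -- cells right of the head, nearest first

  blank : Sym
  blank = zero

  moveHead : List Sym → Sym → List Sym → Move → List Sym × Sym × List Sym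
  moveHead [] s r left = [] , blank , s ∷ r
  moveHead (x ∷ l) s r left = l , x , s ∷ r
  moveHead l s [] right = s ∷ l , blank , []
  moveHead l s (x ∷ r) right = s ∷ l , x , r
  moveHead l s r stay = l , s , r

  run : ℕ → Config → Maybe Bool
  run zero c = nothing
  run (suc t) (cfg q l h r) with δ q h
  ... | inj₁ b = just b
  ... | inj₂ (q' , s , m) with moveHead l s r m
  ...   | (l' , h' , r') = run t (cfg q' l' h' r')

  bitSym : Bool → Sym
  bitSym false = suc zero
  bitSym true  = suc (suc zero)

  initial : List Bool → Config
  initial [] = cfg zero [] blank []
  initial (b ∷ w) = cfg zero [] (bitSym b) (map bitSym w)

encode : Graph → List Bool
encode G = replicate n true ++ (false ∷ concat (map (λ i → map (λ j → adj i j) (allFin n)) (allFin n)))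
  where
  open Graph G renaming (size to n)

PolyTimeDecidable : (Graph → Set) → Set
PolyTimeDecidable P =
  Σ TM λ M → Σ ℕ λ c → Σ ℕ λ d → ∀ (G : Graph) →
    Σ ℕ λ t → t ≤ c * (length (encode G) ^ d) + c ×
    Σ Bool λ b → run M t (initial M (encode G)) ≡ just b × ((b ≡ true) ⇔ P G)

HInducedMinor : Graph → Graph → Set
HInducedMinor H G = IndMinor (Graph.adj H) (Graph.adj G)

{-# OPTIONS --safe #-}

-- A kite model in G can be normalised. The part of 1 shrinks to a vertex a. The part of 5 shrinks to a
-- vertex d, the rest of it being absorbed by the part of 3. The part of 2 is reduced along a walk that
-- starts in N(a) and touches the parts of 3 and 4: an end of the walk outside N(a) is absorbed by the part
-- it touches, and when both ends lie in N(a), they and a form the new part of 2, with an inner vertex of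
-- the walk as the new a. So at most three vertices u, v, w are left in the part of 2. The parts of 3 and 4
-- then exist exactly if, outside N[a], u, v, w and d, some component contains two disjoint paths from N(d)
-- to N({u , v , w}); by Menger's theorem this holds if no single vertex z separates N(d) from N({u , v , w})
-- in that component.
--
-- The resulting criterion is a first-order formula with reachability. A Turing machine evaluates such
-- formulas in polynomial time by keeping, on the input tape, a mark for each variable and for the set of
-- vertices reached so far; every elementary operation is one sweep over the tape.

module Submission where

open import Defs
open import Data.Nat using (ℕ; zero; suc; _+_; _*_; _^_; _≤_; _<_; z≤n; s≤s; _≡ᵇ_; _≤?_; NonZero; >-nonZero)
open import Data.Nat.Properties using (*-distribʳ-+; *-identityʳ; *-identityˡ; *-mono-≤; *-monoʳ-≤; *-monoˡ-≤; +-assoc; +-comm; +-identityʳ; +-mono-≤; +-monoʳ-≤; +-monoˡ-≤; +-suc; <-irrefl; <-trans; <-≤-trans; <⇒≢; <⇒≤; <⇒≱; ^-distribˡ-+-*; ^-monoʳ-≤; m<m+n; m<n+m; m<n⇒m<1+n; m≤m+n; m≤n+m; m≤n⇒m<n∨m≡n; m≤n⇒m≤1+n; n≤1+n; ≡ᵇ⇒≡; ≤-<-trans; ≤-antisym; ≤-pred; ≤-refl; ≤-reflexive; ≤-trans; ≤∧≢⇒<)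
open import Data.Nat.Tactic.RingSolver using (solve-∀)
open import Data.Fin using (Fin; zero; suc; toℕ; fromℕ<; _≟_; _↑ˡ_; _↑ʳ_; splitAt; punchIn; punchOut; #_)
open import Data.Fin.Patterns
open import Data.Fin.Properties using (splitAt-↑ˡ; splitAt-↑ʳ; toℕ<n; toℕ-injective; toℕ-fromℕ<; any?; punchIn-punchOut; punchInᵢ≢i; punchIn-injective)
open import Data.Fin.Subset using (Subset; ∣_∣; _∈_; _∉_; _⊆_; _⊃_; _∪_; ⁅_⁆)
open import Data.Fin.Subset.Properties using (_∈?_; x∈p∪q⁻; p⊆p∪q; q⊆p∪q; x∈⁅x⁆; x∈⁅y⁆⇒x≡y; ∣p∣≤n; ∣p∣≡n⇒p≡⊤; p⊂q⇒∣p∣<∣q∣; ∈⊤)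
open import Data.Fin.Subset.Induction using (⊃-wellFounded)
open import Data.Bool using (Bool; true; false; if_then_else_; not; _∧_; _∨_) renaming (_≟_ to _≟ᵇ_)
open import Data.Bool.Properties using (T-≡; ∨-assoc; ∨-identityʳ; ∨-zeroʳ)
open import Data.Empty using (⊥)
open import Data.List using (List; []; _∷_; map; _++_; length; _ʳ++_; concat; replicate; allFin)
import Data.List as List
open import Data.List.Properties using (ʳ++-ʳ++; length-ʳ++; length-++; length-replicate; length-map; length-tabulate; map-tabulate; ++-identityʳ)
open import Data.List.Relation.Unary.All using (All; []; _∷_)
open import Data.Maybe using (Maybe; just; nothing; maybe)
import Data.Maybe as Maybe
open import Data.Maybe.Properties using (just-injective; ≡-dec)
open import Data.Product using (Σ; _×_; _,_; proj₁; proj₂; map₁)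
open import Data.Sum using (_⊎_; inj₁; inj₂; [_,_]′)
import Data.Sum as Sum
open import Data.Unit using (⊤; tt)
open import Data.Vec using (Vec; []; _∷_; lookup; tabulate)
open import Data.Vec.Properties using (tabulate-cong; lookup∘tabulate; lookup⇒[]=; []=⇒lookup)
open import Function using (_∘_; id; case_of_)
open import Function.Bundles using (_⇔_; mk⇔; mk↔ₛ′; Equivalence; Inverse)
open import Induction.WellFounded using (Acc; acc)
open import Relation.Nullary using (¬_; Dec; yes; no; does; Reflects; ofʸ; ofⁿ; contradiction; _because_)
open import Relation.Nullary.Decidable using (True; toWitness; isYes; decidable-stable; dec-true; dec-false; _×-dec_; _⊎-dec_; ¬?)
open import Relation.Nullary.Reflects using (¬-reflects; _×-reflects_; _⊎-reflects_)
open import Relation.Binary.PropositionalEquality using (_≡_; _≢_; refl; sym; trans; cong; cong₂; cong-app; subst; subst₂)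

-- Structured programs and their Turing machines

-- The obstacle is that the part of 2 in a model has unbounded size. A vertex outside N(a) can be
-- handed to the part of 3 or 4 that it touches; a neighbour of a cannot, since those parts must
-- stay nonadjacent to a. A walk with both ends in N(a) therefore resists shortening, and only a
-- change of roles bounds it: the old a links the two ends, and an inner vertex that touches neither
-- part is fit to represent 1. No model is assumed to be minimal; the reduction is a recursion on
-- the walk.
--
-- A formula cannot quantify over paths. Menger's theorem replaces two disjoint paths by a universal
-- quantifier over z, which one more marked vertex runs through. It is proved here for connected
-- sets in place of paths, so that only ears have to be simple. The two sets that it yields may be
-- nonadjacent, although 3 and 4 are adjacent in the kite; as both lie in the component of r, one of
-- them is grown until it touches the other.
--
-- The number of quantifiers is fixed, and each costs a factor linear in the input length, so a
-- polynomial bound can be built along with the correctness proof.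

record Finite (A : Set) : Set where
  field
    size    : ℕ
    enc     : A → Fin size
    dec     : Fin size → A
    dec-enc : ∀ a → dec (enc a) ≡ a

open Finite

⊤-finite : Finite ⊤
⊤-finite = record { size = 1 ; enc = λ _ → zero ; dec = λ _ → tt ; dec-enc = λ _ → refl }

⊎-finite : ∀ {A B} → Finite A → Finite B → Finite (A ⊎ B)
⊎-finite {A} {B} F H = record { size = size F + size H ; enc = e ; dec = d ; dec-enc = de }
  where
  e : A ⊎ B → Fin (size F + size H)
  e (inj₁ a) = enc F a ↑ˡ size H
  e (inj₂ b) = size F ↑ʳ enc H b
  d : Fin (size F + size H) → A ⊎ B
  d i = Sum.map (dec F) (dec H) (splitAt (size F) i)
  de : ∀ x → d (e x) ≡ x
  de (inj₁ a) rewrite splitAt-↑ˡ (size F) (enc F a) (size H) = cong inj₁ (dec-enc F a)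
  de (inj₂ b) rewrite splitAt-↑ʳ (size F) (size H) (enc H b) = cong inj₂ (dec-enc H b)

retract-finite : ∀ {A B : Set} (f : A → B) (g : B → A) → (∀ a → g (f a) ≡ a) → Finite B → Finite A
retract-finite f g gf F = record
  { size = size F ; enc = λ a → enc F (f a) ; dec = λ i → g (dec F i)
  ; dec-enc = λ a → trans (cong g (dec-enc F (f a))) (gf a) }

Bool×-finite : ∀ {A} → Finite A → Finite (Bool × A)
Bool×-finite {A} F = retract-finite f g gf (⊎-finite F F)
  where
  f : Bool × A → A ⊎ A
  f (false , a) = inj₁ a
  f (true , a) = inj₂ a
  g : A ⊎ A → Bool × A
  g = [ false ,_ , true ,_ ]′
  gf : ∀ x → g (f x) ≡ x
  gf (false , a) = refl
  gf (true , a) = refl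

bits-finite : ∀ k → Finite (Vec Bool k)
bits-finite zero = retract-finite (λ _ → tt) (λ _ → []) (λ { [] → refl }) ⊤-finite
bits-finite (suc k) =
  retract-finite (λ { (b ∷ v) → b , v }) (λ { (b , v) → b ∷ v }) (λ { (b ∷ v) → refl })
    (Bool×-finite (bits-finite k))

infixr 5 _⨾_

-- The Boolean argument of a transition or of a loop guard is a one-bit register
-- kept in the finite control; ifte branches on it.
data Prog (A : Set) : Set where
  act   : (Bool → A → Bool × A × Move) → Prog A
  _⨾_   : Prog A → Prog A → Prog A
  ifte  : Prog A → Prog A → Prog A
  while : (Bool → A → Bool) → Prog A → Prog A

Tape : Set → Set
Tape A = List A × A × List A

module _ {A : Set} (␣ : A) where

  mv : Move → List A → A → List A → Tape A
  mv left  []      s r       = [] , ␣ , s ∷ r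
  mv left  (x ∷ l) s r       = l , x , s ∷ r
  mv right l       s []      = s ∷ l , ␣ , []
  mv right l       s (x ∷ r) = s ∷ l , x , r
  mv stay  l       s r       = l , s , r

  perform : Bool × A × Move → Tape A → Bool × Tape A
  perform (b , s , m) (l , _ , r) = b , mv m l s r

  -- The last index counts machine steps exactly: branching and every evaluation of a loop guard
  -- cost one step each.
  data Exec : Prog A → Bool × Tape A → Bool × Tape A → ℕ → Set where
    act     : ∀ {f b l h r} → Exec (act f) (b , l , h , r) (perform (f b h) (l , h , r)) 1
    seq     : ∀ {p q c c′ c″ t t′} → Exec p c c′ t → Exec q c′ c″ t′ → Exec (p ⨾ q) c c″ (t + t′)
    if-yes  : ∀ {p q τ c t} → Exec p (true , τ) c t → Exec (ifte p q) (true , τ) c (suc t)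
    if-no   : ∀ {p q τ c t} → Exec q (false , τ) c t → Exec (ifte p q) (false , τ) c (suc t)
    done    : ∀ {g p b l h r} → g b h ≡ false →
              Exec (while g p) (b , l , h , r) (b , l , h , r) 1
    again   : ∀ {g p b l h r c c′ t t′} → g b h ≡ true → Exec p (b , l , h , r) c t →
              Exec (while g p) c c′ t′ → Exec (while g p) (b , l , h , r) c′ (suc (t + t′))

  -- The program counter. Branches and loop guards own a position, `inj₁ tt`, at which the machine
  -- spends a step without touching the tape.
  Point : Prog A → Set
  Point (act _)     = ⊤
  Point (p ⨾ q)     = Point p ⊎ Point q
  Point (ifte p q)  = ⊤ ⊎ (Point p ⊎ Point q)
  Point (while _ p) = ⊤ ⊎ Point p

  Point-finite : ∀ p → Finite (Point p)
  Point-finite (act _)     = ⊤-finite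
  Point-finite (p ⨾ q)     = ⊎-finite (Point-finite p) (Point-finite q)
  Point-finite (ifte p q)  = ⊎-finite ⊤-finite (⊎-finite (Point-finite p) (Point-finite q))
  Point-finite (while _ p) = ⊎-finite ⊤-finite (Point-finite p)

  firstPoint : ∀ p → Point p
  firstPoint (act _)     = tt
  firstPoint (p ⨾ q)     = inj₁ (firstPoint p)
  firstPoint (ifte _ _)  = inj₁ tt
  firstPoint (while _ _) = inj₁ tt

  -- Leaving a subprogram that has a successor means continuing at `z`, so the result is always
  -- `just`.
  resume : ∀ {P Q : Set} → (P → Q) → Q → Maybe P → Maybe Q
  resume f z y = just (maybe f z y)

  -- nothing in the first component means that the program is left
  next : ∀ p → Point p → Bool → A → Maybe (Point p) × Bool × A × Move
  next (act f) tt b h = nothing , f b h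
  next (p ⨾ q) (inj₁ x) b h = map₁ (resume inj₁ (inj₂ (firstPoint q))) (next p x b h)
  next (p ⨾ q) (inj₂ x) b h = map₁ (Maybe.map inj₂) (next q x b h)
  next (ifte p q) (inj₁ tt) b h =
    just (inj₂ (if b then inj₁ (firstPoint p) else inj₂ (firstPoint q))) , b , h , stay
  next (ifte p q) (inj₂ (inj₁ x)) b h =
    map₁ (Maybe.map (λ y → inj₂ (inj₁ y))) (next p x b h)
  next (ifte p q) (inj₂ (inj₂ x)) b h =
    map₁ (Maybe.map (λ y → inj₂ (inj₂ y))) (next q x b h)
  next (while g p) (inj₁ tt) b h = (if g b h then just (inj₂ (firstPoint p)) else nothing) , b , h , stay
  next (while g p) (inj₂ x) b h = map₁ (resume inj₂ (inj₁ tt)) (next p x b h)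

  data Runs (p : Prog A) : Point p → Bool × Tape A → Bool × Tape A → ℕ → Set where
    exit : ∀ {x b l h r a} → next p x b h ≡ (nothing , a) →
           Runs p x (b , l , h , r) (perform a (l , h , r)) 1
    more : ∀ {x y b l h r a c t} → next p x b h ≡ (just y , a) →
           Runs p y (perform a (l , h , r)) c t → Runs p x (b , l , h , r) c (suc t)

  module _ {p q : Prog A} where

    seq-snd : ∀ {x c c′ t} → Runs q x c c′ t → Runs (p ⨾ q) (inj₂ x) c c′ t
    seq-snd (exit e) = exit (cong (map₁ (Maybe.map inj₂)) e)
    seq-snd (more e r) = more (cong (map₁ (Maybe.map inj₂)) e) (seq-snd r)

    seq-fst : ∀ {x c c′ c″ t t′} → Runs p x c c′ t → Runs q (firstPoint q) c′ c″ t′ →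
              Runs (p ⨾ q) (inj₁ x) c c″ (t + t′)
    seq-fst (exit e) s = more (cong (map₁ (resume inj₁ (inj₂ (firstPoint q)))) e) (seq-snd s)
    seq-fst (more e r) s = more (cong (map₁ (resume inj₁ (inj₂ (firstPoint q)))) e) (seq-fst r s)

    if-fst : ∀ {x c c′ t} → Runs p x c c′ t → Runs (ifte p q) (inj₂ (inj₁ x)) c c′ t
    if-fst (exit e) = exit (cong (map₁ (Maybe.map (λ y → inj₂ (inj₁ y)))) e)
    if-fst (more e r) = more (cong (map₁ (Maybe.map (λ y → inj₂ (inj₁ y)))) e) (if-fst r)

    if-snd : ∀ {x c c′ t} → Runs q x c c′ t → Runs (ifte p q) (inj₂ (inj₂ x)) c c′ t
    if-snd (exit e) = exit (cong (map₁ (Maybe.map (λ y → inj₂ (inj₂ y)))) e)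
    if-snd (more e r) = more (cong (map₁ (Maybe.map (λ y → inj₂ (inj₂ y)))) e) (if-snd r)

  while-body : ∀ {g p x c c′ c″ t t′} → Runs p x c c′ t → Runs (while g p) (inj₁ tt) c′ c″ t′ →
               Runs (while g p) (inj₂ x) c c″ (t + t′)
  while-body (exit e) s = more (cong (map₁ (resume inj₂ (inj₁ tt))) e) s
  while-body (more e r) s = more (cong (map₁ (resume inj₂ (inj₁ tt))) e) (while-body r s)

  exec-runs : ∀ {p c c′ t} → Exec p c c′ t → Runs p (firstPoint p) c c′ t
  exec-runs act = exit refl
  exec-runs (seq e f) = seq-fst (exec-runs e) (exec-runs f)
  exec-runs (if-yes e) = more refl (if-fst (exec-runs e))
  exec-runs (if-no e) = more refl (if-snd (exec-runs e))
  exec-runs (done e) = exit (cong (λ z → (if z then _ else nothing) , _) e)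
  exec-runs (again e f g) =
    more (cong (λ z → (if z then _ else nothing) , _) e) (while-body (exec-runs f) (exec-runs g))

-- The blank and the two bits must get the numbers prescribed by `TM`. A retraction suffices, as the
-- machine only meets codes of symbols.
record Coding (A : Set) (␣ : A) (bit : Bool → A) : Set where
  field
    extra    : ℕ
    code     : A → Fin (3 + extra)
    decode   : Fin (3 + extra) → A
    decode-code : ∀ a → decode (code a) ≡ a
    code-blank  : code ␣ ≡ zero
    code-bit    : ∀ b → code (bit b) ≡ (if b then suc (suc zero) else suc zero)

module _ {A : Set} {␣ : A} {bit : Bool → A} (K : Coding A ␣ bit) (p : Prog A) where
  open Coding K

  private
    F : Finite (Bool × Point ␣ p)
    F = Bool×-finite (Point-finite ␣ p)

    answer : Maybe (Point ␣ p) × Bool × A × Move →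
             Bool ⊎ (Fin (suc (size F)) × Fin (3 + extra) × Move)
    answer (nothing , b , _) = inj₁ b
    answer (just y , b , s , m) = inj₂ (suc (enc F (b , y)) , code s , m)

    respond : Bool × Point ␣ p → A → Bool ⊎ (Fin (suc (size F)) × Fin (3 + extra) × Move)
    respond (b , x) h = answer (next ␣ p x b h)

  machine : TM
  machine = record
    { nStates = size F ; nExtra = extra
    -- State 0 is prescribed as the start, whereas `enc` may put the first program point anywhere;
    -- this extra step is the `suc` in `machine-run`.
    ; δ = λ { zero s → inj₂ (suc (enc F (false , firstPoint ␣ p)) , s , stay)
            ; (suc q) s → respond (dec F q) (decode s) } }

  private
    config : Fin (suc (size F)) → Tape A → Config machine
    config q (l , h , r) = cfg q (map code l) (code h) (map code r)

    moved : Fin (suc (size F)) → List (Sym machine) × Sym machine × List (Sym machine) → Config machine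
    moved q (l , h , r) = cfg q l h r

    move-code : ∀ q m l s r →
                moved q (moveHead machine (map code l) (code s) (map code r) m) ≡ config q (mv ␣ m l s r)
    move-code q left [] s r rewrite code-blank = refl
    move-code q left (x ∷ l) s r = refl
    move-code q right [] s [] rewrite code-blank = refl
    move-code q right (x ∷ l) s [] rewrite code-blank = refl
    move-code q right [] s (x ∷ r) = refl
    move-code q right (y ∷ l) s (x ∷ r) = refl
    move-code q stay [] s [] = refl
    move-code q stay [] s (y ∷ r) = refl
    move-code q stay (x ∷ l) s [] = refl
    move-code q stay (x ∷ l) s (y ∷ r) = refl

    runs-run : ∀ {x b τ b′ τ′ t} → Runs ␣ p x (b , τ) (b′ , τ′) t →
               run machine t (config (suc (enc F (b , x))) τ) ≡ just b′
    runs-run {x} {b} {l , h , r} (exit e)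
      rewrite dec-enc F (b , x) | decode-code h | e = refl
    runs-run {x} {b} {l , h , r} (more {y = y} {a = b₁ , s , m} {t = t} e rs)
      rewrite dec-enc F (b , x) | decode-code h | e =
      trans (cong (run machine t) (move-code (suc (enc F (b₁ , y))) m l s r)) (runs-run rs)

  machine-run : ∀ {x w b′ τ′ t} →
                Exec ␣ p (false , [] , bit x , map bit w) (b′ , τ′) t →
                run machine (suc t) (initial machine (x ∷ w)) ≡ just b′
  machine-run {x} {w} {t = t} e = trans (cong (run machine t) same) (runs-run (exec-runs ␣ e))
    where
    bit-sym : ∀ b → bitSym machine b ≡ code (bit b)
    bit-sym false = sym (code-bit false)
    bit-sym true = sym (code-bit true)
    bits-sym : ∀ v → map (bitSym machine) v ≡ map code (map bit v)
    bits-sym [] = refl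
    bits-sym (b ∷ v) = cong₂ _∷_ (bit-sym b) (bits-sym v)
    q₁ = suc (enc F (false , firstPoint ␣ p))
    same : moved q₁ (moveHead machine [] (bitSym machine x) (map (bitSym machine) w) stay)
           ≡ config q₁ ([] , bit x , map bit w)
    same = trans (cong₂ (λ h r → moved q₁ (moveHead machine [] h r stay)) (bit-sym x) (bits-sym w))
                 (move-code q₁ stay [] (bit x) (map bit w))

-- Sweeps over a marked tape

data Symbol (P : ℕ) : Set where
  empty : Symbol P
  raw   : Bool → Symbol P
  cell  : Bool → Vec Bool P → Symbol P

symbol-coding : ∀ P → Coding (Symbol P) empty raw
symbol-coding P = record
  { extra = size F ; code = code ; decode = decode ; decode-code = decode-code
  ; code-blank = refl ; code-bit = λ { false → refl ; true → refl } }
  where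
  F = bits-finite (suc P)
  code : Symbol P → Fin (3 + size F)
  code empty = zero
  code (raw false) = suc zero
  code (raw true) = suc (suc zero)
  code (cell b v) = suc (suc (suc (enc F (b ∷ v))))
  marked : Vec Bool (suc P) → Symbol P
  marked (b ∷ v) = cell b v
  decode : Fin (3 + size F) → Symbol P
  decode zero = empty
  decode (suc zero) = raw false
  decode (suc (suc zero)) = raw true
  decode (suc (suc (suc i))) = marked (dec F i)
  decode-code : ∀ a → decode (code a) ≡ a
  decode-code empty = refl
  decode-code (raw false) = refl
  decode-code (raw true) = refl
  decode-code (cell b v) = cong marked (dec-enc F (b ∷ v))

nonblank : ∀ {P} → Symbol P → Bool
nonblank empty = false
nonblank _ = true

pt : ℕ → ℕ → Bool
pt i j = j ≡ᵇ i

bit : List Bool → ℕ → Bool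
bit [] i = false
bit (c ∷ w) zero = c
bit (c ∷ w) (suc i) = bit w i

module _ {P : ℕ} where

  Program : Set
  Program = Prog (Symbol P)

  Ex : Program → Bool × Tape (Symbol P) → Bool × Tape (Symbol P) → ℕ → Set
  Ex = Exec empty

  cast-exec : ∀ {p c c₀ c₁ c₁′ t t′} → c ≡ c₀ → c₁ ≡ c₁′ → t ≡ t′ → Ex p c₀ c₁ t → Ex p c c₁′ t′
  cast-exec refl refl refl e = e

  -- Between sweeps the head rests on the blank before the word. `f` acts on the way right; the way
  -- back changes nothing.
  sweep : (Bool → Bool) → (Bool → Symbol P → Bool × Symbol P) → Program
  sweep i f =
    act (λ b s → i b , s , right) ⨾
    while (λ _ → nonblank) (act (λ b s → proj₁ (f b s) , proj₂ (f b s) , right)) ⨾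
    act (λ b s → b , s , left) ⨾
    while (λ _ → nonblank) (act (λ b s → b , s , left))

  accum : (Bool → Symbol P → Bool × Symbol P) → Bool → List (Symbol P) → Bool × List (Symbol P)
  accum f b [] = b , []
  accum f b (s ∷ ss) = let b′ , ss′ = accum f (proj₁ (f b s)) ss in b′ , proj₂ (f b s) ∷ ss′

  atʳ : List (Symbol P) → List (Symbol P) → Tape (Symbol P)
  atʳ l [] = l , empty , []
  atʳ l (x ∷ r) = l , x , r

  private
    atˡ : List (Symbol P) → List (Symbol P) → Tape (Symbol P)
    atˡ [] r = [] , empty , r
    atˡ (x ∷ l) r = l , x , r

    mv-right : ∀ l s r → mv empty right l s r ≡ atʳ (s ∷ l) r
    mv-right l s [] = refl
    mv-right l s (x ∷ r) = refl

    mv-left : ∀ l s r → mv empty left l s r ≡ atˡ l (s ∷ r)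
    mv-left [] s r = refl
    mv-left (x ∷ l) s r = refl

    module _ (f : Bool → Symbol P → Bool × Symbol P) where

      right-pass : ∀ {tl} → (∀ l → atʳ l tl ≡ (l , empty , [])) → ∀ b l xs →
                   All (λ s → nonblank s ≡ true) xs →
                   Ex (while (λ _ → nonblank) (act (λ b s → proj₁ (f b s) , proj₂ (f b s) , right)))
                      (b , atʳ l (xs ++ tl))
                      (proj₁ (accum f b xs) , proj₂ (accum f b xs) ʳ++ l , empty , [])
                      (length xs + length xs + 1)
      right-pass end b l [] [] rewrite end l = done refl
      right-pass {tl} end b l (x ∷ xs) (nb ∷ nbs) =
        cast-exec refl refl (cong suc (cong (_+ 1) (sym (+-suc (length xs) (length xs)))))
          (again nb act
            (cast-exec (cong (_ ,_) (mv-right l (proj₂ (f b x)) (xs ++ tl))) refl refl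
              (right-pass end (proj₁ (f b x)) (proj₂ (f b x) ∷ l) xs nbs)))

    left-pass : ∀ b zs r → All (λ s → nonblank s ≡ true) zs →
                Ex (while (λ _ → nonblank) (act (λ b s → b , s , left)))
                   (b , atˡ (zs ++ empty ∷ []) r) (b , [] , empty , zs ʳ++ r)
                   (length zs + length zs + 1)
    left-pass b [] r [] = done refl
    left-pass b (z ∷ zs) r (nb ∷ nbs) =
      cast-exec refl refl (cong suc (cong (_+ 1) (sym (+-suc (length zs) (length zs)))))
        (again nb act
          (cast-exec (cong (b ,_) (mv-left (zs ++ empty ∷ []) z r)) refl refl
            (left-pass b zs (z ∷ r) nbs)))

    all-ʳ++ : ∀ {Q : Symbol P → Set} {xs ys} → All Q xs → All Q ys → All Q (xs ʳ++ ys)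
    all-ʳ++ [] qs = qs
    all-ʳ++ (p ∷ ps) qs = all-ʳ++ ps (p ∷ qs)

    ʳ++-append : ∀ (xs : List (Symbol P)) {ys zs} → (xs ʳ++ ys) ++ zs ≡ xs ʳ++ (ys ++ zs)
    ʳ++-append [] = refl
    ʳ++-append (x ∷ xs) = ʳ++-append xs

  accum-length : ∀ f b xs → length (proj₂ (accum f b xs)) ≡ length xs
  accum-length f b [] = refl
  accum-length f b (x ∷ xs) = cong suc (accum-length f _ xs)

  module _ (i : Bool → Bool) (f : Bool → Symbol P → Bool × Symbol P) where
    private
      time : ∀ m → 1 + (m + m + 1 + (1 + (m + m + 1))) ≡ 4 * m + 4
      time = solve-∀

    -- Two passes with a guard and an action per cell give four steps for each cell. Before the
    -- first sweep nothing is recorded beyond the word; afterwards the blank reached there is an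
    -- explicit cell. The hypothesis on `tl` covers both, since they look alike to the head.
    sweep-exec : ∀ {tl b xs b′ ys} → (∀ l → atʳ l tl ≡ (l , empty , [])) →
                 All (λ s → nonblank s ≡ true) xs → All (λ s → nonblank s ≡ true) ys →
                 accum f (i b) xs ≡ (b′ , ys) →
                 Ex (sweep i f) (b , [] , empty , xs ++ tl) (b′ , [] , empty , ys ++ empty ∷ [])
                    (4 * length xs + 4)
    sweep-exec {tl} {b} {xs} end nbs nbs′ refl =
      cast-exec refl refl (time (length xs))
        (seq act (cast-exec (cong (i b ,_) (mv-right [] empty (xs ++ tl))) refl refl
          (seq (right-pass f end (i b) (empty ∷ []) xs nbs)
            (seq act (cast-exec
              (cong (b₁ ,_) (trans (mv-left (ys ʳ++ empty ∷ []) empty [])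
                                  (cong (λ l → atˡ l (empty ∷ [])) (sym (ʳ++-append ys {[]})))))
              (cong (λ r → b₁ , [] , empty , r) (ʳ++-ʳ++ ys)) zs-time
              (left-pass _ (ys ʳ++ []) (empty ∷ []) (all-ʳ++ nbs′ [])))))))
      where
      b₁ = proj₁ (accum f (i b) xs)
      ys = proj₂ (accum f (i b) xs)
      zs-len : length (ys ʳ++ []) ≡ length xs
      zs-len = trans (length-ʳ++ ys) (trans (+-identityʳ _) (accum-length f (i b) xs))
      zs-time : length (ys ʳ++ []) + length (ys ʳ++ []) + 1 ≡ length xs + length xs + 1
      zs-time = cong (λ m → m + m + 1) zs-len

  -- M y i tells whether cell i carries a mark on track y.
  Memory : Set
  Memory = Fin P → ℕ → Bool

  _≈_ : Memory → Memory → Set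
  M ≈ N = ∀ y i → M y i ≡ N y i

  tail : Memory → Memory
  tail M y i = M y (suc i)

  column : Memory → Vec Bool P
  column M = tabulate (λ y → M y 0)

  -- A memory is an infinite table, of which the tape holds the first `length w` columns.
  cells : List Bool → Memory → List (Symbol P)
  cells [] M = []
  cells (c ∷ w) M = cell c (column M) ∷ cells w (tail M)

  cells-cong : ∀ w {M N} → M ≈ N → cells w M ≡ cells w N
  cells-cong [] e = refl
  cells-cong (c ∷ w) e =
    cong₂ _∷_ (cong (cell c) (tabulate-cong (λ y → e y 0))) (cells-cong w (λ y i → e y (suc i)))

  cells-nonblank : ∀ w M → All (λ s → nonblank s ≡ true) (cells w M)
  cells-nonblank [] M = []
  cells-nonblank (c ∷ w) M = refl ∷ cells-nonblank w (tail M)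

  cells-length : ∀ w M → length (cells w M) ≡ length w
  cells-length [] M = refl
  cells-length (c ∷ w) M = cong suc (cells-length w (tail M))

  infixl 5 _[_↦_]

  _[_↦_] : Memory → Fin P → (ℕ → Bool) → Memory
  (M [ x ↦ f ]) y = if does (y ≟ x) then f else M y

  update-≡ : ∀ M x f → (M [ x ↦ f ]) x ≡ f
  update-≡ M x f rewrite dec-true (x ≟ x) refl = refl

  update-≢ : ∀ M {x y} f → y ≢ x → (M [ x ↦ f ]) y ≡ M y
  update-≢ M {x} {y} f ne rewrite dec-false (y ≟ x) ne = refl

  rest : List Bool → Memory → Bool → Bool × Tape (Symbol P)
  rest w M b = b , [] , empty , cells w M ++ empty ∷ []

  -- A Hoare triple for total correctness with a time bound: the final memory, the register and the
  -- execution are exhibited.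
  Triple : List Bool → Program → Memory → Bool → ℕ → (Memory → Bool → Set) → Set
  Triple w p M b T Q =
    Σ Memory λ M′ → Σ Bool λ b′ → Σ ℕ λ t → t ≤ T × Ex p (rest w M b) (rest w M′ b′) t × Q M′ b′

  module _ {w : List Bool} where

    weaken : ∀ {p M b T T′ Q Q′} → T ≤ T′ → (∀ {M′ b′} → Q M′ b′ → Q′ M′ b′) →
             Triple w p M b T Q → Triple w p M b T′ Q′
    weaken le imp (M′ , b′ , t , t≤ , e , q) = M′ , b′ , t , ≤-trans t≤ le , e , imp q

    infixr 4 _then_

    _then_ : ∀ {p q M b T T′ Q Q′} → Triple w p M b T Q →
             (∀ {M′ b′} → Q M′ b′ → Triple w q M′ b′ T′ Q′) → Triple w (p ⨾ q) M b (T + T′) Q′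
    (M′ , b′ , t , t≤ , e , q) then k with k q
    ... | M″ , b″ , t′ , t′≤ , e′ , q′ = M″ , b″ , t + t′ , +-mono-≤ t≤ t′≤ , seq e e′ , q′

    branch-yes : ∀ {p q M T Q} → Triple w p M true T Q → Triple w (ifte p q) M true (suc T) Q
    branch-yes (M′ , b′ , t , t≤ , e , q) = M′ , b′ , suc t , s≤s t≤ , if-yes e , q

    branch-no : ∀ {p q M T Q} → Triple w q M false T Q → Triple w (ifte p q) M false (suc T) Q
    branch-no (M′ , b′ , t , t≤ , e , q) = M′ , b′ , suc t , s≤s t≤ , if-no e , q

  setReg : (Bool → Bool) → Program
  setReg f = act (λ b s → f b , s , stay)

  setReg-triple : ∀ {w f M b Q} → Q M (f b) → Triple w (setReg f) M b 1 Q
  setReg-triple q = _ , _ , 1 , ≤-refl , act , q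

  testing : (Bool → Vec Bool P → Bool) → Bool → Symbol P → Bool × Symbol P
  testing h b (cell c v) = b ∨ h c v , cell c v
  testing h b s = b , s

  test : (Bool → Vec Bool P → Bool) → Program
  test h = sweep (λ _ → false) (testing h)

  writing : Fin P → (Bool → Vec Bool P → Bool) → (Bool → Vec Bool P → Bool) →
            Bool → Symbol P → Bool × Symbol P
  writing x e k b (cell c v) =
    k b v , cell c (tabulate (λ y → if does (y ≟ x) then e b v else lookup v y))
  writing x e k b s = b , s

  write : Fin P → (Bool → Bool) → (Bool → Vec Bool P → Bool) → (Bool → Vec Bool P → Bool) → Program
  write x i e k = sweep i (writing x e k)

  holds : (Bool → Vec Bool P → Bool) → List Bool → Memory → Bool
  holds h [] M = false
  holds h (c ∷ w) M = h c (column M) ∨ holds h w (tail M)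

  test-triple : ∀ {w M b} h {Q} → Q M (holds h w M) → Triple w (test h) M b (4 * length w + 4) Q
  test-triple {w} {M} {b} h {Q} q =
    M , holds h w M , 4 * length (cells w M) + 4 ,
    ≤-reflexive (cong (λ m → 4 * m + 4) (cells-length w M)) ,
    sweep-exec _ _ (λ _ → refl) (cells-nonblank w M) (cells-nonblank w M) (scan false w M) , q
    where
    scan : ∀ b w M → accum (testing h) b (cells w M) ≡ (b ∨ holds h w M , cells w M)
    scan b [] M = cong (_, []) (sym (∨-identityʳ b))
    scan b (c ∷ w) M rewrite scan (b ∨ h c (column M)) w (tail M)
      | ∨-assoc b (h c (column M)) (holds h w (tail M)) = refl

  written : (Bool → Vec Bool P → Bool) → (Bool → Vec Bool P → Bool) → Bool → Memory → ℕ → Bool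
  written e k b M zero = e b (column M)
  written e k b M (suc i) = written e k (k b (column M)) (tail M) i

  -- The new track is specified at every position, also beyond the word where no cell stores it; so
  -- a pointer shifted past the end still has a definite place.
  write-triple : ∀ {w M b} x i e k {Q} →
                 (∀ f b′ → (∀ j → written e k (i b) M j ≡ f j) → Q (M [ x ↦ f ]) b′) →
                 Triple w (write x i e k) M b (4 * length w + 4) Q
  write-triple {w} {M} {b} x i e k {Q} q =
    M′ , b′ , 4 * length (cells w M) + 4 ,
    ≤-reflexive (cong (λ m → 4 * m + 4) (cells-length w M)) ,
    sweep-exec _ _ (λ _ → refl) (cells-nonblank w M) (cells-nonblank w M′) (cong (b′ ,_) (scan (i b) w M)) ,
    q (written e k (i b) M) b′ (λ _ → refl)
    where
    M′ = M [ x ↦ written e k (i b) M ]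
    b′ = proj₁ (accum (writing x e k) (i b) (cells w M))
    scan : ∀ b w M → proj₂ (accum (writing x e k) b (cells w M)) ≡ cells w (M [ x ↦ written e k b M ])
    scan b [] M = refl
    scan b (c ∷ w) M = cong₂ _∷_ (cong (cell c) (tabulate-cong same))
        (trans (scan (k b (column M)) w (tail M)) (cells-cong w later))
      where
      same : ∀ y → (if does (y ≟ x) then e b (column M) else lookup (column M) y)
                   ≡ (M [ x ↦ written e k b M ]) y 0
      same y with does (y ≟ x)
      ... | true = refl
      ... | false = lookup∘tabulate _ y
      later : (tail M [ x ↦ written e k (k b (column M)) (tail M) ]) ≈ tail (M [ x ↦ written e k b M ])
      later y i with does (y ≟ x)
      ... | true = refl
      ... | false = refl

  Marks : Memory → Fin P → ℕ → Set
  Marks M x i = ∀ j → M x j ≡ pt i j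

  -- In `shift` the register carries the old mark of the preceding cell; in `origin` it is true at
  -- the first cell only.
  shift origin clear : Fin P → Program
  shift x = write x (λ _ → false) (λ b _ → b) (λ _ v → lookup v x)
  origin x = write x (λ _ → true) (λ b _ → b) (λ _ _ → false)
  clear x = write x (λ b → b) (λ _ _ → false) (λ b _ → b)

  union : Fin P → Fin P → Program
  union x y = write x (λ b → b) (λ _ v → lookup v x ∨ lookup v y) (λ b _ → b)

  meet : Fin P → Fin P → Program
  meet x y = test (λ _ v → lookup v x ∧ lookup v y)

  readBit : Fin P → Program
  readBit x = test (λ c v → lookup v x ∧ c)

  module _ {w : List Bool} {M : Memory} {b : Bool} where
    private
      T = 4 * length w + 4

    shift-triple : ∀ x {i Q} → Marks M x i →
                   (∀ f b′ → (∀ j → f j ≡ pt (suc i) j) → Q (M [ x ↦ f ]) b′) →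
                   Triple w (shift x) M b T Q
    shift-triple x {i} mx q = write-triple {w = w} x _ _ _ λ f b′ e → q f b′ λ
        { zero → sym (e zero) ; (suc j) → trans (sym (e (suc j))) (trans (moved j false M) (mx j)) }
      where
      moved : ∀ j b M → written (λ b _ → b) (λ _ v → lookup v x) b M (suc j) ≡ M x j
      moved zero b M = lookup∘tabulate _ x
      moved (suc j) b M = moved j b (tail M)

    origin-triple : ∀ x {Q} → (∀ f b′ → (∀ j → f j ≡ pt 0 j) → Q (M [ x ↦ f ]) b′) →
                    Triple w (origin x) M b T Q
    origin-triple x q = write-triple {w = w} x _ _ _ λ f b′ e → q f b′ λ
        { zero → sym (e zero) ; (suc j) → trans (sym (e (suc j))) (off j (tail M)) }
      where
      off : ∀ j M → written (λ b _ → b) (λ _ _ → false) false M j ≡ false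
      off zero M = refl
      off (suc j) M = off j (tail M)

    clear-triple : ∀ x {Q} → (∀ f b′ → (∀ j → f j ≡ false) → Q (M [ x ↦ f ]) b′) →
                   Triple w (clear x) M b T Q
    clear-triple x q = write-triple {w = w} x _ _ _ λ f b′ e → q f b′ λ j →
        trans (sym (e j)) (off j M)
      where
      off : ∀ j M → written (λ _ _ → false) (λ b _ → b) b M j ≡ false
      off zero M = refl
      off (suc j) M = off j (tail M)

    union-triple : ∀ x y {Q} → (∀ f b′ → (∀ j → f j ≡ M x j ∨ M y j) → Q (M [ x ↦ f ]) b′) →
                   Triple w (union x y) M b T Q
    union-triple x y q = write-triple {w = w} x _ _ _ λ f b′ e → q f b′ λ j →
        trans (sym (e j)) (both j M)
      where
      both : ∀ j M → written (λ _ v → lookup v x ∨ lookup v y) (λ b _ → b) b M j ≡ M x j ∨ M y j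
      both zero M = cong₂ _∨_ (lookup∘tabulate _ x) (lookup∘tabulate _ y)
      both (suc j) M = both j (tail M)

  private
    holds-nowhere : ∀ x (h : Bool → Vec Bool P → Bool) w M → (∀ j → M x j ≡ false) → holds (λ c v → lookup v x ∧ h c v) w M ≡ false
    holds-nowhere x h [] M e = refl
    holds-nowhere x h (c ∷ w) M e
      rewrite lookup∘tabulate (λ y → M y 0) x | e 0 = holds-nowhere x h w (tail M) (λ j → e (suc j))

    holds-meet : ∀ x y w M {i} → Marks M x i → i < length w →
                 holds (λ _ v → lookup v x ∧ lookup v y) w M ≡ M y i
    holds-meet x y (c ∷ w) M {zero} mx lt
      rewrite lookup∘tabulate (λ y → M y 0) x | lookup∘tabulate (λ y → M y 0) y | mx 0 =
      trans (cong (M y 0 ∨_) (holds-nowhere x (λ _ v → lookup v y) w (tail M) (λ j → mx (suc j))))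
            (∨-identityʳ _)
    holds-meet x y (c ∷ w) M {suc i} mx (s≤s lt)
      rewrite lookup∘tabulate (λ y → M y 0) x | mx 0 = holds-meet x y w (tail M) (λ j → mx (suc j)) lt

    holds-bit : ∀ x w M {i} → Marks M x i → holds (λ c v → lookup v x ∧ c) w M ≡ bit w i
    holds-bit x [] M mx = refl
    holds-bit x (c ∷ w) M {zero} mx
      rewrite lookup∘tabulate (λ y → M y 0) x | mx 0 =
      trans (cong (c ∨_) (holds-nowhere x (λ c _ → c) w (tail M) (λ j → mx (suc j)))) (∨-identityʳ _)
    holds-bit x (c ∷ w) M {suc i} mx
      rewrite lookup∘tabulate (λ y → M y 0) x | mx 0 = holds-bit x w (tail M) (λ j → mx (suc j))

  module _ {w : List Bool} {M : Memory} {b : Bool} where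
    private
      T = 4 * length w + 4

    -- A mark beyond the word is invisible to the sweep, hence the bound on `i`. For `readBit` the
    -- default `false` of `bit` agrees with what the sweep then finds.
    meet-triple : ∀ x y {i Q} → Marks M x i → i < length w → Q M (M y i) →
                  Triple w (meet x y) M b T Q
    meet-triple x y {Q = Q} mx lt q = test-triple _ (subst (Q M) (sym (holds-meet x y w M mx lt)) q)

    readBit-triple : ∀ x {i Q} → Marks M x i → Q M (bit w i) → Triple w (readBit x) M b T Q
    readBit-triple x {Q = Q} mx q = test-triple _ (subst (Q M) (sym (holds-bit x w M mx)) q)

-- Deciding graph properties with pointer marks

-- Reified, so that unification can find the cost together with the program and `poly-bound` can
-- recurse on it.
data Poly : Set where
  cst : ℕ → Poly
  var : Poly
  _⊕_ _⊗_ : Poly → Poly → Poly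

infixl 6 _⊕_
infixl 7 _⊗_

⟦_⟧ : Poly → ℕ → ℕ
⟦ cst c ⟧ L = c
⟦ var ⟧ L = L
⟦ p ⊕ q ⟧ L = ⟦ p ⟧ L + ⟦ q ⟧ L
⟦ p ⊗ q ⟧ L = ⟦ p ⟧ L * ⟦ q ⟧ L

pt-refl : ∀ n → (n ≡ᵇ n) ≡ true
pt-refl zero = refl
pt-refl (suc n) = pt-refl n

pt-≢ : ∀ {m n} → m ≢ n → (m ≡ᵇ n) ≡ false
pt-≢ {m} {n} ne with m ≡ᵇ n in e
... | false = refl
... | true = contradiction (≡ᵇ⇒≡ m n (Equivalence.from T-≡ e)) ne

pt-true : ∀ {m n} → (m ≡ᵇ n) ≡ true → m ≡ n
pt-true {m} {n} e = ≡ᵇ⇒≡ m n (Equivalence.from T-≡ e)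

≡true-reflects : ∀ b → Reflects (b ≡ true) b
≡true-reflects true = ofʸ refl
≡true-reflects false = ofⁿ λ ()

∨-true : ∀ b {c} → b ∨ c ≡ true → b ≡ true ⊎ c ≡ true
∨-true true _ = inj₁ refl
∨-true false h = inj₂ h

map-reflects : ∀ {P Q : Set} {b} → (P → Q) → (Q → P) → Reflects P b → Reflects Q b
map-reflects f g (ofʸ p) = ofʸ (f p)
map-reflects f g (ofⁿ np) = ofⁿ (np ∘ g)

-- The start s itself need not satisfy Ψ.
data Reach {n : ℕ} (A : Adj n) (Ψ : Fin n → Set) (s : Fin n) : Fin n → Set where
  here : Reach A Ψ s s
  step : ∀ {y x} → Reach A Ψ s y → A y x ≡ true → Ψ x → Reach A Ψ s x

module _ {P′ : ℕ} where
  private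
    P = suc P′
    Pr = Program {P}

  -- This track marks position n, the bit that ends the unary header of the encoding. Vertex i is
  -- represented by a mark at position i, so a pointer that meets the separator has passed all
  -- vertices.
  sep : Fin P
  sep = zero

  Agree : ℕ → Memory {P} → Memory {P} → Set
  Agree k M N = ∀ y → toℕ y < k → ∀ j → M y j ≡ N y j

  agree-trans : ∀ {k M N O} → Agree k M N → Agree k N O → Agree k M O
  agree-trans e f y lt j = trans (e y lt j) (f y lt j)

  agree-≤ : ∀ {k l M N} → l ≤ k → Agree k M N → Agree l M N
  agree-≤ le e y lt = e y (≤-trans lt le)

  agree-update : ∀ {k M N x f} → k ≤ toℕ x → Agree k M N → Agree k M (N [ x ↦ f ])
  agree-update {N = N} {x} {f} le e y lt j =
    trans (e y lt j) (cong (λ g → g j) (sym (update-≢ N f (λ { refl → <⇒≱ lt le }))))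

  agree-suc : ∀ {k M N x f} → toℕ x ≡ k → Agree k M N → (∀ j → f j ≡ N x j) →
              Agree (suc k) (M [ x ↦ f ]) N
  agree-suc {k} {M} {N} {x} {f} refl e ef y lt j with y ≟ x
  ... | yes refl = ef j
  ... | no ne = e y (≤∧≢⇒< (≤-pred lt) (ne ∘ toℕ-injective)) j

  marks-update : ∀ (M : Memory {P}) x {f i} → (∀ j → f j ≡ pt i j) → Marks (M [ x ↦ f ]) x i
  marks-update M x {f} e j = trans (cong (λ g → g j) (update-≡ M x f)) (e j)

  marks-other : ∀ (M : Memory {P}) {x y f i} → y ≢ x → Marks M y i → Marks (M [ x ↦ f ]) y i
  marks-other M {f = f} ne m j = trans (cong (λ g → g j) (update-≢ M f ne)) (m j)

  marks-agree : ∀ {k M N x i} → toℕ x < k → Agree k M N → Marks M x i → Marks N x i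
  marks-agree lt e m j = trans (sym (e _ lt j)) (m j)

  module _ {w : List Bool} where

    while-done : ∀ {p : Pr} {M Q} → Q M false → Triple w (while (λ b _ → b) p) M false 1 Q
    while-done q = _ , _ , 1 , ≤-refl , done refl , q

    while-again : ∀ {p : Pr} {M T T′ Q Q′} → Triple w p M true T Q →
                  (∀ {M′ b′} → Q M′ b′ → Triple w (while (λ b _ → b) p) M′ b′ T′ Q′) →
                  Triple w (while (λ b _ → b) p) M true (suc (T + T′)) Q′
    while-again (M′ , b′ , t , t≤ , e , q) k with k q
    ... | M″ , b″ , t′ , t′≤ , e′ , q′ =
      M″ , b″ , suc (t + t′) , s≤s (+-mono-≤ t≤ t′≤) , again refl e e′ , q′

  -- The loop stops as soon as the body sets the register. It fails to be set in the
  -- end exactly when the pointer x has reached the separator.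
  search : Fin P → Pr → Pr
  search x p =
    origin x ⨾ meet x sep ⨾ setReg not ⨾
    while (λ b _ → b) (p ⨾ ifte (setReg (λ _ → false)) (shift x ⨾ meet x sep ⨾ setReg not)) ⨾
    meet x sep ⨾ setReg not

  sweepCost : ℕ → ℕ
  sweepCost L = 4 * L + 4

  roundCost : ℕ → ℕ → ℕ
  roundCost T L = suc (T + suc (sweepCost L + (sweepCost L + 1)))

  searchCost : ℕ → ℕ → ℕ
  searchCost T L =
    sweepCost L + (sweepCost L + (1 + ((L * roundCost T L + 1) + (sweepCost L + 1))))

  module _ {w : List Bool} {n : ℕ} (n< : n < length w) (x : Fin P) (x≢ : x ≢ sep) (p : Pr)
           (I : ℕ → Memory {P} → Set) (Q : Memory {P} → Set) (T : ℕ)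
           (stable : ∀ {i M f} → I i M → I i (M [ x ↦ f ]))
           (body : ∀ {i M b} → i < n → Marks M x i → Marks M sep n → I i M →
                   Triple w p M b T λ M′ b′ →
                     Marks M′ x i × Marks M′ sep n × (if b′ then Q M′ else I (suc i) M′))
    where
    private
      L = length w
      U = roundCost T L

      Found : Memory {P} → Set
      Found M = Marks M sep n × Σ ℕ λ j → j < n × Marks M x j × Q M

      At : ℕ → Memory {P} → Set
      At i M = Marks M x i × Marks M sep n × I i M

      compare : ∀ {M b i R} → i ≤ n → At i M → R M (not (pt n i)) →
                Triple w (meet x sep ⨾ setReg not) M b (sweepCost L + 1) R
      compare {M} {R = R} le (mx , ms , _) r =
        meet-triple x sep {Q = λ M b → R M (not b)} mx (≤-<-trans le n<)
          (subst (λ b → R M (not b)) (sym (ms _)) r) then setReg-triple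

      below : ∀ k {i} → suc k + i ≡ n → i < n
      below k e = subst (_ <_) e (m<n+m _ (s≤s z≤n))

      -- `k` is the number of positions left; it carries both the recursion and the time bound.
      loop : ∀ k {i M} → k + i ≡ n → At i M →
             Triple w (while (λ b _ → b)
                        (p ⨾ ifte (setReg (λ _ → false)) (shift x ⨾ meet x sep ⨾ setReg not)))
                    M (not (pt n i)) (k * U + 1) (λ M′ _ → Found M′ ⊎ At n M′)
      loop zero {i} refl a rewrite pt-refl i = while-done (inj₂ a)
      loop (suc k) {i} {M} e a@(mx , ms , iv) rewrite pt-≢ (<⇒≢ (below k e)) =
        weaken (≤-reflexive (cong suc (sym (+-assoc _ (k * U) 1)))) id
          (while-again (body i<n mx ms iv then λ { {M′} {b′} q → turn M′ b′ q }) λ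
            { (inj₁ (refl , f)) → weaken (m≤n+m 1 (k * U)) id (while-done (inj₁ f))
            ; (inj₂ (refl , a′)) → loop k (trans (+-suc k i) e) a′ })
        where
        i<n : i < n
        i<n = below k e
        R : Memory {P} → Bool → Set
        R M b = (b ≡ false × Found M) ⊎ (b ≡ not (pt n (suc i)) × At (suc i) M)
        turn : ∀ M′ b′ → Marks M′ x i × Marks M′ sep n × (if b′ then Q M′ else I (suc i) M′) →
               Triple w (ifte (setReg (λ _ → false)) (shift x ⨾ meet x sep ⨾ setReg not)) M′ b′
                 (suc (sweepCost L + (sweepCost L + 1))) R
        turn M′ true (mx , ms , q) =
          weaken (s≤s (≤-trans (m≤n+m 1 (sweepCost L)) (m≤n+m _ (sweepCost L)))) id
            (branch-yes (setReg-triple (inj₁ (refl , ms , i , i<n , mx , q))))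
        turn M′ false (mx , ms , iv) =
          branch-no (shift-triple x {Q = λ M _ → At (suc i) M} mx
            (λ f _ ef → marks-update M′ x ef , marks-other M′ (x≢ ∘ sym) ms , stable iv)
            then λ a → compare i<n a (inj₂ (refl , a)))

    -- A loop rule: `I i` is what is known when the positions below `i` have failed, `Q` what a hit
    -- provides. The loop itself moves `x`, so `I` must be insensitive to that track.
    search-triple : ∀ {M b} → Marks M sep n → I 0 M →
                    Triple w (search x p) M b (searchCost T L) λ M′ b′ →
                      Marks M′ sep n ×
                      (if b′ then (Σ ℕ λ j → j < n × Marks M′ x j × Q M′) else I n M′)
    search-triple {M} ms iv =
      origin-triple x {Q = λ M _ → At 0 M}
        (λ f _ ef → marks-update M x ef , marks-other M (x≢ ∘ sym) ms , stable iv) then λ a →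
      meet-triple x sep {Q = λ M b → At 0 M × b ≡ pt n 0} (proj₁ a) (≤-<-trans z≤n n<)
        (a , proj₁ (proj₂ a) 0) then λ { (a , refl) →
      setReg-triple {Q = λ M b → At 0 M × b ≡ not (pt n 0)} (a , refl) then λ { (a , refl) →
      weaken (+-monoˡ-≤ 1 (*-monoˡ-≤ U (<⇒≤ n<))) id (loop n (+-identityʳ n) a) then λ
        { (inj₁ f@(ms , j , j<n , mx , q)) → found f
        ; (inj₂ a) → missed a } } }
      where
      End : Memory {P} → Bool → Set
      End M b = Marks M sep n × (if b then (Σ ℕ λ j → j < n × Marks M x j × Q M) else I n M)
      missed : ∀ {M b} → At n M → Triple w (meet x sep ⨾ setReg not) M b (sweepCost L + 1) End
      missed {M} a@(mx , ms , iv) =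
        compare ≤-refl a (subst (λ b → End M (not b)) (sym (pt-refl n)) (ms , iv))
      found : ∀ {M b} → Found M → Triple w (meet x sep ⨾ setReg not) M b (sweepCost L + 1) End
      found (ms , j , j<n , mx , q) =
        meet-triple x sep {Q = λ M b → b ≡ false × Found M} mx (<-trans j<n n<)
          (trans (ms j) (pt-≢ (<⇒≢ j<n)) , ms , j , j<n , mx , q) then λ
            { (refl , ms , f) → setReg-triple (ms , f) }

  sweepPoly : Poly
  sweepPoly = cst 4 ⊗ var ⊕ cst 4

  searchPoly : Poly → Poly
  searchPoly T = sweepPoly ⊕ (sweepPoly ⊕ (cst 1 ⊕
    ((var ⊗ (cst 1 ⊕ (T ⊕ (cst 1 ⊕ (sweepPoly ⊕ (sweepPoly ⊕ cst 1))))) ⊕ cst 1) ⊕ (sweepPoly ⊕ cst 1))))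

  -- `setReg id` serves as the idle program: on that branch the register already holds the answer.
  andP orP : Pr → Pr → Pr
  andP p q = p ⨾ ifte q (setReg id)
  orP p q = p ⨾ ifte (setReg id) q

  -- The index of a matrix entry is found by counting instead of arithmetic: `e` starts just behind
  -- the separator and advances once for each pair of positions of `i` and `j`, in row-major order,
  -- until these meet `x` and `y`.
  locate : (e i j x y : Fin P) → Pr
  locate e i j x y =
    clear e ⨾ union e sep ⨾ shift e ⨾
    search i (search j (andP (meet i x) (meet j y) ⨾
      ifte (setReg id) (shift e ⨾ setReg (λ _ → false))))

  adjP : (e i j x y : Fin P) → Pr
  adjP e i j x y = locate e i j x y ⨾ readBit e

  adjPoly : Poly
  adjPoly =
    sweepPoly ⊕ (sweepPoly ⊕ (sweepPoly ⊕
      searchPoly (searchPoly (sweepPoly ⊕ (cst 1 ⊕ (cst 1 ⊕ sweepPoly)) ⊕ (cst 1 ⊕ (sweepPoly ⊕ cst 1))))))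
    ⊕ sweepPoly

  -- The final `setReg` leaves the register false, which turns the enclosing `search` into a plain
  -- loop over all `x`.
  growP : (S x y e i j : Fin P) → Pr → Pr
  growP S x y e i j p =
    andP (search y (andP (meet y S) (adjP e i j y x))) p ⨾
    ifte (union S x) (setReg id) ⨾ setReg (λ _ → false)

  growPoly : Poly → Poly
  growPoly T = (searchPoly (sweepPoly ⊕ (cst 1 ⊕ (cst 1 ⊕ adjPoly))) ⊕ (cst 1 ⊕ (cst 1 ⊕ T))) ⊕
               ((cst 1 ⊕ sweepPoly) ⊕ cst 1)

  -- `c` is a mere counter: `search c` repeats the scan n times.
  reachP : (S c x y e i j s t : Fin P) → Pr → Pr
  reachP S c x y e i j s t p =
    clear S ⨾ union S s ⨾ search c (search x (growP S x y e i j p)) ⨾ meet t S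

  reachPoly : Poly → Poly
  reachPoly T = sweepPoly ⊕ (sweepPoly ⊕ (searchPoly (searchPoly (growPoly T)) ⊕ sweepPoly))

  module _ {w : List Bool} {n : ℕ} (A : Adj n) (n< : n < length w)
           (bit-adj : ∀ i j → bit w (suc n + toℕ i * n + toℕ j) ≡ A i j) where
    private
      L = length w

    -- Tracks from k on are scratch space.
    record Decides (k : ℕ) (p : Pr) (T : Poly) (M : Memory {P}) (Φ : Set) : Set where
      constructor by
      field
        decide : ∀ {N b} → Agree k M N →
          Triple w p N b (⟦ T ⟧ L) λ N′ b′ → Reflects Φ b′ × Agree k M N′

    open Decides

    module _ {k : ℕ} {M : Memory {P}} where

      decides-agree : ∀ {p T N Φ} → Agree k M N → Decides k p T M Φ → Decides k p T N Φ
      decides-agree e d .decide e′ = weaken ≤-refl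
        (λ (r , f) → r , λ y lt j → trans (sym (e y lt j)) (f y lt j)) (decide d (agree-trans e e′))

      decides-map : ∀ {p T Φ Ψ} → (Φ → Ψ) → (Ψ → Φ) → Decides k p T M Φ → Decides k p T M Ψ
      decides-map f g d .decide e = weaken ≤-refl (λ (r , a) → map-reflects f g r , a) (decide d e)

      -- An execution started on `M` itself ends with a register that reflects `Φ`; so a program
      -- that decides a property also proves it decidable.
      decides-dec : ∀ {p T Φ} → Decides k p T M Φ → Dec Φ
      decides-dec d with decide d {b = false} (λ _ _ _ → refl)
      ... | _ , b , _ , _ , _ , r , _ = b because r

      decides-not : ∀ {p T Φ} → Decides k p T M Φ → Decides k (p ⨾ setReg not) (T ⊕ cst 1) M (¬ Φ)
      decides-not d .decide e = decide d e then λ (r , a) → setReg-triple (¬-reflects r , a)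

      decides-and : ∀ {p q T U Φ Ψ} → Decides k p T M Φ → Decides k q U M Ψ →
                    Decides k (andP p q) (T ⊕ (cst 1 ⊕ (cst 1 ⊕ U))) M (Φ × Ψ)
      decides-and {q = q} {U = U} {Φ} {Ψ} d d′ .decide e =
        decide d e then λ { {N} {b} (r , a) → second N b r a }
        where
        second : ∀ N b → Reflects Φ b → Agree k M N →
                 Triple w (ifte q (setReg id)) N b (suc (suc (⟦ U ⟧ L)))
                   (λ N′ b′ → Reflects (Φ × Ψ) b′ × Agree k M N′)
        second N true (ofʸ φ) a =
          branch-yes (weaken (n≤1+n _) (λ (r , a) → (ofʸ φ ×-reflects r) , a) (decide d′ a))
        second N false (ofⁿ ¬φ) a =
          branch-no (weaken (s≤s z≤n) id (setReg-triple (ofⁿ (λ (φ , _) → ¬φ φ) , a)))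

      decides-or : ∀ {p q T U Φ Ψ} → Decides k p T M Φ → Decides k q U M Ψ →
                   Decides k (orP p q) (T ⊕ (cst 1 ⊕ (cst 1 ⊕ U))) M (Φ ⊎ Ψ)
      decides-or {q = q} {U = U} {Φ} {Ψ} d d′ .decide e =
        decide d e then λ { {N} {b} (r , a) → second N b r a }
        where
        second : ∀ N b → Reflects Φ b → Agree k M N →
                 Triple w (ifte (setReg id) q) N b (suc (suc (⟦ U ⟧ L)))
                   (λ N′ b′ → Reflects (Φ ⊎ Ψ) b′ × Agree k M N′)
        second N true (ofʸ φ) a =
          branch-yes (weaken (s≤s z≤n) id (setReg-triple (ofʸ (inj₁ φ) , a)))
        second N false (ofⁿ ¬φ) a =
          branch-no (weaken (n≤1+n _) (λ (r , a) → (ofⁿ ¬φ ⊎-reflects r) , a) (decide d′ a))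

      decides-meet : ∀ x y {i} → i < n → toℕ x < k → toℕ y < k → Marks M x i →
                     Decides k (meet x y) sweepPoly M (M y i ≡ true)
      decides-meet x y i<n x< y< mx .decide e =
        meet-triple x y (marks-agree x< e mx) (<-trans i<n n<)
          (subst (λ b → Reflects (b ≡ true) _) (sym (e y y< _)) (≡true-reflects _) , e)

      decides-eq : ∀ x y {i j : Fin n} → toℕ x < k → toℕ y < k → Marks M x (toℕ i) → Marks M y (toℕ j) →
                   Decides k (meet x y) sweepPoly M (i ≡ j)
      decides-eq x y {i} {j} x< y< mx my =
        decides-map
          (λ e → toℕ-injective (pt-true (trans (sym (my _)) e)))
          (λ { refl → trans (my _) (pt-refl (toℕ j)) })
          (decides-meet x y (toℕ<n i) x< y< mx)

      decides-ex : ∀ x {p T} {Φ : Fin n → Set} → toℕ x ≡ k → 0 < k → Marks M sep n →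
                   (∀ i → Decides (suc k) p T (M [ x ↦ pt (toℕ i) ]) (Φ i)) →
                   Decides k (search x p) (searchPoly T) M (Σ (Fin n) Φ)
      decides-ex x {p} {T} {Φ} refl 0<k ms d .decide e =
        weaken ≤-refl (λ { {N} {b} (_ , q) → finish N b q })
          (search-triple n< x (λ { refl → <-irrefl refl 0<k }) p I Q (⟦ T ⟧ L)
            (λ (a , none) → agree-update ≤-refl a , none)
            (λ { {i} {N} i<n mx _ (a , none) → weaken ≤-refl
              (λ { {N′} {b} (r , a′) → round i<n N′ b none r a′ })
              (decide (d (fromℕ< i<n)) (agree-suc refl a
                (λ j → trans (cong (λ m → pt m j) (toℕ-fromℕ< i<n)) (sym (mx j))))) })
            (marks-agree 0<k e ms) (e , λ _ ()))
        where
        I : ℕ → Memory {P} → Set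
        I i N = Agree k M N × (∀ (j : Fin n) → toℕ j < i → ¬ Φ j)
        Q : Memory {P} → Set
        Q N = Agree k M N × Σ (Fin n) Φ
        below : ∀ {i N} → Agree (suc k) (M [ x ↦ pt i ]) N → Agree k M N
        below {i} a y lt j = trans (cong (λ g → g j) (sym (update-≢ M (pt i) (λ { refl → <-irrefl refl lt }))))
                               (a y (m<n⇒m<1+n lt) j)
        round : ∀ {i} (i<n : i < n) N b → (∀ (j : Fin n) → toℕ j < i → ¬ Φ j) →
                Reflects (Φ (fromℕ< i<n)) b →
                Agree (suc k) (M [ x ↦ pt (toℕ (fromℕ< i<n)) ]) N →
                Marks N x i × Marks N sep n × (if b then Q N else I (suc i) N)
        round {i} i<n N b none r a =
          subst (Marks N x) (toℕ-fromℕ< i<n) (marks-agree ≤-refl a (marks-update M x (λ _ → refl))) ,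
          marks-agree 0<k (below a) ms ,
          value b r
          where
          value : ∀ b → Reflects (Φ (fromℕ< i<n)) b → if b then Q N else I (suc i) N
          value true (ofʸ φ) = below a , _ , φ
          value false (ofⁿ ¬φ) = below a , λ j j<si → case-last j (m≤n⇒m<n∨m≡n (≤-pred j<si))
            where
            case-last : ∀ j → toℕ j < i ⊎ toℕ j ≡ i → ¬ Φ j
            case-last j (inj₁ lt) = none j lt
            case-last j (inj₂ eq) = subst (λ j → ¬ Φ j)
              (toℕ-injective (trans (toℕ-fromℕ< i<n) (sym eq))) ¬φ
        finish : ∀ N b → (if b then (Σ ℕ λ j → j < n × Marks N x j × Q N) else I n N) →
                 Reflects (Σ (Fin n) Φ) b × Agree k M N
        finish N true (_ , _ , _ , a , φ) = ofʸ φ , a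
        finish N false (a , none) = ofⁿ (λ (j , φ) → none j (toℕ<n j) φ) , a

    -- The program looks for a counterexample; `decides-dec` provides the stability under double
    -- negation that turns its absence into the universal statement.
    decides-all : ∀ {k M} x {p T} {Φ : Fin n → Set} → toℕ x ≡ k → 0 < k → Marks M sep n →
                  (∀ i → Decides (suc k) p T (M [ x ↦ pt (toℕ i) ]) (Φ i)) →
                  Decides k (search x (p ⨾ setReg not) ⨾ setReg not) (searchPoly (T ⊕ cst 1) ⊕ cst 1) M
                    (∀ i → Φ i)
    decides-all {k} {M} x {p} {T} {Φ} x≡ 0<k ms d =
      decides-map
        (λ none i → decidable-stable (decides-dec (d i)) (λ ¬φ → none (i , ¬φ)))
        (λ all (i , ¬φ) → ¬φ (all i))
        (decides-not (decides-ex x x≡ 0<k ms (λ i → decides-not (d i))))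

    -- The invariants keep `e` at the entry of the current pair and say, by `r ≤ toℕ a` and by
    -- `c ≤ toℕ b` in row `a`, that the wanted entry has not been passed. A search without a hit
    -- would end with `n ≤ toℕ a`, which is absurd.
    decides-adj : ∀ {k M} e i j x y {a b : Fin n} → k ≤ toℕ e → toℕ e < toℕ i → toℕ i < toℕ j →
                  0 < k → toℕ x < k → toℕ y < k →
                  Marks M sep n → Marks M x (toℕ a) → Marks M y (toℕ b) →
                  Decides k (adjP e i j x y) adjPoly M (A a b ≡ true)
    decides-adj {k} {M} e i j x y {a} {b} k≤e e<i i<j 0<k x< y< ms mx my = by λ {N} ag →
      (clear-triple e {Q = λ N _ → Agree k M N × (∀ l → N e l ≡ false)}
         (λ f _ ef → agree-update k≤e ag , λ l → trans (cong (λ g → g l) (update-≡ N e f)) (ef l)) then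
       λ { {N} (ag , off) → union-triple e sep {Q = λ N _ → Agree k M N × Marks N e n}
         (λ f _ ef → agree-update k≤e ag , marks-update N e (λ l →
            trans (ef l) (cong₂ _∨_ (off l) (marks-agree 0<k ag ms l)))) then
       λ { {N} (ag , me) → shift-triple e {Q = λ N _ → Outer 0 N} me
         (λ f _ ef → agree-update k≤e ag ,
           subst (Marks (N [ e ↦ f ]) e) (sym (+-identityʳ (suc n))) (marks-update N e ef) , z≤n) then
       λ o → search-triple n< i i≢sep _ Outer Hit _
         (λ { {M = N} (ag , me , le) → agree-update k≤i ag , marks-other N e≢i me , le })
         (λ r<n mi _ o → outer r<n mi o) (marks-agree 0<k (proj₁ o) ms) o }}) then
      λ { {N} {β} (_ , q) → read N β q }
      where
      k≤i = ≤-trans k≤e (<⇒≤ e<i)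
      k≤j = ≤-trans k≤i (<⇒≤ i<j)
      e<j = <-trans e<i i<j
      e≢i : e ≢ i
      e≢i refl = <-irrefl refl e<i
      e≢j : e ≢ j
      e≢j refl = <-irrefl refl e<j
      i≢j : i ≢ j
      i≢j refl = <-irrefl refl i<j
      i≢sep : i ≢ sep
      i≢sep refl = <-irrefl refl (≤-trans 0<k k≤i)
      j≢sep : j ≢ sep
      j≢sep refl = <-irrefl refl (≤-trans 0<k k≤j)

      Outer : ℕ → Memory {P} → Set
      Outer r N = Agree k M N × Marks N e (suc n + r * n) × r ≤ toℕ a
      Hit : Memory {P} → Set
      Hit N = Agree k M N × Marks N e (suc n + toℕ a * n + toℕ b)
      Inner : ℕ → ℕ → Memory {P} → Set
      Inner r c N = Agree k M N × Marks N e (suc n + r * n + c) × Marks N i r × r ≤ toℕ a ×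
                    (r ≡ toℕ a → c ≤ toℕ b)
      InnerHit : ℕ → Memory {P} → Set
      InnerHit r N = Hit N × Marks N i r

      inner : ∀ {r c N β} → r < n → c < n → Marks N j c → Inner r c N →
              Triple w (andP (meet i x) (meet j y) ⨾ ifte (setReg id) (shift e ⨾ setReg (λ _ → false)))
                N β (⟦ sweepPoly ⊕ (cst 1 ⊕ (cst 1 ⊕ sweepPoly)) ⊕ (cst 1 ⊕ (sweepPoly ⊕ cst 1)) ⟧ L) λ N′ β′ →
                Marks N′ j c × Marks N′ sep n × (if β′ then InnerHit r N′ else Inner r (suc c) N′)
      inner {r} {c} {N} r<n c<n mj (ag , me , mi , r≤ , c≤) =
        decide (decides-and {k = suc (toℕ j)} {M = N}
          (decides-meet i x r<n (m<n⇒m<1+n i<j) (m<n⇒m<1+n (<-≤-trans x< k≤j)) mi)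
          (decides-meet j y c<n ≤-refl (m<n⇒m<1+n (<-≤-trans y< k≤j)) mj)) (λ _ _ _ → refl)
        then λ { {N′} {β′} (ρ , ag′) → turn N′ β′ ρ ag′ }
        where
        turn : ∀ N′ β′ → Reflects (N x r ≡ true × N y c ≡ true) β′ → Agree (suc (toℕ j)) N N′ →
               Triple w (ifte (setReg id) (shift e ⨾ setReg (λ _ → false))) N′ β′
                 (suc (sweepCost L + 1)) λ N′ β′ →
                 Marks N′ j c × Marks N′ sep n × (if β′ then InnerHit r N′ else Inner r (suc c) N′)
        turn N′ β′ ρ ag′ = go β′ ρ
          where
          agʲ : Agree k M N′
          agʲ = agree-trans ag (agree-≤ (m≤n⇒m≤1+n k≤j) ag′)
          mj′ = marks-agree ≤-refl ag′ mj
          me′ = marks-agree (m<n⇒m<1+n e<j) ag′ me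
          mi′ = marks-agree (m<n⇒m<1+n i<j) ag′ mi
          ms′ = marks-agree 0<k agʲ ms
          mxN = marks-agree x< ag mx
          myN = marks-agree y< ag my
          go : ∀ β′ → Reflects (N x r ≡ true × N y c ≡ true) β′ →
               Triple w (ifte (setReg id) (shift e ⨾ setReg (λ _ → false))) N′ β′
                 (suc (sweepCost L + 1)) λ N′ β′ →
                 Marks N′ j c × Marks N′ sep n × (if β′ then InnerHit r N′ else Inner r (suc c) N′)
          go true (ofʸ (p , q)) =
            branch-yes (weaken (m≤n+m 1 (sweepCost L)) id
              (setReg-triple (mj′ , ms′ , (agʲ , subst₂ (λ r c → Marks N′ e (suc n + r * n + c))
                (pt-true {r} {toℕ a} (trans (sym (mxN r)) p)) (pt-true {c} {toℕ b} (trans (sym (myN c)) q)) me′) , mi′)))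
          go false (ofⁿ no-hit) = branch-no
            (shift-triple e {Q = λ N″ _ → Marks N″ j c × Marks N″ sep n × Inner r (suc c) N″} me′
              (λ f _ ef → marks-other N′ (e≢j ∘ sym) mj′ ,
                 marks-agree 0<k (agree-update k≤e agʲ) ms ,
                 agree-update k≤e agʲ ,
                 subst (Marks (N′ [ e ↦ f ]) e) (sym (+-suc (suc n + r * n) c)) (marks-update N′ e ef) ,
                 marks-other N′ (e≢i ∘ sym) mi′ , r≤ ,
                 λ r≡a → ≤∧≢⇒< (c≤ r≡a) λ c≡b → no-hit
                   ( trans (mxN r) (trans (cong (_≡ᵇ toℕ a) r≡a) (pt-refl (toℕ a)))
                   , trans (myN c) (trans (cong (_≡ᵇ toℕ b) c≡b) (pt-refl (toℕ b))) ))
             then setReg-triple)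

      outer : ∀ {r N β} → r < n → Marks N i r → Outer r N →
              Triple w (search j (andP (meet i x) (meet j y) ⨾
                         ifte (setReg id) (shift e ⨾ setReg (λ _ → false)))) N β _ λ N′ β′ →
                Marks N′ i r × Marks N′ sep n × (if β′ then Hit N′ else Outer (suc r) N′)
      outer {r} {N} r<n mi (ag , me , r≤) =
        weaken ≤-refl (λ { {N′} {β′} (ms′ , q) → turn N′ β′ ms′ q })
          (search-triple n< j j≢sep _ (Inner r) (InnerHit r) _
            (λ { {M = N} (ag , me , mi , r≤ , c≤) →
              agree-update k≤j ag , marks-other N e≢j me , marks-other N i≢j mi , r≤ , c≤ })
            (λ c<n mj _ iv → inner r<n c<n mj iv)
            (marks-agree 0<k ag ms)
            (ag , subst (Marks N e) (sym (+-identityʳ _)) me , mi , r≤ , λ _ → z≤n))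
        where
        turn : ∀ N′ β′ → Marks N′ sep n →
               (if β′ then (Σ ℕ λ c → c < n × Marks N′ j c × InnerHit r N′) else Inner r n N′) →
               Marks N′ i r × Marks N′ sep n × (if β′ then Hit N′ else Outer (suc r) N′)
        turn N′ true ms′ (_ , _ , _ , hit , mi′) = mi′ , ms′ , hit
        turn N′ false ms′ (ag , me , mi , r≤ , c≤) =
          mi , ms′ , ag ,
          -- A whole row moves `e` by n, to the start of the next row.
          subst (Marks N′ e) (trans (+-assoc (suc n) (r * n) n) (cong (suc n +_) (+-comm (r * n) n))) me ,
          -- Row `a` cannot be exhausted without a hit, since that would give `n ≤ toℕ b`.
          ≤∧≢⇒< r≤ (λ r≡a → <⇒≱ (toℕ<n b) (c≤ r≡a))

      read : ∀ N β → (if β then (Σ ℕ λ r → r < n × Marks N i r × Hit N) else Outer n N) →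
             Triple w (readBit e) N β (sweepCost L) λ N′ β′ → Reflects (A a b ≡ true) β′ × Agree k M N′
      read N true (_ , _ , _ , ag , me) =
        readBit-triple e me (subst (Reflects (A a b ≡ true)) (sym (bit-adj a b)) (≡true-reflects _) , ag)
      read N false (_ , _ , n≤a) = contradiction n≤a (<⇒≱ (toℕ<n a))

    -- A round either adds a vertex or shows that the set is closed, hence complete. A set that grew
    -- in each of n rounds has n elements and contains everything. The test for `Ψ` is required for
    -- all contents of `S` and `c`, because it is run while these change.
    decides-reach :
      ∀ {k M} S c x y e i j s t {p T a b} {Ψ : Fin n → Set} →
      toℕ S ≡ k → toℕ c ≡ 1 + k → toℕ x ≡ 2 + k → toℕ y ≡ 3 + k →
      4 + k ≤ toℕ e → toℕ e < toℕ i → toℕ i < toℕ j → 0 < k → toℕ s < k → toℕ t < k →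
      Marks M sep n → Marks M s (toℕ a) → Marks M t (toℕ b) →
      (∀ f g l → Decides (3 + k) p T (M [ S ↦ f ] [ c ↦ g ] [ x ↦ pt (toℕ l) ]) (Ψ l)) →
      Decides k (reachP S c x y e i j s t p) (reachPoly T) M (Reach A Ψ a b)
    decides-reach {k} {M} S c x y e i j s t {p} {T} {a} {b} {Ψ}
      refl c≡ x≡ y≡ e≥ e<i i<j 0<k s< t< ms msrc mt dΨ = by λ {N} ag →
      clear-triple S {Q = λ N _ → Agree k M N × (∀ l → N S l ≡ false)}
        (λ f _ ef → agree-update ≤-refl ag , λ l → trans (cong (λ g → g l) (update-≡ N S f)) (ef l)) then
      λ { {N} (ag , off) → union-triple S s {Q = λ N _ → Outer 0 N}
        (λ f _ ef → start N f ag (λ l → trans (ef l) (cong₂ _∨_ (off l) (marks-agree s< ag msrc l)))) then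
      λ { {N} o → search-triple n< c c≢sep _ Outer (λ _ → ⊥) (⟦ searchPoly (growPoly T) ⟧ L)
        (λ { {M = N} → outer-stable N })
        (λ r<n mc _ o → round r<n mc o) (marks-agree 0<k (proj₁ o) ms) o then
      λ { {N} {β} (_ , q) → finish N β q } } }
      where
      k<c : k < toℕ c
      k<c = ≤-reflexive (sym c≡)
      c<x : toℕ c < toℕ x
      c<x = ≤-reflexive (trans (cong suc c≡) (sym x≡))
      x<y : toℕ x < toℕ y
      x<y = ≤-reflexive (trans (cong suc x≡) (sym y≡))
      k<x = <-trans k<c c<x
      distinct : ∀ {u v : Fin P} → toℕ u < toℕ v → u ≢ v
      distinct lt refl = <-irrefl refl lt
      c≢sep : c ≢ sep
      c≢sep = distinct (≤-<-trans z≤n k<c) ∘ sym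
      x≢sep : x ≢ sep
      x≢sep = distinct (≤-<-trans z≤n k<x) ∘ sym

      elem : Memory {P} → Fin n → Bool
      elem N l = N S (toℕ l)
      members : Memory {P} → Subset n
      members N = tabulate (elem N)
      ∈-members : ∀ {N l} → elem N l ≡ true → l ∈ members N
      ∈-members {N} {l} h = lookup⇒[]= l _ (trans (lookup∘tabulate (elem N) l) h)
      members-∈ : ∀ {N l} → l ∈ members N → elem N l ≡ true
      members-∈ {N} {l} h = trans (sym (lookup∘tabulate (elem N) l)) ([]=⇒lookup h)
      Sound Complete : Memory {P} → Set
      Sound N = ∀ l → elem N l ≡ true → Reach A Ψ a l
      Complete N = ∀ l → Reach A Ψ a l → elem N l ≡ true

      elem-update : ∀ N {z} f → S ≢ z → ∀ l → elem (N [ z ↦ f ]) l ≡ elem N l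
      elem-update N f ne l = cong (λ g → g (toℕ l)) (update-≢ N f ne)

      Outer : ℕ → Memory {P} → Set
      Outer r N = Agree k M N × Sound N × elem N a ≡ true × (Complete N ⊎ r ≤ ∣ members N ∣)

      outer-transfer : ∀ {r N N′} → Agree k M N′ → (∀ l → elem N′ l ≡ elem N l) → Outer r N → Outer r N′
      outer-transfer {r} {N} {N′} ag same (_ , sound , src , prog) =
        ag , (λ l h → sound l (trans (sym (same l)) h)) , trans (same a) src ,
        (case prog of λ
          { (inj₁ comp) → inj₁ (λ l h → trans (same l) (comp l h))
          ; (inj₂ le) → inj₂ (subst (λ m → r ≤ ∣ m ∣) (tabulate-cong (sym ∘ same)) le) })

      outer-stable : ∀ {r} N {f} → Outer r N → Outer r (N [ c ↦ f ])
      outer-stable N {f} o = outer-transfer (agree-update (<⇒≤ k<c) (proj₁ o))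
        (elem-update N f (distinct k<c)) o

      start : ∀ N f → Agree k M N → (∀ l → f l ≡ pt (toℕ a) l) → Outer 0 (N [ S ↦ f ])
      start N f ag ef = agree-update ≤-refl ag , sound , trans (val a) (pt-refl (toℕ a)) , inj₂ z≤n
        where
        val : ∀ l → elem (N [ S ↦ f ]) l ≡ pt (toℕ a) (toℕ l)
        val l = trans (cong (λ g → g (toℕ l)) (update-≡ N S f)) (ef (toℕ l))
        sound : Sound (N [ S ↦ f ])
        sound l h with toℕ-injective (pt-true {toℕ l} {toℕ a} (trans (sym (val l)) h))
        ... | refl = here

      -- `S₀` is the set at the start of the round. Vertices added during the scan may add further
      -- ones, but only the neighbours of `S₀` are guaranteed to be caught.
      module _ (r : ℕ) (S₀ : Fin n → Bool) where

        Round : ℕ → Memory {P} → Set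
        Round m N = Agree k M N × Marks N c r × Sound N ×
          (∀ l → S₀ l ≡ true → elem N l ≡ true) ×
          (∀ l → toℕ l < m → Ψ l → ∀ z → S₀ z ≡ true → A z l ≡ true → elem N l ≡ true)

        round-stable : ∀ {m} N {f} → Round m N → Round m (N [ x ↦ f ])
        round-stable N {f} (ag , mc , sound , sup , nxt) =
          agree-update (<⇒≤ k<x) ag , marks-other N (distinct c<x) mc ,
          (λ l h → sound l (trans (sym (same l)) h)) ,
          (λ l h → trans (same l) (sup l h)) ,
          (λ l lt ψ z h z~l → trans (same l) (nxt l lt ψ z h z~l))
          where same = elem-update N f (distinct k<x)

        grow : ∀ {m N β} → m < n → Marks N x m → Marks N sep n → Round m N →
               Triple w (growP S x y e i j p) N β (⟦ growPoly T ⟧ L) λ N′ β′ →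
                 Marks N′ x m × Marks N′ sep n × (if β′ then ⊥ else Round (suc m) N′)
        grow {m} {N} m<n mx ms′ (ag , mc , sound , sup , nxt) =
          decide cond (λ _ _ _ → refl) then λ { {N′} {β′} (ρ , ag′) →
          add N′ β′ ρ ag′ then λ (mx , ms , rd) → setReg-triple (mx , ms , rd) }
          where
          l : Fin n
          l = fromℕ< m<n
          l≡ : toℕ l ≡ m
          l≡ = toℕ-fromℕ< m<n
          mx′ : Marks N x (toℕ l)
          mx′ = subst (Marks N x) (sym l≡) mx
          Hit : Set
          Hit = (Σ (Fin n) λ z → elem N z ≡ true × A z l ≡ true) × Ψ l
          3+k = 3 + k
          cond : Decides 3+k (andP (search y (andP (meet y S) (adjP e i j y x))) p) _ N Hit
          cond = decides-and
            (decides-ex y y≡ (s≤s z≤n) ms′ λ z →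
              decides-and
                (decides-map (trans (sym (elem-update N _ (distinct (<-trans k<x x<y)) z)))
                             (trans (elem-update N _ (distinct (<-trans k<x x<y)) z))
                  (decides-meet y S (toℕ<n z) (≤-reflexive (cong suc y≡))
                    (s≤s (m≤n+m k 3)) (marks-update N y (λ _ → refl))))
                (decides-adj e i j y x e≥ e<i i<j (s≤s z≤n) (≤-reflexive (cong suc y≡))
                  (m<n⇒m<1+n (≤-reflexive (cong suc x≡)))
                  (marks-other N (distinct (≤-<-trans z≤n (<-trans k<x x<y))) ms′)
                  (marks-update N y (λ _ → refl)) (marks-other N (distinct x<y) mx′)))
            (decides-agree
              (agree-suc x≡ (agree-suc c≡ (agree-suc refl ag (λ _ → refl)) (λ _ → refl)) (sym ∘ mx′))
              (dΨ (N S) (N c) l))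

          add : ∀ N′ β′ → Reflects Hit β′ → Agree 3+k N N′ →
                Triple w (ifte (union S x) (setReg id)) N′ β′ (suc (sweepCost L)) λ N″ _ →
                  Marks N″ x m × Marks N″ sep n × Round (suc m) N″
          add N′ β′ ρ ag′ = go β′ ρ
            where
            agᵏ = agree-trans ag (agree-≤ (m≤n+m k 3) ag′)
            mxʳ : Marks N′ x m
            mxʳ = marks-agree (≤-reflexive (cong suc x≡)) ag′ mx
            mcʳ : Marks N′ c r
            mcʳ = marks-agree (m<n⇒m<1+n (≤-reflexive (cong suc c≡))) ag′ mc
            msʳ : Marks N′ sep n
            msʳ = marks-agree 0<k agᵏ ms
            same : ∀ z → elem N z ≡ elem N′ z
            same z = ag′ S (s≤s (m≤n+m k 2)) (toℕ z)
            go : ∀ β′ → Reflects Hit β′ →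
                 Triple w (ifte (union S x) (setReg id)) N′ β′ (suc (sweepCost L)) λ N″ _ →
                   Marks N″ x m × Marks N″ sep n × Round (suc m) N″
            go true (ofʸ ((z , zS , z~l) , ψ)) = branch-yes (union-triple S x λ f _ ef →
              let val : ∀ v → elem (N′ [ S ↦ f ]) v ≡ elem N′ v ∨ pt m (toℕ v)
                  val v = trans (cong (λ g → g (toℕ v)) (update-≡ N′ S f))
                            (trans (ef (toℕ v)) (cong (elem N′ v ∨_) (mxʳ (toℕ v))))
                  keep : ∀ v → elem N v ≡ true → elem (N′ [ S ↦ f ]) v ≡ true
                  keep v h = trans (val v) (cong (_∨ pt m (toℕ v)) (trans (sym (same v)) h))
                  new : ∀ v → elem (N′ [ S ↦ f ]) v ≡ true → Reach A Ψ a v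
                  new v h = case ∨-true (elem N′ v) (trans (sym (val v)) h) of λ
                    { (inj₁ old) → sound v (trans (same v) old)
                    ; (inj₂ v≡m) → subst (Reach A Ψ a)
                        (toℕ-injective (trans l≡ (sym (pt-true {toℕ v} {m} v≡m))))
                        (step (sound z zS) z~l ψ) }
              in marks-other N′ (distinct k<x ∘ sym) mxʳ ,
                 marks-agree 0<k (agree-update ≤-refl agᵏ) ms ,
                 agree-update ≤-refl agᵏ , marks-other N′ (distinct k<c ∘ sym) mcʳ , new ,
                 (λ v h → keep v (sup v h)) ,
                 λ v v<sm ψv u uS u~v → case m≤n⇒m<n∨m≡n (≤-pred v<sm) of λ
                   { (inj₁ v<m) → keep v (nxt v v<m ψv u uS u~v)
                   ; (inj₂ v≡m) → trans (val v) (trans (cong (elem N′ v ∨_)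
                       (trans (cong (_≡ᵇ m) v≡m) (pt-refl m))) (∨-zeroʳ _)) })
            go false (ofⁿ ¬hit) = branch-no (weaken (≤-trans (s≤s z≤n) (m≤n+m 4 (4 * L))) id (setReg-triple
              (mxʳ , msʳ , agᵏ , mcʳ , (λ v h → sound v (trans (same v) h)) ,
               (λ v h → trans (sym (same v)) (sup v h)) ,
               λ v v<sm ψv u uS u~v → case m≤n⇒m<n∨m≡n (≤-pred v<sm) of λ
                 { (inj₁ v<m) → trans (sym (same v)) (nxt v v<m ψv u uS u~v)
                 ; (inj₂ v≡m) → contradiction
                     (subst (λ v → (Σ (Fin n) λ z → elem N z ≡ true × A z v ≡ true) × Ψ v)
                       (toℕ-injective (trans v≡m (sym l≡))) ((u , sup u uS , u~v) , ψv)) ¬hit })))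

      round : ∀ {r N β} → r < n → Marks N c r → Outer r N →
              Triple w (search x (growP S x y e i j p)) N β (⟦ searchPoly (growPoly T) ⟧ L) λ N′ β′ →
                Marks N′ c r × Marks N′ sep n × (if β′ then ⊥ else Outer (suc r) N′)
      round {r} {N} r<n mc (ag , sound , src , prog) =
        weaken ≤-refl (λ { {N′} {β′} (ms′ , q) → turn N′ β′ ms′ q })
          (search-triple n< x x≢sep (growP S x y e i j p) (Round r (elem N)) (λ _ → ⊥) (⟦ growPoly T ⟧ L)
            (λ { {M = N′} → round-stable r (elem N) N′ })
            (grow r (elem N))
            (marks-agree 0<k ag ms)
            (ag , mc , sound , (λ _ h → h) , λ _ ()))
        where
        turn : ∀ N′ β′ → Marks N′ sep n →
               (if β′ then (Σ ℕ λ m → m < n × Marks N′ x m × ⊥) else Round r (elem N) n N′) →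
               Marks N′ c r × Marks N′ sep n × (if β′ then ⊥ else Outer (suc r) N′)
        turn N′ true ms′ (_ , _ , _ , ())
        turn N′ false ms′ (ag , mc , sound , sup , nxt) =
          mc , ms′ , ag , sound , sup a src , measure prog
          where
          measure : Complete N ⊎ r ≤ ∣ members N ∣ → Complete N′ ⊎ suc r ≤ ∣ members N′ ∣
          measure (inj₁ comp) = inj₁ (λ l h → sup l (comp l h))
          measure (inj₂ le) with any? (λ l → (elem N′ l ≟ᵇ true) ×-dec (elem N l ≟ᵇ false))
          ... | yes (l , h , h′) = inj₂ (≤-<-trans le (p⊂q⇒∣p∣<∣q∣
                  ( (λ {z} z∈ → ∈-members {N′} (sup z (members-∈ {N} z∈)))
                  , l , ∈-members {N′} h , λ l∈ → contradiction (trans (sym (members-∈ {N} l∈)) h′) λ () )))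
          -- Nothing was added, so the old set is closed under steps into `Ψ`, and induction on the
          -- walk applies.
          ... | no none = inj₁ comp
            where
            back : ∀ l → elem N′ l ≡ true → elem N l ≡ true
            back l h with elem N l in q
            ... | true = refl
            ... | false = contradiction (l , h , q) none
            comp : Complete N′
            comp l here = sup l src
            comp l (step {z} rz z~l ψ) = nxt l (toℕ<n l) ψ z (back z (comp z rz)) z~l

      finish : ∀ N β → (if β then (Σ ℕ λ r → r < n × Marks N c r × ⊥) else Outer n N) →
               Triple w (meet t S) N β (sweepCost L) λ N′ β′ → Reflects (Reach A Ψ a b) β′ × Agree k M N′
      finish N true (_ , _ , _ , ())
      finish N false (ag , sound , src , prog) =
        meet-triple t S (marks-agree t< ag mt) (<-trans (toℕ<n b) n<)
          (map-reflects (sound b) (comp b) (≡true-reflects _) , ag)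
        where
        comp : Complete N
        comp = case prog of λ
          { (inj₁ c) → c
          ; (inj₂ le) → λ l _ → members-∈ {N}
              (subst (l ∈_) (sym (∣p∣≡n⇒p≡⊤ (≤-antisym (∣p∣≤n (members N)) le))) ∈⊤) }

-- Polynomial bounds and the layout of an encoded graph

poly-bound : ∀ p → Σ ℕ λ c → Σ ℕ λ d → ∀ L → .{{_ : NonZero L}} → ⟦ p ⟧ L ≤ c * L ^ d
poly-bound (cst c) = c , 0 , λ L → ≤-reflexive (sym (*-identityʳ c))
poly-bound var = 1 , 1 , λ L → ≤-reflexive (sym (trans (*-identityˡ _) (*-identityʳ L)))
poly-bound (p ⊕ q) with poly-bound p | poly-bound q
-- As `L` is positive, both summands are bounded by multiples of the same power once the degrees are
-- added.
... | c , d , f | c′ , d′ , f′ = c + c′ , d + d′ , λ L → ≤-trans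
  (+-mono-≤ (≤-trans (f L) (*-monoʳ-≤ c (^-monoʳ-≤ L (m≤m+n d d′))))
            (≤-trans (f′ L) (*-monoʳ-≤ c′ (^-monoʳ-≤ L (m≤n+m d′ d)))))
  (≤-reflexive (sym (*-distribʳ-+ (L ^ (d + d′)) c c′)))
poly-bound (p ⊗ q) with poly-bound p | poly-bound q
... | c , d , f | c′ , d′ , f′ = c * c′ , d + d′ , λ L → ≤-trans (*-mono-≤ (f L) (f′ L))
  (≤-reflexive (trans (swap c (L ^ d) c′ (L ^ d′)) (cong (c * c′ *_) (sym (^-distribˡ-+-* L d d′)))))
  where
  swap : ∀ a x b y → a * x * (b * y) ≡ a * b * (x * y)
  swap = solve-∀

bit-++ : ∀ u v m → bit (u ++ v) (length u + m) ≡ bit v m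
bit-++ [] v m = refl
bit-++ (_ ∷ u) v m = bit-++ u v m

bit-++ˡ : ∀ u v {m} → m < length u → bit (u ++ v) m ≡ bit u m
bit-++ˡ (_ ∷ u) v {zero} lt = refl
bit-++ˡ (_ ∷ u) v {suc m} (s≤s lt) = bit-++ˡ u v lt

bit-tabulate : ∀ {n} (h : Fin n → Bool) j → bit (List.tabulate h) (toℕ j) ≡ h j
bit-tabulate h zero = refl
bit-tabulate h (suc j) = bit-tabulate (h ∘ suc) j

bit-concat : ∀ {m n} (g : Fin m → List Bool) → (∀ i → length (g i) ≡ n) → ∀ i {r} → r < n →
             bit (concat (List.tabulate g)) (toℕ i * n + r) ≡ bit (g i) r
bit-concat g len zero {r} r<n = bit-++ˡ (g zero) _ (subst (r <_) (sym (len zero)) r<n)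
bit-concat {n = n} g len (suc i) {r} r<n =
  trans (cong (bit (concat (List.tabulate g)))
          (trans (+-assoc n (toℕ i * n) r) (cong (_+ (toℕ i * n + r)) (sym (len zero)))))
    (trans (bit-++ (g zero) _ (toℕ i * n + r)) (bit-concat (g ∘ suc) (len ∘ suc) i r<n))

module _ (G : Graph) where
  open Graph G using (adj) renaming (size to n)

  private
    matrix : List Bool
    matrix = concat (map (λ i → map (λ j → adj i j) (allFin n)) (allFin n))

  encode-length : n < length (encode G)
  encode-length = subst (n <_) (sym (trans (length-++ (replicate n true)) (cong (_+ suc (length matrix)) (length-replicate n))))
    (m<m+n n (s≤s z≤n))

  encode-bit : ∀ i j → bit (encode G) (suc n + toℕ i * n + toℕ j) ≡ adj i j
  encode-bit i j =
    trans (cong (bit (encode G)) place)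
      (trans (bit-++ (replicate n true) (false ∷ matrix) (suc (toℕ i * n + toℕ j)))
        (trans (cong (λ rows → bit (concat rows) (toℕ i * n + toℕ j)) (map-tabulate id (λ i → map (adj i) (allFin n))))
          (trans (bit-concat (λ i → map (adj i) (allFin n)) (λ i → trans (length-map (adj i) (allFin n)) (length-tabulate id)) i (toℕ<n j))
            (trans (cong (λ row → bit row (toℕ j)) (map-tabulate id (adj i))) (bit-tabulate (adj i) j)))))
    where
    place : suc n + toℕ i * n + toℕ j ≡ length (replicate n true) + suc (toℕ i * n + toℕ j)
    place = trans (+-assoc (suc n) (toℕ i * n) (toℕ j))
      (trans (sym (+-suc n _)) (cong (_+ suc (toℕ i * n + toℕ j)) (sym (length-replicate n))))

-- Preparing the input tape

module _ {P′ : ℕ} where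
  private
    P = suc P′

  initialMemory : ℕ → Memory {P}
  initialMemory n zero = pt n
  initialMemory n (suc y) _ = false

  sepOnly : Bool → Fin P → Bool
  sepOnly b zero = b
  sepOnly b (suc y) = false

  -- The register is true while the unary header is being read; the first `false` gets the separator
  -- mark and switches the register off.
  marking : Bool → Symbol P → Bool × Symbol P
  marking b (raw c) = b ∧ c , cell c (tabulate (sepOnly (b ∧ not c)))
  marking b s = b , s

  -- The machine starts on the first input symbol, a sweep on the blank before it; hence the initial
  -- move.
  setup : Program {P}
  setup = act (λ b s → b , s , left) ⨾ sweep (λ _ → true) marking

  private
    unmarked : ∀ v M → (∀ y i → M y i ≡ false) → accum marking false (map raw v) ≡ (false , cells v M)
    unmarked [] M e = refl
    unmarked (c ∷ v) M e rewrite unmarked v (tail M) (λ y i → e y (suc i)) =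
      cong (λ u → false , cell c u ∷ cells v (tail M)) (tabulate-cong {f = sepOnly false} {g = λ y → M y 0} λ
        { zero → sym (e zero 0) ; (suc y) → sym (e (suc y) 0) })

    marked : ∀ n v → accum marking true (map raw (replicate n true ++ false ∷ v))
                     ≡ (false , cells (replicate n true ++ false ∷ v) (initialMemory n))
    marked zero v rewrite unmarked v (tail (initialMemory 0)) (λ { zero i → refl ; (suc y) i → refl }) =
      cong (λ u → false , cell false u ∷ cells v (tail (initialMemory 0))) (tabulate-cong {f = sepOnly true} {g = λ y → initialMemory 0 y 0} λ
        { zero → refl ; (suc y) → refl })
    marked (suc n) v rewrite marked n v =
      cong₂ (λ u cs → false , cell true u ∷ cs)
        (tabulate-cong {f = sepOnly false} {g = λ y → initialMemory (suc n) y 0} λ { zero → refl ; (suc y) → refl })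
        (cells-cong (replicate n true ++ false ∷ v) λ { zero i → refl ; (suc y) i → refl })

    raw-nonblank : ∀ v → All (λ s → nonblank {P} s ≡ true) (map raw v)
    raw-nonblank [] = []
    raw-nonblank (c ∷ v) = refl ∷ raw-nonblank v

  setup-exec : ∀ n v {c u} → replicate n true ++ false ∷ v ≡ c ∷ u →
               Ex setup (false , [] , raw c , map raw u)
                 (rest (c ∷ u) (initialMemory n) false) (1 + (4 * length (c ∷ u) + 4))
  setup-exec n v {c} {u} e =
    seq act (cast-exec (cong (λ xs → false , [] , empty , xs) (sym (++-identityʳ (map raw (c ∷ u)))))
      refl (cong (λ m → 4 * m + 4) (length-map raw (c ∷ u)))
      (sweep-exec _ _ (λ _ → refl) (raw-nonblank (c ∷ u)) (cells-nonblank (c ∷ u) (initialMemory n))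
        (subst (λ z → accum marking true (map raw z) ≡ (false , cells z (initialMemory n))) e (marked n v))))

  module _ {Φ : Graph → Set} {p : Program {P}} {T : Poly}
    (d : ∀ G → Decides {w = encode G} (Graph.adj G) (encode-length G) (encode-bit G) 1 p T
                 (initialMemory (Graph.size G)) (Φ G)) where
    private
      M : TM
      M = machine (symbol-coding P) (setup ⨾ p)

      total : Poly
      total = cst 1 ⊕ ((cst 1 ⊕ (cst 4 ⊗ var ⊕ cst 4)) ⊕ T)

      Outcome : List Bool → Set → Set
      Outcome w Ψ = Σ ℕ λ t → t ≤ ⟦ total ⟧ (length w) ×
        Σ Bool λ b → run M t (initial M w) ≡ just b × Reflects Ψ b

      outcome : ∀ n v {x u Ψ k} → replicate n true ++ false ∷ v ≡ x ∷ u →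
                Triple (x ∷ u) p (initialMemory n) false (⟦ T ⟧ (length (x ∷ u)))
                  (λ N b → Reflects Ψ b × Agree k (initialMemory n) N) →
                Outcome (x ∷ u) Ψ
      outcome n v e (_ , b , t , t≤ , ex , r , _) =
        _ , s≤s (s≤s (+-monoʳ-≤ _ t≤)) , b ,
        machine-run (symbol-coding P) (setup ⨾ p) (seq (setup-exec n v e) ex) , r

      -- `initial` matches on its word, and the first symbol of an encoding appears only after a
      -- case split on `n`.
      outcome′ : ∀ n v {Ψ k} →
                 Triple (replicate n true ++ false ∷ v) p (initialMemory n) false
                   (⟦ T ⟧ (length (replicate n true ++ false ∷ v)))
                   (λ N b → Reflects Ψ b × Agree k (initialMemory n) N) →
                 Outcome (replicate n true ++ false ∷ v) Ψ
      outcome′ zero v = outcome zero v refl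
      outcome′ (suc n) v = outcome (suc n) v refl

      answers : ∀ {Ψ : Set} {b} → Reflects Ψ b → (b ≡ true) ⇔ Ψ
      answers (ofʸ ψ) = mk⇔ (λ _ → ψ) (λ _ → refl)
      answers (ofⁿ ¬ψ) = mk⇔ (λ ()) (λ ψ → contradiction ψ ¬ψ)

    decides-poly-time : PolyTimeDecidable Φ
    decides-poly-time with poly-bound total
    ... | c , e , bound = M , c , e , λ G →
      let t , t≤ , b , runs , r = outcome′ (Graph.size G) _ (Decides.decide (d G) (λ _ _ _ → refl))
      in t , ≤-trans t≤ (≤-trans (bound (length (encode G)) {{>-nonZero (≤-<-trans z≤n (encode-length G))}})
                          (m≤m+n _ c)) , b , runs , answers r

-- Induced minor models

≢true : ∀ {b} → b ≢ true → b ≡ false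
≢true {false} _ = refl
≢true {true} h = contradiction refl h

true≢false : ∀ {b} → b ≡ true → b ≢ false
true≢false refl ()

∧-true : ∀ {b c} → b ∧ c ≡ true → b ≡ true × c ≡ true
∧-true {true} h = refl , h

Symmetric Irreflexive : ∀ {n} → Adj n → Set
Symmetric A = ∀ i j → A i j ≡ A j i
Irreflexive A = ∀ i → A i i ≡ false

module _ {n : ℕ} {A : Adj n} where

  reach-end : ∀ {Ψ s t} → Ψ s → Reach A Ψ s t → Ψ t
  reach-end ψ here = ψ
  reach-end ψ (step _ _ ψ′) = ψ′

  reach-mono : ∀ {Ψ Ψ′ s t} → (∀ {x} → Ψ x → Ψ′ x) → Reach A Ψ s t → Reach A Ψ′ s t
  reach-mono f here = here
  reach-mono f (step r e ψ) = step (reach-mono f r) e (f ψ)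

  reach-trans : ∀ {Ψ s t u} → Reach A Ψ s t → Reach A Ψ t u → Reach A Ψ s u
  reach-trans r here = r
  reach-trans r (step r′ e ψ) = step (reach-trans r r′) e ψ

  reach-sym : ∀ {Ψ s t} → Symmetric A → Ψ s → Reach A Ψ s t → Reach A Ψ t s
  reach-sym sy ψ here = here
  reach-sym sy ψ (step r e ψ′) =
    reach-trans (step here (trans (sy _ _) e) (reach-end ψ r)) (reach-sym sy ψ r)

reach-map : ∀ {m n} {A : Adj m} {B : Adj n} {Ψ Ψ′} (f : Fin m → Fin n) →
            (∀ {x y} → A x y ≡ true → f x ≢ f y → B (f x) (f y) ≡ true) →
            (∀ {x} → Ψ x → Ψ′ (f x)) →
            ∀ {s t} → Reach A Ψ s t → Reach B Ψ′ (f s) (f t)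
reach-map f hom pres here = here
reach-map {B = B} {Ψ′ = Ψ′} f hom pres {s} (step {y} {x} r e ψ) with f y ≟ f x
... | yes same = subst (Reach B Ψ′ (f s)) same (reach-map f hom pres r)
... | no diff = step (reach-map f hom pres r) (hom e diff) (pres ψ)

-- The usual description of an induced minor by disjoint connected branch sets; `nothing` labels the
-- vertices to be deleted.
record Model {m n : ℕ} (H : Adj m) (A : Adj n) : Set where
  field
    part    : Fin n → Maybe (Fin m)
    rep     : ∀ a → Σ (Fin n) λ x → part x ≡ just a
    conn    : ∀ {a x y} → part x ≡ just a → part y ≡ just a → Reach A (λ z → part z ≡ just a) x y
    edge    : ∀ {a b} → H a b ≡ true →
              Σ (Fin n) λ x → Σ (Fin n) λ y → part x ≡ just a × part y ≡ just b × A x y ≡ true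
    nonedge : ∀ {a b x y} → a ≢ b → H a b ≡ false → part x ≡ just a → part y ≡ just b → A x y ≡ false

open Model

irrefl-≢ : ∀ {m} {H : Adj m} → Irreflexive H → ∀ {a b} → H a b ≡ true → a ≢ b
irrefl-≢ ir e refl = true≢false e (ir _)

-- Contraction of uv is the quotient by the map that sends v to u.
module _ {n : ℕ} {A : Adj (suc n)} (irr : Irreflexive A) {u v : Fin (suc n)} (uv : A u v ≡ true) where

  v≢u : v ≢ u
  v≢u refl = true≢false uv (irr v)

  merge : Fin (suc n) → Fin n
  merge x with v ≟ x
  ... | yes _ = punchOut v≢u
  ... | no v≢x = punchOut v≢x

  merge-v : merge v ≡ punchOut v≢u
  merge-v with v ≟ v
  ... | yes _ = refl
  ... | no v≢v = contradiction refl v≢v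

  punchIn-merge : ∀ {x} → v ≢ x → punchIn v (merge x) ≡ x
  punchIn-merge {x} v≢x with v ≟ x
  ... | yes v≡x = contradiction v≡x v≢x
  ... | no v≢x = punchIn-punchOut v≢x

  merge-punchIn : ∀ i → merge (punchIn v i) ≡ i
  merge-punchIn i = punchIn-injective v _ _ (punchIn-merge (punchInᵢ≢i v i ∘ sym))

  punchIn-merge-v : punchIn v (merge v) ≡ u
  punchIn-merge-v = trans (cong (punchIn v) merge-v) (punchIn-punchOut v≢u)

  merge-cases : ∀ x → (x ≡ v × punchIn v (merge x) ≡ u) ⊎ (punchIn v (merge x) ≡ x)
  merge-cases x with v ≟ x in eq
  ... | yes refl = inj₁ (refl , punchIn-punchOut v≢u)
  ... | no v≢x = inj₂ (punchIn-punchOut v≢x)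

  private
    isYes-refl : ∀ {k} (x : Fin k) → isYes (x ≟ x) ≡ true
    isYes-refl x with x ≟ x
    ... | yes _ = refl
    ... | no h = contradiction refl h

    isYes-≡ : ∀ {k} {x y : Fin k} → isYes (x ≟ y) ≡ true → x ≡ y
    isYes-≡ {x = x} {y} h with x ≟ y
    ... | yes e = e

    isYes-≢ : ∀ {k} {x y : Fin k} → x ≢ y → not (isYes (x ≟ y)) ≡ true
    isYes-≢ {x = x} {y} h with x ≟ y
    ... | yes e = contradiction e h
    ... | no _ = refl

    ≢-isYes : ∀ {k} {x y : Fin k} → not (isYes (x ≟ y)) ≡ true → x ≢ y
    ≢-isYes {x = x} h refl with trans (cong not (sym (isYes-refl x))) h
    ... | ()

    clause : ∀ {i j} i′ j′ → punchIn v i ≡ i′ → punchIn v j ≡ j′ → i ≢ j →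
             (A i′ j′ ∨ ((isYes (i′ ≟ u) ∧ A v j′) ∨ (isYes (j′ ≟ u) ∧ A i′ v))) ≡ true →
             contract u v A i j ≡ true
    clause i′ j′ refl refl ne h rewrite isYes-≢ ne = h

  contract-adj : ∀ {x y} → A x y ≡ true → merge x ≢ merge y → contract u v A (merge x) (merge y) ≡ true
  contract-adj {x} {y} xy ne with merge-cases x | merge-cases y
  ... | inj₂ px | inj₂ py = clause x y px py ne (cong (_∨ ((isYes (x ≟ u) ∧ A v y) ∨ (isYes (y ≟ u) ∧ A x v))) xy)
  ... | inj₁ (refl , px) | inj₂ py = clause u y px py ne
    (trans (cong (λ b → A u y ∨ ((b ∧ A v y) ∨ (isYes (y ≟ u) ∧ A u v))) (isYes-refl u))
      (trans (cong (λ b → A u y ∨ (b ∨ (isYes (y ≟ u) ∧ A u v))) xy) (∨-zeroʳ _)))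
  ... | inj₂ px | inj₁ (refl , py) = clause x u px py ne
    (trans (cong (λ b → A x u ∨ ((isYes (x ≟ u) ∧ A v u) ∨ (b ∧ A x v))) (isYes-refl u))
      (trans (cong (λ b → A x u ∨ ((isYes (x ≟ u) ∧ A v u) ∨ b)) xy)
        (trans (cong (A x u ∨_) (∨-zeroʳ _)) (∨-zeroʳ _))))
  ... | inj₁ (refl , _) | inj₁ (refl , _) = contradiction refl ne

  -- Together with `contract-adj` this presents `contract` as the image of `A` under `merge` with
  -- loops removed; from here on its Boolean formula is not unfolded.
  contract-adj⁻ : ∀ {i j} → contract u v A i j ≡ true →
                  i ≢ j × Σ (Fin (suc n)) λ x → Σ (Fin (suc n)) λ y →
                    merge x ≡ i × merge y ≡ j × A x y ≡ true
  contract-adj⁻ {i} {j} h with ∧-true h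
  ... | ne , h′ = ≢-isYes ne , find (∨-true _ h′)
    where
    at-u : ∀ {k} → isYes (punchIn v k ≟ u) ≡ true → merge v ≡ k
    at-u {k} e = punchIn-injective v _ _ (trans punchIn-merge-v (sym (isYes-≡ e)))
    find : A (punchIn v i) (punchIn v j) ≡ true ⊎ _ →
           Σ (Fin (suc n)) λ x → Σ (Fin (suc n)) λ y → merge x ≡ i × merge y ≡ j × A x y ≡ true
    find (inj₁ e) = _ , _ , merge-punchIn i , merge-punchIn j , e
    find (inj₂ e) with ∨-true _ e
    ... | inj₁ e = let iu , vj = ∧-true e in v , _ , at-u iu , merge-punchIn j , vj
    ... | inj₂ e = let ju , iv = ∧-true e in _ , v , merge-punchIn i , at-u ju , iv

  -- The only fibre of `merge` with two elements consists of `u` and `v`, which the contracted edge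
  -- joins.
  merge-fibre : Symmetric A → ∀ {Ψ : Fin (suc n) → Set} {x y} → merge x ≡ merge y → Ψ y → Reach A Ψ x y
  merge-fibre sy {x = x} {y} e ψ with merge-cases x | merge-cases y
  ... | inj₂ px | inj₂ py with trans (sym px) (trans (cong (punchIn v) e) py)
  ... | refl = here
  merge-fibre sy {x = x} {y} e ψ | inj₁ (refl , px) | inj₂ py with trans (sym px) (trans (cong (punchIn v) e) py)
  ... | refl = step here (trans (sy v u) uv) ψ
  merge-fibre sy {x = x} {y} e ψ | inj₂ px | inj₁ (refl , py) with trans (sym px) (trans (cong (punchIn v) e) py)
  ... | refl = step here uv ψ
  merge-fibre sy {x = x} {y} e ψ | inj₁ (refl , _) | inj₁ (refl , _) = here

  contract-irrefl : Irreflexive (contract u v A)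
  contract-irrefl i = ≢true (λ h → proj₁ (contract-adj⁻ h) refl)

  contract-flip : Symmetric A → ∀ {i j} → contract u v A i j ≡ true → contract u v A j i ≡ true
  contract-flip sy h with contract-adj⁻ h
  ... | ne , x , y , refl , refl , xy = contract-adj (trans (sy y x) xy) (ne ∘ sym)

  contract-sym : Symmetric A → Symmetric (contract u v A)
  contract-sym sy i j with contract u v A i j in p | contract u v A j i in q
  ... | true | true = refl
  ... | false | false = refl
  ... | true | false = contradiction q (true≢false (contract-flip sy p))
  ... | false | true = contradiction p (true≢false (contract-flip sy q))

  module _ {m : ℕ} {H : Adj m} (irrH : Irreflexive H) where

    contract-model : (M : Model H A) → part M u ≡ part M v → Model H (contract u v A)
    contract-model M same = record
      { part = part′
      ; rep = λ a → let x , e = rep M a in merge x , trans (part-merge x) e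
      ; conn = λ {a} {i} {j} pi pj →
          subst₂ (Reach (contract u v A) (λ z → part′ z ≡ just a)) (merge-punchIn i) (merge-punchIn j)
            (reach-map merge contract-adj (λ {x} e → trans (part-merge x) e) (conn M pi pj))
      ; edge = λ h → let x , y , px , py , xy = edge M h in
          merge x , merge y , trans (part-merge x) px , trans (part-merge y) py ,
          contract-adj xy (λ e → irrefl-≢ {H = H} irrH h (just-injective
            (trans (sym px) (trans (sym (part-merge x)) (trans (cong part′ e) (trans (part-merge y) py))))))
      ; nonedge = λ {a} {b} ne h pi pj → ≢true λ e →
          let _ , x , y , mx , my , xy = contract-adj⁻ e in
          true≢false xy (nonedge M ne h
            (trans (sym (part-merge x)) (trans (cong part′ mx) pi))
            (trans (sym (part-merge y)) (trans (cong part′ my) pj))) }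
      where
      part′ : Fin n → Maybe (Fin m)
      part′ i = part M (punchIn v i)
      part-merge : ∀ x → part′ (merge x) ≡ part M x
      part-merge x with merge-cases x
      ... | inj₂ px = cong (part M) px
      ... | inj₁ (refl , px) = trans (cong (part M) px) same

    -- Every edge of the contracted graph lifts to an edge between fibres; between consecutive
    -- lifted edges the walk continues inside a fibre.
    uncontract-model : Symmetric A → Model H (contract u v A) → Model H A
    uncontract-model sy M = record
      { part = part M ∘ merge
      ; rep = λ a → let i , e = rep M a in punchIn v i , trans (cong (part M) (merge-punchIn i)) e
      ; conn = λ {a} px py → lift px refl py (conn M px py)
      ; edge = λ h → let i , j , pi , pj , ij = edge M h
                         _ , x , y , mx , my , xy = contract-adj⁻ ij in
          x , y , trans (cong (part M) mx) pi , trans (cong (part M) my) pj , xy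
      ; nonedge = λ ne h px py → ≢true λ xy → true≢false
          (contract-adj xy (λ e → ne (just-injective (trans (sym px) (trans (cong (part M) e) py)))))
          (nonedge M ne h px py) }
      where
      lift : ∀ {a x y j} → part M (merge x) ≡ just a → merge y ≡ j → part M j ≡ just a →
             Reach (contract u v A) (λ z → part M z ≡ just a) (merge x) j →
             Reach A (λ z → part M (merge z) ≡ just a) x y
      lift px my pj here = merge-fibre sy (sym my) (trans (cong (part M) my) pj)
      lift px my pj (step {k} r kj _) with contract-adj⁻ kj
      ... | _ , x′ , y′ , refl , my′ , xy =
        reach-trans (step (lift px refl (reach-end px r) r) xy (trans (cong (part M) my′) pj))
                    (merge-fibre sy (trans my′ (sym my)) (trans (cong (part M) my) pj))

module _ {m n : ℕ} {H : Adj m} {A : Adj (suc n)} (v : Fin (suc n)) where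

  delete-model : (M : Model H A) → part M v ≡ nothing → Model H (delete v A)
  delete-model M none = record
    { part = part M ∘ punchIn v
    ; rep = λ a → let x , e = rep M a in punchOut (kept e) , trans (cong (part M) (punchIn-punchOut (kept e))) e
    ; conn = λ pi pj → lower pi refl refl (conn M pi pj)
    ; edge = λ h → let x , y , px , py , xy = edge M h
                       ex = punchIn-punchOut (kept px) ; ey = punchIn-punchOut (kept py) in
        punchOut (kept px) , punchOut (kept py) , trans (cong (part M) ex) px , trans (cong (part M) ey) py ,
        trans (cong₂ A ex ey) xy
    ; nonedge = nonedge M }
    where
    kept : ∀ {a x} → part M x ≡ just a → v ≢ x
    kept e refl with trans (sym e) none
    ... | ()
    lower : ∀ {a x y i j} → part M x ≡ just a → punchIn v i ≡ x → punchIn v j ≡ y →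
            Reach A (λ z → part M z ≡ just a) x y →
            Reach (delete v A) (λ z → part M (punchIn v z) ≡ just a) i j
    lower px ei ej here with punchIn-injective v _ _ (trans ei (sym ej))
    ... | refl = here
    lower px ei refl (step r e ψ) =
      let kz = kept (reach-end px r) in
      step (lower px ei (punchIn-punchOut kz) r) (trans (cong (λ z → A z _) (punchIn-punchOut kz)) e) ψ

  undelete-model : Model H (delete v A) → Model H A
  undelete-model M = record
    { part = part′
    ; rep = λ a → let i , e = rep M a in punchIn v i , trans (part-in i) e
    ; conn = λ {a} px py → let i , ei , pi = source px ; j , ej , pj = source py in
        subst₂ (Reach A (λ z → part′ z ≡ just a)) ei ej
          (reach-map (punchIn v) (λ e _ → e) (λ {x} e → trans (part-in x) e) (conn M pi pj))
    ; edge = λ h → let i , j , pi , pj , ij = edge M h in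
        punchIn v i , punchIn v j , trans (part-in i) pi , trans (part-in j) pj , ij
    ; nonedge = λ ne h px py → let i , ei , pi = source px ; j , ej , pj = source py in
        trans (sym (cong₂ A ei ej)) (nonedge M ne h pi pj) }
    where
    part′ : Fin (suc n) → Maybe (Fin m)
    part′ x with v ≟ x
    ... | yes _ = nothing
    ... | no v≢x = part M (punchOut v≢x)
    part-in : ∀ i → part′ (punchIn v i) ≡ part M i
    part-in i with v ≟ punchIn v i
    ... | yes e = contradiction (sym e) (punchInᵢ≢i v i)
    ... | no ne = cong (part M) (punchIn-injective v _ _ (punchIn-punchOut ne))
    source : ∀ {x a} → part′ x ≡ just a → Σ (Fin n) λ i → punchIn v i ≡ x × part M i ≡ just a
    source {x} e with v ≟ x
    ... | no v≢x = punchOut v≢x , punchIn-punchOut v≢x , e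

module _ {m : ℕ} {H : Adj m} (irrH : Irreflexive H) where

  minor⇒model : ∀ {n} {A : Adj n} → Symmetric A → Irreflexive A → IndMinor H A → Model H A
  minor⇒model {A = A} sy irr (iso (f , pres)) = record
    { part = just ∘ from
    ; rep = λ a → to a , cong just (strictlyInverseʳ a)
    ; conn = λ {a} px py → one (to-eq px) (to-eq py)
    ; edge = λ {a} {b} h → to a , to b , cong just (strictlyInverseʳ a) , cong just (strictlyInverseʳ b) ,
        trans (sym (pres a b)) h
    ; nonedge = λ {a} {b} _ h px py → trans (sym (cong₂ A (to-eq px) (to-eq py))) (trans (sym (pres a b)) h) }
    where
    open Function.Bundles.Inverse f
    to-eq : ∀ {x a} → just (from x) ≡ just a → to a ≡ x
    to-eq e = trans (cong to (sym (just-injective e))) (strictlyInverseˡ _)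
    one : ∀ {a x y} {Ψ : _ → Set} → to a ≡ x → to a ≡ y → Reach A Ψ x y
    one refl refl = here
  minor⇒model sy irr (del v im) =
    undelete-model v (minor⇒model (λ i j → sy _ _) (λ i → irr _) im)
  minor⇒model {A = A} sy irr (con u v uv im) =
    uncontract-model irr uv irrH sy (minor⇒model (contract-sym irr uv sy) (contract-irrefl {A = A} irr {u} {v} uv) im)

  private
    bijective-iso : ∀ {n} {A : Adj n} → Irreflexive A → (M : Model H A) →
                    (∀ x → part M x ≢ nothing) →
                    (∀ {x y a} → part M x ≡ just a → part M y ≡ just a → x ≡ y) → Iso H A
    bijective-iso {n} {A} irr M total inj = mk↔ₛ′ to from to-from from-to , pres
      where
      to : Fin m → Fin n
      to a = proj₁ (rep M a)
      label : ∀ x → Σ (Fin m) λ a → part M x ≡ just a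
      label x with part M x in e
      ... | just a = a , refl
      ... | nothing = contradiction e (total x)
      from : Fin n → Fin m
      from x = proj₁ (label x)
      to-from : ∀ x → to (from x) ≡ x
      to-from x = inj (proj₂ (rep M (from x))) (proj₂ (label x))
      from-to : ∀ a → from (to a) ≡ a
      from-to a = just-injective (trans (sym (proj₂ (label (to a)))) (proj₂ (rep M a)))
      pres : ∀ a b → H a b ≡ A (to a) (to b)
      pres a b with H a b in h
      ... | true = let x , y , px , py , xy = edge M h in
        trans (sym xy) (cong₂ A (inj px (proj₂ (rep M a))) (inj py (proj₂ (rep M b))))
      ... | false with a ≟ b
      ...   | yes refl = sym (irr (to a))
      ...   | no a≢b = sym (nonedge M a≢b h (proj₂ (rep M a)) (proj₂ (rep M b)))

  -- An unlabelled vertex is deleted, an edge inside a part is contracted. When neither exists, a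
  -- connected part has only one vertex, and the model is an isomorphism.
  model⇒minor : ∀ {n} {A : Adj n} → Symmetric A → Irreflexive A → Model H A → IndMinor H A
  model⇒minor {zero} sy irr M = iso (bijective-iso irr M (λ ()) (λ { {x = ()} }))
  model⇒minor {suc n} {A} sy irr M with any? (λ v → ≡-dec _≟_ (part M v) nothing)
  ... | yes (v , none) =
    del v (model⇒minor (λ i j → sy _ _) (λ i → irr _) (delete-model v M none))
  ... | no total with any? (λ u → any? (λ v → (A u v ≟ᵇ true) ×-dec (≡-dec _≟_ (part M u) (part M v))))
  ...   | yes (u , v , uv , same) =
    con u v uv (model⇒minor (contract-sym irr uv sy) (contract-irrefl {A = A} irr {u} {v} uv) (contract-model irr uv irrH M same))
  ...   | no split = iso (bijective-iso irr M (λ x e → total (x , e)) (λ px py → alone px (conn M px py)))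
    where
    alone : ∀ {a x y} → part M x ≡ just a → Reach A (λ z → part M z ≡ just a) x y → x ≡ y
    alone px here = refl
    alone px (step r e py) = contradiction (_ , _ , e , trans (reach-end px r) (sym py)) split

-- Menger's theorem for two paths

module _ {n : ℕ} {Q : Fin n → Set} (Q? : ∀ x → Dec (Q x)) where

  collect : Subset n
  collect = tabulate (does ∘ Q?)

  ∈-collect⁺ : ∀ {x} → Q x → x ∈ collect
  ∈-collect⁺ {x} q = lookup⇒[]= x collect (trans (lookup∘tabulate (does ∘ Q?) x) (dec-true (Q? x) q))

  ∈-collect⁻ : ∀ {x} → x ∈ collect → Q x
  ∈-collect⁻ {x} x∈ with Q? x | trans (sym (lookup∘tabulate (does ∘ Q?) x)) ([]=⇒lookup x∈)
  ... | yes q | _ = q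

Disjoint : ∀ {n} → Subset n → Subset n → Set
Disjoint X Y = ∀ {z} → z ∈ X → z ∉ Y

module _ {n : ℕ} {X Y : Subset n} where

  ∪ˡ : X ⊆ X ∪ Y
  ∪ˡ = p⊆p∪q Y

  ∪ʳ : Y ⊆ X ∪ Y
  ∪ʳ = q⊆p∪q X Y

  ∪-elim : ∀ {P : Fin n → Set} → (∀ {z} → z ∈ X → P z) → (∀ {z} → z ∈ Y → P z) → ∀ {z} → z ∈ X ∪ Y → P z
  ∪-elim f g {z} z∈ with x∈p∪q⁻ X Y z∈
  ... | inj₁ h = f h
  ... | inj₂ h = g h

⁅⁆-elim : ∀ {n} {x : Fin n} {P : Fin n → Set} → P x → ∀ {z} → z ∈ ⁅ x ⁆ → P z
⁅⁆-elim {x = x} {P} p z∈ = subst P (sym (x∈⁅y⁆⇒x≡y x z∈)) p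

Connected : ∀ {n} → Adj n → Subset n → Set
Connected A X = ∀ {x y} → x ∈ X → y ∈ X → Reach A (_∈ X) x y

module _ {n : ℕ} {A : Adj n} (sy : Symmetric A) where

  connected-⁅⁆ : ∀ x → Connected A ⁅ x ⁆
  connected-⁅⁆ x p q = subst₂ (Reach A (_∈ ⁅ x ⁆)) (sym (x∈⁅y⁆⇒x≡y x p)) (sym (x∈⁅y⁆⇒x≡y x q)) here

  connected-via : ∀ {X Y p q} → Connected A X → Connected A Y → p ∈ X → q ∈ Y →
                  Reach A (_∈ X ∪ Y) p q → Connected A (X ∪ Y)
  connected-via {X} {Y} {p} {q} cx cy p∈ q∈ pq a b = reach-trans (to-p a) (reach-sym sy b (to-p b))
    where
    to-p : ∀ {z} → z ∈ X ∪ Y → Reach A (_∈ X ∪ Y) z p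
    to-p = ∪-elim {X = X} {Y} (λ z∈ → reach-mono ∪ˡ (cx z∈ p∈))
      (λ z∈ → reach-trans (reach-mono (∪ʳ {X = X}) (cy z∈ q∈)) (reach-sym sy (∪ˡ p∈) pq))

  connected-∪ : ∀ {X Y p q} → Connected A X → Connected A Y → p ∈ X → q ∈ Y → A p q ≡ true → Connected A (X ∪ Y)
  connected-∪ {X} cx cy p∈ q∈ pq = connected-via cx cy p∈ q∈ (step here pq (∪ʳ {X = X} q∈))

  connected-overlap : ∀ {X Y p} → Connected A X → Connected A Y → p ∈ X → p ∈ Y → Connected A (X ∪ Y)
  connected-overlap cx cy p∈ p∈′ = connected-via cx cy p∈ p∈′ here

  connected-snoc : ∀ {X p q} → Connected A X → p ∈ X → A p q ≡ true → Connected A (X ∪ ⁅ q ⁆)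
  connected-snoc {q = q} cx p∈ pq = connected-∪ cx (connected-⁅⁆ q) p∈ (x∈⁅x⁆ q) pq

  -- A simple path indexed by its vertex set; `x ∉ E` is what makes the two pieces disjoint when it
  -- is cut.
  data Trail : Subset n → Fin n → Fin n → Set where
    one  : ∀ x → Trail ⁅ x ⁆ x x
    cons : ∀ {x y z E} → A x y ≡ true → x ∉ E → Trail E y z → Trail (⁅ x ⁆ ∪ E) x z

  first∈ : ∀ {E x z} → Trail E x z → x ∈ E
  first∈ (one x) = x∈⁅x⁆ x
  first∈ (cons {x} _ _ _) = ∪ˡ (x∈⁅x⁆ x)

  last∈ : ∀ {E x z} → Trail E x z → z ∈ E
  last∈ (one x) = x∈⁅x⁆ x
  last∈ (cons {x} _ _ p) = ∪ʳ {X = ⁅ x ⁆} (last∈ p)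

  trail-connected : ∀ {E x z} → Trail E x z → Connected A E
  trail-connected (one x) = connected-⁅⁆ x
  trail-connected (cons {x} e _ p) =
    connected-∪ (connected-⁅⁆ x) (trail-connected p) (x∈⁅x⁆ x) (first∈ p) e

  trail-suffix : ∀ {E x z y} → Trail E x z → y ∈ E → Σ (Subset n) λ E′ → Trail E′ y z × E′ ⊆ E
  trail-suffix (one x) y∈ with x∈⁅y⁆⇒x≡y x y∈
  ... | refl = _ , one x , λ h → h
  trail-suffix (cons {x} {E = E} e x∉ p) y∈ with x∈p∪q⁻ ⁅ x ⁆ E y∈
  ... | inj₂ y∈E = let E′ , p′ , sub = trail-suffix p y∈E in E′ , p′ , ∪ʳ {X = ⁅ x ⁆} ∘ sub
  ... | inj₁ y∈x with x∈⁅y⁆⇒x≡y x y∈x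
  ... | refl = _ , cons e x∉ p , λ h → h

  -- A walk that returns to a vertex of the trail cuts it back to the suffix from that vertex. The
  -- trail runs backwards, since `Reach` grows at its far end.
  reach-trail : ∀ {Ψ s t} → Ψ s → Reach A Ψ s t → Σ (Subset n) λ E → Trail E t s × (∀ {x} → x ∈ E → Ψ x)
  reach-trail {Ψ} {s} ψ here = ⁅ s ⁆ , one s , ⁅⁆-elim {P = Ψ} ψ
  reach-trail {Ψ} ψ (step {x = x} r e ψ′) with reach-trail ψ r
  ... | E , p , all with x ∈? E
  ... | yes x∈ = let E′ , p′ , sub = trail-suffix p x∈ in E′ , p′ , all ∘ sub
  ... | no x∉ = ⁅ x ⁆ ∪ E , cons (trans (sy _ _) e) x∉ p , ∪-elim {X = ⁅ x ⁆} {P = Ψ} (⁅⁆-elim {P = Ψ} ψ′) all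

  record Split (E : Subset n) (h l x y : Fin n) : Set where
    field
      X Y : Subset n
      X-conn : Connected A X
      Y-conn : Connected A Y
      disjoint : Disjoint X Y
      X⊆ : X ⊆ E
      Y⊆ : Y ⊆ E
      h∈ : h ∈ X
      l∈ : l ∈ Y
      x∈ : x ∈ X
      y∈ : y ∈ Y

  split-cons : ∀ {E h h′ l x y} → A h h′ ≡ true → h ∉ E → Split E h′ l x y → Split (⁅ h ⁆ ∪ E) h l x y
  split-cons {E} {h} e h∉ s = record
    { X = ⁅ h ⁆ ∪ X ; Y = Y ; X-conn = connected-∪ (connected-⁅⁆ h) X-conn (x∈⁅x⁆ h) h∈ e ; Y-conn = Y-conn
    ; disjoint = ∪-elim {X = ⁅ h ⁆} {P = _∉ Y} (⁅⁆-elim {P = _∉ Y} (h∉ ∘ Y⊆)) disjoint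
    ; X⊆ = ∪-elim {X = ⁅ h ⁆} {P = _∈ ⁅ h ⁆ ∪ E} ∪ˡ (∪ʳ {X = ⁅ h ⁆} ∘ X⊆) ; Y⊆ = ∪ʳ {X = ⁅ h ⁆} ∘ Y⊆
    ; h∈ = ∪ˡ (x∈⁅x⁆ h) ; l∈ = l∈ ; x∈ = ∪ʳ {X = ⁅ h ⁆} x∈ ; y∈ = y∈ }
    where open Split s

  trail-split : ∀ {E h l x y} → Trail E h l → x ∈ E → y ∈ E → x ≢ y →
                Split E h l x y ⊎ Split E h l y x
  trail-split (one h) x∈ y∈ ne = contradiction (trans (x∈⁅y⁆⇒x≡y h x∈) (sym (x∈⁅y⁆⇒x≡y h y∈))) ne
  trail-split {h = h} (cons {E = E} e h∉ p) x∈ y∈ ne with x∈p∪q⁻ ⁅ h ⁆ E x∈ | x∈p∪q⁻ ⁅ h ⁆ E y∈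
  ... | inj₁ x∈h | inj₁ y∈h = contradiction (trans (x∈⁅y⁆⇒x≡y h x∈h) (sym (x∈⁅y⁆⇒x≡y h y∈h))) ne
  ... | inj₁ x∈h | inj₂ y∈E = inj₁ record
    { X = ⁅ h ⁆ ; Y = E ; X-conn = connected-⁅⁆ h ; Y-conn = trail-connected p
    ; disjoint = ⁅⁆-elim {P = _∉ E} h∉ ; X⊆ = ∪ˡ ; Y⊆ = ∪ʳ {X = ⁅ h ⁆}
    ; h∈ = x∈⁅x⁆ h ; l∈ = last∈ p ; x∈ = x∈h ; y∈ = y∈E }
  ... | inj₂ x∈E | inj₁ y∈h = inj₂ record
    { X = ⁅ h ⁆ ; Y = E ; X-conn = connected-⁅⁆ h ; Y-conn = trail-connected p
    ; disjoint = ⁅⁆-elim {P = _∉ E} h∉ ; X⊆ = ∪ˡ ; Y⊆ = ∪ʳ {X = ⁅ h ⁆}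
    ; h∈ = x∈⁅x⁆ h ; l∈ = last∈ p ; x∈ = y∈h ; y∈ = x∈E }
  ... | inj₂ x∈E | inj₂ y∈E with trail-split p x∈E y∈E ne
  ... | inj₁ s = inj₁ (split-cons e h∉ s)
  ... | inj₂ s = inj₂ (split-cons e h∉ s)

  module _ (Target : Fin n → Set) where

    -- Two disjoint paths in `B` from `x` and `y` to targets, with connected sets in place of paths.
    record Link (B : Subset n) (x y : Fin n) : Set where
      field
        X Y : Subset n
        X-conn : Connected A X
        Y-conn : Connected A Y
        disjoint : Disjoint X Y
        X⊆ : X ⊆ B
        Y⊆ : Y ⊆ B
        x∈ : x ∈ X
        y∈ : y ∈ Y
        X-target : Σ (Fin n) λ t → t ∈ X × Target t
        Y-target : Σ (Fin n) λ t → t ∈ Y × Target t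

    link-sym : ∀ {B x y} → Link B x y → Link B y x
    link-sym l = record
      { X = Y ; Y = X ; X-conn = Y-conn ; Y-conn = X-conn ; disjoint = λ y∈ x∈ → disjoint x∈ y∈
      ; X⊆ = Y⊆ ; Y⊆ = X⊆ ; x∈ = y∈ ; y∈ = x∈ ; X-target = Y-target ; Y-target = X-target }
      where open Link l

    -- An extension of a link at its end `y`: it meets `B` in `y` only, and so stays clear of the
    -- other set of the link.
    record Arm (B E : Subset n) (y : Fin n) : Set where
      field
        arm-conn : Connected A E
        base∈ : y ∈ E
        meets : ∀ {z} → z ∈ E → z ∈ B → z ≡ y

    open Arm

    bare-arm : ∀ {B} y → Arm B ⁅ y ⁆ y
    bare-arm y = record { arm-conn = connected-⁅⁆ y ; base∈ = x∈⁅x⁆ y ; meets = λ z∈ _ → x∈⁅y⁆⇒x≡y y z∈ }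

    outer-arm : ∀ {B E p y} → Connected A E → Disjoint E B → p ∈ E → A p y ≡ true → Arm B (E ∪ ⁅ y ⁆) y
    outer-arm {B} {E} {y = y} c dis p∈ py = record
      { arm-conn = connected-snoc c p∈ py ; base∈ = ∪ʳ {X = E} (x∈⁅x⁆ y)
      ; meets = ∪-elim {X = E} {P = λ z → z ∈ B → z ≡ y} (λ z∈E z∈B → contradiction z∈B (dis z∈E))
                  (λ z∈y _ → x∈⁅y⁆⇒x≡y y z∈y) }

    join-arms : ∀ {B B′ E₁ E₂ y₁ y₂ x y} → Link B y₁ y₂ → Arm B E₁ y₁ → Arm B E₂ y₂ → Disjoint E₁ E₂ →
                B ⊆ B′ → E₁ ⊆ B′ → E₂ ⊆ B′ → x ∈ E₁ → y ∈ E₂ → Link B′ x y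
    join-arms {B′ = B′} {E₁} {E₂} l a₁ a₂ dis B⊆ E₁⊆ E₂⊆ x∈E y∈E = record
      { X = X ∪ E₁ ; Y = Y ∪ E₂
      ; X-conn = connected-overlap X-conn (arm-conn a₁) x∈ (base∈ a₁)
      ; Y-conn = connected-overlap Y-conn (arm-conn a₂) y∈ (base∈ a₂)
      ; disjoint = λ z∈ z∈′ → apart (x∈p∪q⁻ X E₁ z∈) (x∈p∪q⁻ Y E₂ z∈′)
      ; X⊆ = ∪-elim {X = X} {P = _∈ B′} (B⊆ ∘ X⊆) E₁⊆
      ; Y⊆ = ∪-elim {X = Y} {P = _∈ B′} (B⊆ ∘ Y⊆) E₂⊆
      ; x∈ = ∪ʳ {X = X} x∈E ; y∈ = ∪ʳ {X = Y} y∈E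
      ; X-target = let t , t∈ , h = X-target in t , ∪ˡ t∈ , h
      ; Y-target = let t , t∈ , h = Y-target in t , ∪ˡ t∈ , h }
      where
      open Link l
      apart : ∀ {z} → z ∈ X ⊎ z ∈ E₁ → ¬ (z ∈ Y ⊎ z ∈ E₂)
      apart (inj₁ z∈X) (inj₁ z∈Y) = disjoint z∈X z∈Y
      apart (inj₁ z∈X) (inj₂ z∈E) = disjoint z∈X (subst (_∈ Y) (sym (meets a₂ z∈E (X⊆ z∈X))) y∈)
      apart (inj₂ z∈E) (inj₁ z∈Y) = disjoint (subst (_∈ X) (sym (meets a₁ z∈E (Y⊆ z∈Y))) x∈) z∈Y
      apart (inj₂ z∈E₁) (inj₂ z∈E₂) = dis z∈E₁ z∈E₂

    Linked : Subset n → Set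
    Linked B = ∀ {x y} → x ∈ B → y ∈ B → x ≢ y → Link B x y

    module _ {B E : Subset n} {p q y₁ y₂ : Fin n} (linked : Linked B) (tr : Trail E p q) (dis : Disjoint E B)
             (y₁∈ : y₁ ∈ B) (y₂∈ : y₂ ∈ B) (ne : y₁ ≢ y₂) (py : A p y₁ ≡ true) (qy : A q y₂ ≡ true) where
      private
        via : ∀ {x y r y₀} → x ∈ E → y ∈ B → r ∈ E → A r y₀ ≡ true → y₀ ∈ B → y₀ ≢ y → Link (B ∪ E) x y
        via {x} {y} {r} {y₀} x∈E y∈B r∈ ry y₀∈ ne = join-arms (linked y₀∈ y∈B ne)
          (outer-arm (trail-connected tr) dis r∈ ry) (bare-arm y)
          (∪-elim {X = E} {P = _∉ ⁅ y ⁆} (λ z∈E z∈y → dis z∈E (⁅⁆-elim {P = _∈ B} y∈B z∈y))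
            (λ z∈y₀ z∈y → ne (trans (sym (x∈⁅y⁆⇒x≡y y₀ z∈y₀)) (x∈⁅y⁆⇒x≡y y z∈y))))
          ∪ˡ (∪-elim {X = E} {P = _∈ B ∪ E} (∪ʳ {X = B}) (⁅⁆-elim {P = _∈ B ∪ E} (∪ˡ y₀∈)))
          (⁅⁆-elim {P = _∈ B ∪ E} (∪ˡ y∈B)) (∪ˡ x∈E) (x∈⁅x⁆ y)

        mixed : ∀ {x y} → x ∈ E → y ∈ B → Link (B ∪ E) x y
        mixed {y = y} x∈E y∈B with y₁ ≟ y
        ... | no y₁≢y = via x∈E y∈B (first∈ tr) py y₁∈ y₁≢y
        ... | yes refl = via x∈E y∈B (last∈ tr) qy y₂∈ (ne ∘ sym)

        both : ∀ {x y} → Split E p q x y → Link (B ∪ E) x y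
        both s = join-arms (linked y₁∈ y₂∈ ne)
          (outer-arm X-conn (dis ∘ X⊆) h∈ py) (outer-arm Y-conn (dis ∘ Y⊆) l∈ qy)
          (λ z∈₁ z∈₂ → apart (x∈p∪q⁻ X ⁅ y₁ ⁆ z∈₁) (x∈p∪q⁻ Y ⁅ y₂ ⁆ z∈₂))
          ∪ˡ (∪-elim {X = X} {P = _∈ B ∪ E} (∪ʳ {X = B} ∘ X⊆) (⁅⁆-elim {P = _∈ B ∪ E} (∪ˡ y₁∈)))
          (∪-elim {X = Y} {P = _∈ B ∪ E} (∪ʳ {X = B} ∘ Y⊆) (⁅⁆-elim {P = _∈ B ∪ E} (∪ˡ y₂∈)))
          (∪ˡ x∈) (∪ˡ y∈)
          where
          open Split s
          apart : ∀ {z} → z ∈ X ⊎ z ∈ ⁅ y₁ ⁆ → ¬ (z ∈ Y ⊎ z ∈ ⁅ y₂ ⁆)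
          apart (inj₁ a) (inj₁ b) = disjoint a b
          apart (inj₁ a) (inj₂ b) = dis (X⊆ a) (⁅⁆-elim {P = _∈ B} y₂∈ b)
          apart (inj₂ a) (inj₁ b) = dis (Y⊆ b) (⁅⁆-elim {P = _∈ B} y₁∈ a)
          apart (inj₂ a) (inj₂ b) = ne (trans (sym (x∈⁅y⁆⇒x≡y y₁ a)) (x∈⁅y⁆⇒x≡y y₂ b))

      -- Two vertices of the ear leave it at different ends, towards `y₁` and `y₂`. A vertex of the
      -- ear paired with one of `B` leaves at an end whose attachment differs from its partner.
      linked-ear : Linked (B ∪ E)
      linked-ear {x} {y} x∈ y∈ x≢y with x∈p∪q⁻ B E x∈ | x∈p∪q⁻ B E y∈
      ... | inj₁ x∈B | inj₁ y∈B = join-arms (linked x∈B y∈B x≢y) (bare-arm x) (bare-arm y)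
            (λ z∈x z∈y → x≢y (trans (sym (x∈⁅y⁆⇒x≡y x z∈x)) (x∈⁅y⁆⇒x≡y y z∈y)))
            ∪ˡ (⁅⁆-elim {P = _∈ B ∪ E} x∈) (⁅⁆-elim {P = _∈ B ∪ E} y∈) (x∈⁅x⁆ x) (x∈⁅x⁆ y)
      ... | inj₂ x∈E | inj₁ y∈B = mixed x∈E y∈B
      ... | inj₁ x∈B | inj₂ y∈E = link-sym (mixed y∈E x∈B)
      ... | inj₂ x∈E | inj₂ y∈E with trail-split tr x∈E y∈E x≢y
      ... | inj₁ s = both s
      ... | inj₂ s = link-sym (both s)

    -- The part of a walk up to its first vertex y in B: Outside is that part without y.
    record Outside (B : Subset n) (Ψ : Fin n → Set) (s y : Fin n) : Set where
      field
        E : Subset n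
        E-conn : Connected A E
        free : Disjoint E B
        inside : ∀ {x} → x ∈ E → Ψ x
        s∈ : s ∈ E
        foot : Fin n
        foot∈ : foot ∈ E
        foot-adj : A foot y ≡ true

    Entrance : Subset n → (Fin n → Set) → Fin n → Set
    Entrance B Ψ s = Σ (Fin n) λ y → y ∈ B × Ψ y × (s ≡ y ⊎ Outside B Ψ s y)

    first-entry : ∀ {B Ψ s t} → Ψ s → Reach A Ψ s t → t ∈ B → Entrance B Ψ s
    first-entry {B} {Ψ} {s} {t} ψ r t∈ = conclude (walk r)
      where
      Avoiding : Fin n → Set
      Avoiding x = Σ (Subset n) λ E → Connected A E × Disjoint E B × (∀ {z} → z ∈ E → Ψ z) × s ∈ E × x ∈ E
      walk : ∀ {x} → Reach A Ψ s x → (x ∉ B × Avoiding x) ⊎ Entrance B Ψ s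
      walk here with s ∈? B
      ... | yes s∈ = inj₂ (s , s∈ , ψ , inj₁ refl)
      ... | no s∉ = inj₁ (s∉ , ⁅ s ⁆ , connected-⁅⁆ s , ⁅⁆-elim {P = _∉ B} s∉ , ⁅⁆-elim {P = Ψ} ψ , x∈⁅x⁆ s , x∈⁅x⁆ s)
      walk (step {y} {x} r e ψx) with walk r
      ... | inj₂ en = inj₂ en
      ... | inj₁ (_ , E , c , free , ins , s∈ , y∈) with x ∈? B
      ... | yes x∈ = inj₂ (x , x∈ , ψx , inj₂ record
              { E = E ; E-conn = c ; free = free ; inside = ins ; s∈ = s∈ ; foot = y ; foot∈ = y∈ ; foot-adj = e })
      ... | no x∉ = inj₁ (x∉ , E ∪ ⁅ x ⁆ , connected-snoc c y∈ e ,
              ∪-elim {X = E} {P = _∉ B} free (⁅⁆-elim {P = _∉ B} x∉) ,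
              ∪-elim {X = E} {P = Ψ} ins (⁅⁆-elim {P = Ψ} ψx) , ∪ˡ s∈ , ∪ʳ {X = E} (x∈⁅x⁆ x))
      conclude : (t ∉ B × Avoiding t) ⊎ Entrance B Ψ s → Entrance B Ψ s
      conclude (inj₁ (t∉ , _)) = contradiction t∈ t∉
      conclude (inj₂ en) = en

    module _ (C : Subset n) (Source : Fin n → Set)
             (unseparated : ∀ z → Σ (Fin n) λ s → Source s × s ∈ C × s ≢ z ×
                Σ (Fin n) λ t → Target t × Reach A (λ x → x ∈ C × x ≢ z) s t) where

      Routes : Set
      Routes = Σ (Fin n) λ s₁ → Σ (Fin n) λ s₂ → Source s₁ × Source s₂ × Link C s₁ s₂

      module _ (z₀ : Fin n) where
        private
          -- One walk enters `B` first at `y₁`; another, avoiding `y₁`, enters at some `y₂`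
          -- different from it. If their parts outside `B` are disjoint, these extend the link of
          -- `y₁` and `y₂`; otherwise they contain an ear, and the larger set is tried.
          grow : ∀ {B} → Acc _⊃_ B → B ⊆ C → (∀ {t} → t ∈ C → Target t → t ∈ B) → Linked B → Routes
          -- Here `z₀` only instantiates `unseparated`, to obtain some walk from a source to a
          -- target.
          grow {B} (acc rec) B⊆C targets linked with unseparated z₀
          ... | s₁ , src₁ , s₁∈ , s₁≢ , t₁ , tgt₁ , r₁
            with first-entry (s₁∈ , s₁≢) r₁ (targets (proj₁ (reach-end {Ψ = λ x → x ∈ C × x ≢ z₀} (s₁∈ , s₁≢) r₁)) tgt₁)
          ... | y₁ , y₁∈ , _ , out₁ with unseparated y₁
          ... | s₂ , src₂ , s₂∈ , s₂≢ , t₂ , tgt₂ , r₂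
            with first-entry (s₂∈ , s₂≢) r₂ (targets (proj₁ (reach-end {Ψ = λ x → x ∈ C × x ≢ y₁} (s₂∈ , s₂≢) r₂)) tgt₂)
          ... | y₂ , y₂∈ , (_ , y₂≢y₁) , out₂ = choose out₁ out₂
            where
            finish : ∀ {E₁ E₂} → Arm B E₁ y₁ → Arm B E₂ y₂ → Disjoint E₁ E₂ → E₁ ⊆ C → E₂ ⊆ C →
                     s₁ ∈ E₁ → s₂ ∈ E₂ → Routes
            finish a₁ a₂ dis sub₁ sub₂ in₁ in₂ =
              s₁ , s₂ , src₁ , src₂ , join-arms (linked y₁∈ y₂∈ (y₂≢y₁ ∘ sym)) a₁ a₂ dis B⊆C sub₁ sub₂ in₁ in₂
            single : ∀ {y} → y ∈ B → ⁅ y ⁆ ⊆ C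
            single y∈ = ⁅⁆-elim {P = _∈ C} (B⊆C y∈)
            y₁≠y₂ : ∀ {z} → z ∈ ⁅ y₁ ⁆ → z ∉ ⁅ y₂ ⁆
            y₁≠y₂ a b = y₂≢y₁ (trans (sym (x∈⁅y⁆⇒x≡y y₂ b)) (x∈⁅y⁆⇒x≡y y₁ a))
            choose : s₁ ≡ y₁ ⊎ Outside B (λ x → x ∈ C × x ≢ z₀) s₁ y₁ →
                     s₂ ≡ y₂ ⊎ Outside B (λ x → x ∈ C × x ≢ y₁) s₂ y₂ → Routes
            choose (inj₁ refl) (inj₁ refl) =
              finish (bare-arm y₁) (bare-arm y₂) y₁≠y₂ (single y₁∈) (single y₂∈) (x∈⁅x⁆ y₁) (x∈⁅x⁆ y₂)
            choose (inj₁ refl) (inj₂ o) =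
              finish (bare-arm y₁) (outer-arm E-conn free foot∈ foot-adj)
                (λ a b → ∪-elim {X = E} {P = λ z → z ∉ ⁅ y₁ ⁆}
                  (λ z∈E z∈y → free z∈E (⁅⁆-elim {P = _∈ B} y₁∈ z∈y)) (λ z∈y₂ z∈y₁ → y₁≠y₂ z∈y₁ z∈y₂) b a)
                (single y₁∈) (∪-elim {X = E} {P = _∈ C} (proj₁ ∘ inside) (single y₂∈)) (x∈⁅x⁆ y₁) (∪ˡ s∈)
              where open Outside o
            choose (inj₂ o) (inj₁ refl) =
              finish (outer-arm E-conn free foot∈ foot-adj) (bare-arm y₂)
                (∪-elim {X = E} {P = _∉ ⁅ y₂ ⁆} (λ z∈E z∈y → free z∈E (⁅⁆-elim {P = _∈ B} y₂∈ z∈y)) y₁≠y₂)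
                (∪-elim {X = E} {P = _∈ C} (proj₁ ∘ inside) (single y₁∈)) (single y₂∈) (∪ˡ s∈) (x∈⁅x⁆ y₂)
              where open Outside o
            choose (inj₂ o) (inj₂ o′) with any? (λ m → (m ∈? Outside.E o) ×-dec (m ∈? Outside.E o′))
            ... | no apart =
              finish (outer-arm O.E-conn O.free O.foot∈ O.foot-adj) (outer-arm O′.E-conn O′.free O′.foot∈ O′.foot-adj)
                (λ a b → split-up (x∈p∪q⁻ O.E ⁅ y₁ ⁆ a) (x∈p∪q⁻ O′.E ⁅ y₂ ⁆ b))
                (∪-elim {X = O.E} {P = _∈ C} (proj₁ ∘ O.inside) (single y₁∈))
                (∪-elim {X = O′.E} {P = _∈ C} (proj₁ ∘ O′.inside) (single y₂∈)) (∪ˡ O.s∈) (∪ˡ O′.s∈)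
              where
              module O = Outside o
              module O′ = Outside o′
              split-up : ∀ {z} → z ∈ O.E ⊎ z ∈ ⁅ y₁ ⁆ → ¬ (z ∈ O′.E ⊎ z ∈ ⁅ y₂ ⁆)
              split-up (inj₁ a) (inj₁ b) = apart (_ , a , b)
              split-up (inj₁ a) (inj₂ b) = O.free a (⁅⁆-elim {P = _∈ B} y₂∈ b)
              split-up (inj₂ a) (inj₁ b) = O′.free b (⁅⁆-elim {P = _∈ B} y₁∈ a)
              split-up (inj₂ a) (inj₂ b) = y₁≠y₂ a b
            ... | yes (m , m∈ , m∈′) =
              -- The two outside parts share `m`, so their union is connected; a trail in it between
              -- the two feet is the ear.
              let E , tr , E⊆ = reach-trail (∪ʳ {X = O.E} O′.foot∈)
                                  (connected-overlap O.E-conn O′.E-conn m∈ m∈′ (∪ʳ {X = O.E} O′.foot∈) (∪ˡ O.foot∈))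
                  E-free = λ {z} (z∈ : z ∈ E) → ∪-elim {X = O.E} {P = _∉ B} O.free O′.free (E⊆ z∈)
                  E⊆C = λ {z} (z∈ : z ∈ E) → ∪-elim {X = O.E} {P = _∈ C} (proj₁ ∘ O.inside) (proj₁ ∘ O′.inside) (E⊆ z∈)
              in grow (rec (∪ˡ , O.foot , ∪ʳ {X = B} (first∈ tr) , O.free O.foot∈))
                   (∪-elim {X = B} {P = _∈ C} B⊆C E⊆C) (λ t∈ h → ∪ˡ (targets t∈ h))
                   (linked-ear linked tr E-free y₁∈ y₂∈ (y₂≢y₁ ∘ sym) O.foot-adj O′.foot-adj)
              where
              module O = Outside o
              module O′ = Outside o′

        -- Starting from the targets, ears are added to a set any two vertices of which are linked
        -- disjointly to targets, until the walks from the sources are disjoint.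
        menger : (∀ t → Dec (Target t)) → Routes
        menger target? = grow (⊃-wellFounded B) (proj₁ ∘ ∈-collect⁻ B?) (λ t∈ h → ∈-collect⁺ B? (t∈ , h)) start
          where
          B? : ∀ t → Dec (t ∈ C × Target t)
          B? t = (t ∈? C) ×-dec target? t
          B = collect B?
          start : Linked B
          start {x} {y} x∈ y∈ x≢y = record
            { X = ⁅ x ⁆ ; Y = ⁅ y ⁆ ; X-conn = connected-⁅⁆ x ; Y-conn = connected-⁅⁆ y
            ; disjoint = λ a b → x≢y (trans (sym (x∈⁅y⁆⇒x≡y x a)) (x∈⁅y⁆⇒x≡y y b))
            ; X⊆ = ⁅⁆-elim {P = _∈ B} x∈ ; Y⊆ = ⁅⁆-elim {P = _∈ B} y∈ ; x∈ = x∈⁅x⁆ x ; y∈ = x∈⁅x⁆ y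
            ; X-target = x , x∈⁅x⁆ x , proj₂ (∈-collect⁻ B? x∈)
            ; Y-target = y , x∈⁅x⁆ y , proj₂ (∈-collect⁻ B? y∈) }

  -- `X` swallows a walk towards `Y` vertex by vertex and stops when the next vertex lies in `Y`.
  -- This supplies the edge between the parts of 3 and 4.
  adjoin : ∀ {C X Y s t} → Connected A X → Disjoint X Y → X ⊆ C → s ∈ X → t ∈ Y → Reach A (_∈ C) s t →
           Σ (Subset n) λ X′ → Connected A X′ × Disjoint X′ Y × X′ ⊆ C × X ⊆ X′ ×
             Σ (Fin n) λ p → Σ (Fin n) λ q → p ∈ X′ × q ∈ Y × A p q ≡ true
  adjoin {C} {X} {Y} {s} {t} cX dis X⊆ s∈ t∈ r with walk r
    where
    Joined : Set
    Joined = Σ (Subset n) λ X′ → Connected A X′ × Disjoint X′ Y × X′ ⊆ C × X ⊆ X′ ×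
               Σ (Fin n) λ p → Σ (Fin n) λ q → p ∈ X′ × q ∈ Y × A p q ≡ true
    walk : ∀ {x} → Reach A (_∈ C) s x →
           (Σ (Subset n) λ X′ → Connected A X′ × Disjoint X′ Y × X′ ⊆ C × X ⊆ X′ × x ∈ X′) ⊎ Joined
    walk here = inj₁ (X , cX , dis , X⊆ , (λ h → h) , s∈)
    walk (step {y} {x} r e x∈C) with walk r
    ... | inj₂ j = inj₂ j
    ... | inj₁ (X′ , c , d , sub , sup , y∈) with x ∈? Y
    ... | yes x∈ = inj₂ (X′ , c , d , sub , sup , y , x , y∈ , x∈ , e)
    ... | no x∉ = inj₁ (X′ ∪ ⁅ x ⁆ , connected-snoc c y∈ e ,
            ∪-elim {X = X′} {P = _∉ Y} d (⁅⁆-elim {P = _∉ Y} x∉) ,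
            ∪-elim {X = X′} {P = _∈ C} sub (⁅⁆-elim {P = _∈ C} x∈C) , ∪ˡ ∘ sup , ∪ʳ {X = X′} (x∈⁅x⁆ x))
  ... | inj₂ j = j
  ... | inj₁ (X′ , _ , d , _ , _ , t∈X′) = contradiction t∈ (d t∈X′)

-- Certificates for the kite

module _ {n : ℕ} (A : Adj n) where

  Off : (a d x : Fin n) → Set
  Off a d x = ¬ A d x ≡ true × ¬ d ≡ x × ¬ a ≡ x

  -- The equalities admit a part of 2 with fewer than three vertices.
  Frame : (a d u v w : Fin n) → Set
  Frame a d u v w = A a u ≡ true × (u ≡ v ⊎ A u v ≡ true) × (v ≡ w ⊎ A v w ≡ true) ×
    ¬ A d a ≡ true × ¬ d ≡ a × Off a d u × Off a d v × Off a d w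

  Region : (a d u v w x : Fin n) → Set
  Region a d u v w x = ¬ A a x ≡ true × ¬ a ≡ x × ¬ d ≡ x × ¬ u ≡ x × ¬ v ≡ x × ¬ w ≡ x

  Attached : (u v w t : Fin n) → Set
  Attached u v w t = A u t ≡ true ⊎ (A v t ≡ true ⊎ A w t ≡ true)

  -- `z` fails to separate N(d) from the part of 2 in the component of `r`. As `Reach` leaves its
  -- start unconstrained, `¬ z ≡ s` is stated separately; `s` is in the region as the end of a walk
  -- from `r`.
  Crossing : (a d u v w r z : Fin n) → Set
  Crossing a d u v w r z = Σ (Fin n) λ s → A d s ≡ true × ¬ z ≡ s × Reach A (Region a d u v w) r s ×
    Σ (Fin n) λ t → Attached u v w t × Reach A (λ x → Region a d u v w x × ¬ z ≡ x) s t

  -- In a kite model, a and d are the parts of the vertices 1 and 5, the connected set {u , v , w}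
  -- is the part of 2, and the parts of 3 and 4 are found in the component of r in the region.
  KiteCertificate : Set
  KiteCertificate = Σ (Fin n) λ a → Σ (Fin n) λ d → Σ (Fin n) λ u → Σ (Fin n) λ v → Σ (Fin n) λ w →
    Frame a d u v w × Σ (Fin n) λ r → Region a d u v w r × (∀ z → Crossing a d u v w r z)

subsets-model : ∀ {m n} {H : Adj m} {A : Adj n} (X : Fin m → Subset n) →
                (∀ a b → a ≢ b → Disjoint (X a) (X b)) →
                (∀ a → Σ (Fin n) (_∈ X a)) → (∀ a → Connected A (X a)) →
                (∀ a b → H a b ≡ true → Σ (Fin n) λ x → Σ (Fin n) λ y → x ∈ X a × y ∈ X b × A x y ≡ true) →
                (∀ a b → a ≢ b → H a b ≡ false → ∀ {x y} → x ∈ X a → y ∈ X b → ¬ A x y ≡ true) →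
                Model H A
subsets-model {m} {n} {H} {A} X dis ne cn ed nd = record
  { part = label
  ; rep = λ a → let x , x∈ = ne a in x , ∈⇒label x∈
  ; conn = λ px py → reach-mono ∈⇒label (cn _ (label⇒∈ px) (label⇒∈ py))
  ; edge = λ h → let x , y , x∈ , y∈ , xy = ed _ _ h in x , y , ∈⇒label x∈ , ∈⇒label y∈ , xy
  ; nonedge = λ ne h px py → ≢true (nd _ _ ne h (label⇒∈ px) (label⇒∈ py)) }
  where
  label : Fin n → Maybe (Fin m)
  label x with any? (λ a → x ∈? X a)
  ... | yes (a , _) = just a
  ... | no _ = nothing
  label⇒∈ : ∀ {x a} → label x ≡ just a → x ∈ X a
  label⇒∈ {x} e with any? (λ a → x ∈? X a)
  label⇒∈ refl | yes (a , x∈) = x∈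
  ∈⇒label : ∀ {x a} → x ∈ X a → label x ≡ just a
  ∈⇒label {x} {a} x∈ with any? (λ a → x ∈? X a)
  ... | no none = contradiction (a , x∈) none
  ... | yes (b , x∈b) with a ≟ b
  ... | yes refl = refl
  ... | no a≢b = contradiction x∈b (dis a b a≢b x∈)

module _ {n : ℕ} {A : Adj n} (sy : Symmetric A) where

  module _ {a d u v w : Fin n} (frame : Frame A a d u v w) {X Y : Subset n}
           (X-in : ∀ {z} → z ∈ X → Region A a d u v w z) (Y-in : ∀ {z} → z ∈ Y → Region A a d u v w z)
           (X-conn : Connected A X) (Y-conn : Connected A Y) (dis : Disjoint X Y)
           (X-target : Σ (Fin n) λ t → t ∈ X × Attached A u v w t)
           (Y-target : Σ (Fin n) λ t → t ∈ Y × Attached A u v w t)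
           {s₁ s₂ p q : Fin n} (s₁∈ : s₁ ∈ X) (ds₁ : A d s₁ ≡ true) (s₂∈ : s₂ ∈ Y) (ds₂ : A d s₂ ≡ true)
           (p∈ : p ∈ X) (q∈ : q ∈ Y) (pq : A p q ≡ true) where
    private
      au = proj₁ frame
      uv = proj₁ (proj₂ frame)
      vw = proj₁ (proj₂ (proj₂ frame))
      ¬da = proj₁ (proj₂ (proj₂ (proj₂ frame)))
      d≢a = proj₁ (proj₂ (proj₂ (proj₂ (proj₂ frame))))
      offu = proj₁ (proj₂ (proj₂ (proj₂ (proj₂ (proj₂ frame)))))
      offv = proj₁ (proj₂ (proj₂ (proj₂ (proj₂ (proj₂ (proj₂ frame))))))
      offw = proj₂ (proj₂ (proj₂ (proj₂ (proj₂ (proj₂ (proj₂ frame))))))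
      U : Subset n
      U = ⁅ u ⁆ ∪ (⁅ v ⁆ ∪ ⁅ w ⁆)
      U-elim : ∀ {P : Fin n → Set} → P u → P v → P w → ∀ {z} → z ∈ U → P z
      U-elim {P} pu pv pw =
        ∪-elim {X = ⁅ u ⁆} {P = P} (⁅⁆-elim {P = P} pu)
          (∪-elim {X = ⁅ v ⁆} {P = P} (⁅⁆-elim {P = P} pv) (⁅⁆-elim {P = P} pw))
      u∈ : u ∈ U
      u∈ = ∪ˡ (x∈⁅x⁆ u)
      v∈ : v ∈ U
      v∈ = ∪ʳ {X = ⁅ u ⁆} (∪ˡ (x∈⁅x⁆ v))
      w∈ : w ∈ U
      w∈ = ∪ʳ {X = ⁅ u ⁆} (∪ʳ {X = ⁅ v ⁆} (x∈⁅x⁆ w))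
      bond : ∀ {x y X} → x ≡ y ⊎ A x y ≡ true → Connected A X → y ∈ X → Connected A (⁅ x ⁆ ∪ X)
      bond {x} (inj₁ refl) c y∈ = connected-overlap sy (connected-⁅⁆ sy x) c (x∈⁅x⁆ x) y∈
      bond {x} (inj₂ xy) c y∈ = connected-∪ sy (connected-⁅⁆ sy x) c (x∈⁅x⁆ x) y∈ xy
      parts : Fin 5 → Subset n
      parts 0F = ⁅ a ⁆
      parts 1F = U
      parts 2F = X
      parts 3F = Y
      parts 4F = ⁅ d ⁆
      flip : ∀ {X Y : Subset n} → Disjoint X Y → Disjoint Y X
      flip f y∈ x∈ = f x∈ y∈
      aU : Disjoint ⁅ a ⁆ U
      aU z∈a z∈U = U-elim {λ z → ¬ a ≡ z} (proj₂ (proj₂ offu)) (proj₂ (proj₂ offv)) (proj₂ (proj₂ offw)) z∈U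
        (sym (x∈⁅y⁆⇒x≡y a z∈a))
      aC : ∀ {Z} → (∀ {z} → z ∈ Z → Region A a d u v w z) → Disjoint ⁅ a ⁆ Z
      aC sub z∈a z∈ = proj₁ (proj₂ (sub z∈)) (sym (x∈⁅y⁆⇒x≡y a z∈a))
      dC : ∀ {Z} → (∀ {z} → z ∈ Z → Region A a d u v w z) → Disjoint ⁅ d ⁆ Z
      dC sub z∈d z∈ = proj₁ (proj₂ (proj₂ (sub z∈))) (sym (x∈⁅y⁆⇒x≡y d z∈d))
      dU : Disjoint U ⁅ d ⁆
      dU z∈U z∈d = U-elim {λ z → ¬ d ≡ z} (proj₁ (proj₂ offu)) (proj₁ (proj₂ offv)) (proj₁ (proj₂ offw)) z∈U (sym (x∈⁅y⁆⇒x≡y d z∈d))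
      UC : ∀ {Z} → (∀ {z} → z ∈ Z → Region A a d u v w z) → Disjoint U Z
      UC {Z} sub = U-elim {_∉ Z}
        (λ z∈ → proj₁ (proj₂ (proj₂ (proj₂ (sub z∈)))) refl)
        (λ z∈ → proj₁ (proj₂ (proj₂ (proj₂ (proj₂ (sub z∈))))) refl)
        (λ z∈ → proj₂ (proj₂ (proj₂ (proj₂ (proj₂ (sub z∈))))) refl)
      ad : Disjoint ⁅ a ⁆ ⁅ d ⁆
      ad z∈a z∈d = d≢a (trans (sym (x∈⁅y⁆⇒x≡y d z∈d)) (x∈⁅y⁆⇒x≡y a z∈a))
      disj : ∀ i j → i ≢ j → Disjoint (parts i) (parts j)
      disj 0F 0F ne = contradiction refl ne
      disj 0F 1F _ = aU
      disj 0F 2F _ = aC X-in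
      disj 0F 3F _ = aC Y-in
      disj 0F 4F _ = ad
      disj 1F 0F _ = flip aU
      disj 1F 1F ne = contradiction refl ne
      disj 1F 2F _ = UC X-in
      disj 1F 3F _ = UC Y-in
      disj 1F 4F _ = dU
      disj 2F 0F _ = flip (aC X-in)
      disj 2F 1F _ = flip (UC X-in)
      disj 2F 2F ne = contradiction refl ne
      disj 2F 3F _ = dis
      disj 2F 4F _ = flip (dC X-in)
      disj 3F 0F _ = flip (aC Y-in)
      disj 3F 1F _ = flip (UC Y-in)
      disj 3F 2F _ = flip dis
      disj 3F 3F ne = contradiction refl ne
      disj 3F 4F _ = flip (dC Y-in)
      disj 4F 0F _ = flip ad
      disj 4F 1F _ = flip dU
      disj 4F 2F _ = dC X-in
      disj 4F 3F _ = dC Y-in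
      disj 4F 4F ne = contradiction refl ne
      nonempty : ∀ i → Σ (Fin n) (_∈ parts i)
      nonempty 0F = a , x∈⁅x⁆ a
      nonempty 1F = u , u∈
      nonempty 2F = p , p∈
      nonempty 3F = q , q∈
      nonempty 4F = d , x∈⁅x⁆ d
      connected : ∀ i → Connected A (parts i)
      connected 0F = connected-⁅⁆ sy a
      connected 1F = bond uv (bond vw (connected-⁅⁆ sy w) (x∈⁅x⁆ w)) (∪ˡ (x∈⁅x⁆ v))
      connected 2F = X-conn
      connected 3F = Y-conn
      connected 4F = connected-⁅⁆ sy d
      Edge : Subset n → Subset n → Set
      Edge X Y = Σ (Fin n) λ x → Σ (Fin n) λ y → x ∈ X × y ∈ Y × A x y ≡ true
      back : ∀ {X Y} → Edge X Y → Edge Y X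
      back (x , y , x∈ , y∈ , xy) = y , x , y∈ , x∈ , trans (sy y x) xy
      hook : ∀ {Z} → (Σ (Fin n) λ t → t ∈ Z × Attached A u v w t) →
             Edge U Z
      hook (t , t∈ , inj₁ e) = u , t , u∈ , t∈ , e
      hook (t , t∈ , inj₂ (inj₁ e)) = v , t , v∈ , t∈ , e
      hook (t , t∈ , inj₂ (inj₂ e)) = w , t , w∈ , t∈ , e
      e01 : Edge ⁅ a ⁆ U
      e01 = a , u , x∈⁅x⁆ a , u∈ , au
      e12 : Edge U X
      e12 = hook X-target
      e13 : Edge U Y
      e13 = hook Y-target
      e23 : Edge X Y
      e23 = p , q , p∈ , q∈ , pq
      e42 : Edge ⁅ d ⁆ X
      e42 = d , s₁ , x∈⁅x⁆ d , s₁∈ , ds₁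
      e43 : Edge ⁅ d ⁆ Y
      e43 = d , s₂ , x∈⁅x⁆ d , s₂∈ , ds₂
      edges : ∀ i j → kiteAdj i j ≡ true → Edge (parts i) (parts j)
      edges 0F 1F _ = e01
      edges 1F 0F _ = back e01
      edges 1F 2F _ = e12
      edges 2F 1F _ = back e12
      edges 1F 3F _ = e13
      edges 3F 1F _ = back e13
      edges 2F 3F _ = e23
      edges 3F 2F _ = back e23
      edges 4F 2F _ = e42
      edges 2F 4F _ = back e42
      edges 4F 3F _ = e43
      edges 3F 4F _ = back e43
      edges 0F 0F ()
      edges 0F 2F ()
      edges 0F 3F ()
      edges 0F 4F ()
      edges 1F 1F ()
      edges 1F 4F ()
      edges 2F 0F ()
      edges 2F 2F ()
      edges 3F 0F ()
      edges 3F 3F ()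
      edges 4F 0F ()
      edges 4F 1F ()
      edges 4F 4F ()
      Apart : Subset n → Subset n → Set
      Apart X Y = ∀ {x y} → x ∈ X → y ∈ Y → ¬ A x y ≡ true
      back′ : ∀ {X Y} → Apart X Y → Apart Y X
      back′ f y∈ x∈ yx = f x∈ y∈ (trans (sy _ _) yx)
      nC : ∀ {Z} → (∀ {z} → z ∈ Z → Region A a d u v w z) → Apart ⁅ a ⁆ Z
      nC sub x∈ y∈ xy = proj₁ (sub y∈) (subst (λ x → A x _ ≡ true) (x∈⁅y⁆⇒x≡y a x∈) xy)
      n40 : Apart ⁅ d ⁆ ⁅ a ⁆
      n40 x∈ y∈ xy = ¬da (subst₂ (λ x y → A x y ≡ true) (x∈⁅y⁆⇒x≡y d x∈) (x∈⁅y⁆⇒x≡y a y∈) xy)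
      n41 : Apart ⁅ d ⁆ U
      n41 x∈ y∈ xy = U-elim {λ z → ¬ A d z ≡ true} (proj₁ offu) (proj₁ offv) (proj₁ offw) y∈
        (subst (λ x → A x _ ≡ true) (x∈⁅y⁆⇒x≡y d x∈) xy)
      nonedges : ∀ i j → i ≢ j → kiteAdj i j ≡ false → Apart (parts i) (parts j)
      nonedges 0F 0F ne _ = contradiction refl ne
      nonedges 1F 1F ne _ = contradiction refl ne
      nonedges 2F 2F ne _ = contradiction refl ne
      nonedges 3F 3F ne _ = contradiction refl ne
      nonedges 4F 4F ne _ = contradiction refl ne
      nonedges 0F 2F _ _ = nC X-in
      nonedges 0F 3F _ _ = nC Y-in
      nonedges 2F 0F _ _ = back′ (nC X-in)
      nonedges 3F 0F _ _ = back′ (nC Y-in)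
      nonedges 4F 0F _ _ = n40
      nonedges 0F 4F _ _ = back′ n40
      nonedges 4F 1F _ _ = n41
      nonedges 1F 4F _ _ = back′ n41
      nonedges 0F 1F _ ()
      nonedges 1F 0F _ ()
      nonedges 1F 2F _ ()
      nonedges 1F 3F _ ()
      nonedges 2F 1F _ ()
      nonedges 2F 3F _ ()
      nonedges 2F 4F _ ()
      nonedges 3F 1F _ ()
      nonedges 3F 2F _ ()
      nonedges 3F 4F _ ()
      nonedges 4F 2F _ ()
      nonedges 4F 3F _ ()

    kite-model : Model kiteAdj A
    kite-model = subsets-model parts disj nonempty connected edges nonedges

  -- Only neighbours of `d` in the component of `r` count as sources, so the two sets given by
  -- `menger` are joined by a walk in the region and `adjoin` applies.
  certificate⇒model : KiteCertificate A → Model kiteAdj A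
  certificate⇒model (a , d , u , v , w , frame , r , r∈ , cross) =
    finish (menger sy (Attached A u v w) C Source unseparated r attached?)
    where
    region? : ∀ x → Dec (Region A a d u v w x)
    region? x = ¬? (A a x ≟ᵇ true) ×-dec ¬? (a ≟ x) ×-dec ¬? (d ≟ x) ×-dec ¬? (u ≟ x) ×-dec ¬? (v ≟ x) ×-dec ¬? (w ≟ x)
    C : Subset n
    C = collect region?
    attached? : ∀ t → Dec (Attached A u v w t)
    attached? t = (A u t ≟ᵇ true) ⊎-dec ((A v t ≟ᵇ true) ⊎-dec (A w t ≟ᵇ true))
    Source : Fin n → Set
    Source s = A d s ≡ true × Reach A (_∈ C) r s
    unseparated : ∀ z → Σ (Fin n) λ s → Source s × s ∈ C × s ≢ z ×
                    Σ (Fin n) λ t → Attached A u v w t × Reach A (λ x → x ∈ C × x ≢ z) s t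
    unseparated z = let s , ds , z≢s , rs , t , ut , st = cross z in
      s , (ds , reach-mono (∈-collect⁺ region?) rs) , ∈-collect⁺ region? (reach-end r∈ rs) , z≢s ∘ sym ,
      t , ut , reach-mono (λ (h , ne) → ∈-collect⁺ region? h , ne ∘ sym) st
    module _ {s₁ s₂ : Fin n} (src₁ : Source s₁) (src₂ : Source s₂) (link : Link sy (Attached A u v w) C s₁ s₂) where
      open Link link
      join : (Σ (Subset n) λ X′ → Connected A X′ × Disjoint X′ Y × X′ ⊆ C × X ⊆ X′ ×
               Σ (Fin n) λ p → Σ (Fin n) λ q → p ∈ X′ × q ∈ Y × A p q ≡ true) → Model kiteAdj A
      join (X′ , X′-conn , dis , X′⊆ , X⊆X′ , p , q , p∈ , q∈ , pq) =
        kite-model frame (∈-collect⁻ region? ∘ X′⊆) (∈-collect⁻ region? ∘ Y⊆) X′-conn Y-conn dis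
          (proj₁ X-target , X⊆X′ (proj₁ (proj₂ X-target)) , proj₂ (proj₂ X-target)) Y-target
          (X⊆X′ x∈) (proj₁ src₁) y∈ (proj₁ src₂) p∈ q∈ pq
      link-model : Model kiteAdj A
      link-model = join (adjoin sy X-conn disjoint X⊆ x∈ y∈
        (reach-trans (reach-sym sy (∈-collect⁺ region? r∈) (proj₂ src₁)) (proj₂ src₂)))
    finish : Routes sy (Attached A u v w) C Source unseparated → Model kiteAdj A
    finish (_ , _ , src₁ , src₂ , link) = link-model src₁ src₂ link

-- From a kite model to a certificate

module _ {n : ℕ} {A : Adj n} {Φ : Fin n → Set} {s : Fin n} where

  AllR AnyR : (Fin n → Set) → ∀ {t} → Reach A Φ s t → Set
  AllR Q here = Q s
  AllR Q (step {x = x} r _ _) = AllR Q r × Q x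
  AnyR Q here = Q s
  AnyR Q (step {x = x} r _ _) = AnyR Q r ⊎ Q x

  anyR? : ∀ {Q} → (∀ x → Dec (Q x)) → ∀ {t} (r : Reach A Φ s t) → Dec (AnyR Q r)
  anyR? q? here = q? s
  anyR? q? (step {x = x} r _ _) = anyR? q? r ⊎-dec q? x

  any-end : ∀ {Q t} (r : Reach A Φ s t) → Q t → AnyR Q r
  any-end here q = q
  any-end (step _ _ _) q = inj₂ q

  all-end : ∀ {Q t} (r : Reach A Φ s t) → AllR Q r → Q t
  all-end here q = q
  all-end (step _ _ _) (_ , q) = q

  all-map : ∀ {Q Q′} → (∀ {x} → Q x → Q′ x) → ∀ {t} (r : Reach A Φ s t) → AllR Q r → AllR Q′ r
  all-map f here q = f q
  all-map f (step r _ _) (qs , q) = all-map f r qs , f q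

  all-zip : ∀ {Q Q′ t} (r : Reach A Φ s t) → AllR Q r → AllR Q′ r → AllR (λ x → Q x × Q′ x) r
  all-zip here q q′ = q , q′
  all-zip (step r _ _) (qs , q) (qs′ , q′) = all-zip r qs qs′ , q , q′

  all-reach : Φ s → ∀ {t} (r : Reach A Φ s t) → AllR Φ r
  all-reach φ here = φ
  all-reach φ (step r _ φ′) = all-reach φ r , φ′

  none-all : ∀ {Q t} (r : Reach A Φ s t) → ¬ AnyR Q r → AllR (¬_ ∘ Q) r
  none-all here none = none
  none-all (step r _ _) none = none-all r (none ∘ inj₁) , none ∘ inj₂

  any-suffix : ∀ {Q T} → ∀ {t} (r : Reach A Φ s t) → AllR Q r → AnyR T r →
               Σ (Fin n) λ x → T x × Q x × Reach A Q x t
  any-suffix here q τ = s , τ , q , here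
  any-suffix (step {x = x} r e φ) (qs , q) (inj₂ τ) = x , τ , q , here
  any-suffix (step r e φ) (qs , q) (inj₁ any) = let x , τ , qx , r′ = any-suffix r qs any in
    x , τ , qx , step r′ e q

  -- Provides the inner vertex that replaces `a` in `two-ended`.
  second : ∀ {Q t} (r : Reach A Φ s t) → AllR Q r →
           s ≡ t ⊎ Σ (Fin n) λ x → A s x ≡ true × Φ x × Q x
  second here q = inj₁ refl
  second (step {y} {x} r e φ) (qs , q) with second r qs
  ... | inj₂ found = inj₂ found
  ... | inj₁ refl = inj₂ (x , e , φ , q)

all-mono : ∀ {n} {A : Adj n} {Ψ Ψ′ Q : Fin n → Set} {s t} (f : ∀ {z} → Ψ z → Ψ′ z) →
           (∀ {z} → Ψ z → Q z) → Q s → (r : Reach A Ψ s t) → AllR Q (reach-mono f r)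
all-mono f g q here = q
all-mono f g q (step r _ ψ) = all-mono f g q r , g ψ

module _ {n : ℕ} {A : Adj n} (sy : Symmetric A) where

  Touch : Subset n → Fin n → Set
  Touch X x = Σ (Fin n) λ q → q ∈ X × A x q ≡ true

  touch? : ∀ X x → Dec (Touch X x)
  touch? X x = any? (λ q → (q ∈? X) ×-dec (A x q ≟ᵇ true))

  -- A kite model stripped of its part of 2: `a` and `d` stand for 1 and 5, `X` and `Y` for 3 and 4.
  record Setting (a d : Fin n) (X Y : Subset n) : Set where
    field
      ¬da : ¬ A d a ≡ true
      d≢a : ¬ d ≡ a
      X-conn : Connected A X
      Y-conn : Connected A Y
      dis : Disjoint X Y
      bridge : Σ (Fin n) λ p → p ∈ X × Touch Y p
      dX : Touch X d
      dY : Touch Y d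
      X-clear : ∀ {z} → z ∈ X → ¬ A a z ≡ true × ¬ a ≡ z × ¬ d ≡ z
      Y-clear : ∀ {z} → z ∈ Y → ¬ A a z ≡ true × ¬ a ≡ z × ¬ d ≡ z

  setting-swap : ∀ {a d X Y} → Setting a d X Y → Setting a d Y X
  setting-swap S = record
    { ¬da = ¬da ; d≢a = d≢a ; X-conn = Y-conn ; Y-conn = X-conn ; dis = λ y∈ x∈ → dis x∈ y∈
    ; bridge = let p , p∈ , q , q∈ , pq = bridge in q , q∈ , p , p∈ , trans (sy q p) pq
    ; dX = dY ; dY = dX ; X-clear = Y-clear ; Y-clear = X-clear }
    where open Setting S

  touch-mono : ∀ {X Y x} → X ⊆ Y → Touch X x → Touch Y x
  touch-mono sub (q , q∈ , e) = q , sub q∈ , e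

  setting-absorb : ∀ {a d X Y x} → Setting a d X Y → Off A a d x → ¬ A a x ≡ true → x ∉ X → Touch Y x →
                   Setting a d X (Y ∪ ⁅ x ⁆)
  setting-absorb {a} {d} {X} {Y} {x} S (¬dx , d≢x , a≢x) ¬ax x∉X (q , q∈ , xq) = record
    { ¬da = ¬da ; d≢a = d≢a ; X-conn = X-conn ; Y-conn = connected-snoc sy Y-conn q∈ (trans (sy q x) xq)
    ; dis = λ z∈X z∈ → ∪-elim {X = Y} {P = _∉ X} (λ z∈Y z∈X → dis z∈X z∈Y) (⁅⁆-elim {P = _∉ X} x∉X) z∈ z∈X
    ; bridge = let p , p∈ , t = bridge in p , p∈ , touch-mono ∪ˡ t
    ; dX = dX ; dY = touch-mono ∪ˡ dY ; X-clear = X-clear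
    ; Y-clear = ∪-elim {X = Y} {P = λ z → ¬ A a z ≡ true × ¬ a ≡ z × ¬ d ≡ z} Y-clear
        (⁅⁆-elim {P = λ z → ¬ A a z ≡ true × ¬ a ≡ z × ¬ d ≡ z} (¬ax , a≢x , d≢x)) }
    where open Setting S

  -- The easy half of Menger's theorem: `z` misses `X` or `Y`, and the set that it misses contains
  -- the required walk. As `r` is an end of the bridge, both sets are within its reach.
  certify : ∀ {a d X Y u v w} → Setting a d X Y → A a u ≡ true →
            u ≡ v ⊎ A u v ≡ true → v ≡ w ⊎ A v w ≡ true →
            Off A a d u → Off A a d v → Off A a d w →
            u ∉ X → v ∉ X → w ∉ X → u ∉ Y → v ∉ Y → w ∉ Y →
            (Σ (Fin n) λ t → t ∈ X × Attached A u v w t) →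
            (Σ (Fin n) λ t → t ∈ Y × Attached A u v w t) → KiteCertificate A
  certify {a} {d} {X} {Y} {u} {v} {w} S au uv vw offu offv offw uX vX wX uY vY wY (t , t∈ , ut) (t′ , t′∈ , ut′) =
    a , d , u , v , w , (au , uv , vw , ¬da , d≢a , offu , offv , offw) , r , X-in r∈ , cross
    where
    open Setting S
    Rg = Region A a d u v w
    region : ∀ {Z z} → (¬ A a z ≡ true × ¬ a ≡ z × ¬ d ≡ z) → u ∉ Z → v ∉ Z → w ∉ Z → z ∈ Z → Rg z
    region (¬az , a≢z , d≢z) u∉ v∉ w∉ z∈ = ¬az , a≢z , d≢z ,
      (λ { refl → u∉ z∈ }) , (λ { refl → v∉ z∈ }) , (λ { refl → w∉ z∈ })
    X-in : ∀ {z} → z ∈ X → Rg z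
    X-in z∈ = region (X-clear z∈) uX vX wX z∈
    Y-in : ∀ {z} → z ∈ Y → Rg z
    Y-in z∈ = region (Y-clear z∈) uY vY wY z∈
    r = proj₁ bridge
    r∈ = proj₁ (proj₂ bridge)
    cross : ∀ z → Crossing A a d u v w r z
    cross z with z ∈? X
    ... | no z∉X = let s , s∈ , ds = dX in
      s , ds , (λ { refl → z∉X s∈ }) , reach-mono X-in (X-conn r∈ s∈) ,
      t , ut , reach-mono (λ x∈ → X-in x∈ , λ { refl → z∉X x∈ }) (X-conn s∈ t∈)
    ... | yes z∈X = let s , s∈ , ds = dY ; q , q∈ , rq = proj₂ (proj₂ bridge) in
      s , ds , (λ { refl → dis z∈X s∈ }) ,
      reach-trans (step here rq (Y-in q∈)) (reach-mono Y-in (Y-conn q∈ s∈)) ,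
      t′ , ut′ , reach-mono (λ x∈ → Y-in x∈ , λ { refl → dis z∈X x∈ }) (Y-conn s∈ t′∈)

  certify-one : ∀ {a d X Y x} → Setting a d X Y → A a x ≡ true → Off A a d x →
                x ∉ X → x ∉ Y → Touch X x → Touch Y x → KiteCertificate A
  certify-one S ax off xX xY (q , q∈ , xq) (q′ , q′∈ , xq′) =
    certify S ax (inj₁ refl) (inj₁ refl) off off off xX xX xX xY xY xY (q , q∈ , inj₁ xq) (q′ , q′∈ , inj₁ xq′)

  untouched-≢ : ∀ {X x y} → ¬ Touch X y → Touch X x → ¬ y ≡ x
  untouched-≢ no-touch touch refl = no-touch touch

  setting-move : ∀ {a d X Y b} → Setting a d X Y → Off A a d b → b ∉ X → b ∉ Y →
                 ¬ Touch X b → ¬ Touch Y b → Setting b d X Y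
  setting-move S (¬db , d≢b , _) bX bY ¬tX ¬tY = record
    { ¬da = ¬db ; d≢a = d≢b ; X-conn = X-conn ; Y-conn = Y-conn ; dis = dis ; bridge = bridge ; dX = dX ; dY = dY
    ; X-clear = λ z∈ → (λ e → ¬tX (_ , z∈ , e)) , (λ { refl → bX z∈ }) , proj₂ (proj₂ (X-clear z∈))
    ; Y-clear = λ z∈ → (λ e → ¬tY (_ , z∈ , e)) , (λ { refl → bY z∈ }) , proj₂ (proj₂ (Y-clear z∈)) }
    where open Setting S

  ∉-absorb : ∀ {X : Subset n} {x z} → z ∉ X → ¬ z ≡ x → z ∉ X ∪ ⁅ x ⁆
  ∉-absorb {X} {x} z∉ z≢ z∈ = [ z∉ , z≢ ∘ x∈⁅y⁆⇒x≡y x ]′ (x∈p∪q⁻ X ⁅ x ⁆ z∈)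

  module _ {a d : Fin n} where

    private
      Beyond : Subset n → Fin n → Set
      Beyond Y z = Off A a d z × z ∉ Y × ¬ Touch Y z

    -- The end `x` lies in N(a) and touches `Y`; no later vertex touches `Y`. The other end is
    -- shortened until it alone touches `X`, and absorbed by `X` as long as it is outside N(a).
    two-ended : ∀ {X Y x v} → Setting a d X Y → A a x ≡ true → Off A a d x → x ∉ Y → Touch Y x →
                (r : Reach A (Beyond Y) x v) → AllR (_∉ X) r → AnyR (Touch X) r → KiteCertificate A
    two-ended S ax off xY tY here x∉ tX = certify-one S ax off x∉ xY tX tY
    two-ended {X} {Y} {x} S ax off xY tY@(q , q∈ , xq) (step {y} {v} r yv (offv , vY , ¬vY)) (r∉ , v∉) any
      with anyR? (touch? X) r
    ... | yes any′ = two-ended S ax off xY tY r r∉ any′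
    ... | no none with A a v ≟ᵇ true | [ (λ h → contradiction h none) , (λ h → h) ]′ any
    -- `X` absorbs `v`, and the predecessor `y` of `v` touches the enlarged set.
    ... | no ¬av | tv@(p , p∈ , vp) =
      two-ended (setting-swap (setting-absorb (setting-swap S) offv ¬av vY tv)) ax off xY tY r
        (all-map {Q = λ z → z ∉ X × ¬ Touch X z} (λ (z∉ , ¬t) → ∉-absorb z∉ (untouched-≢ ¬t tv)) r (all-zip r r∉ (none-all r none)))
        (any-end r (v , ∪ʳ {X = X} (x∈⁅x⁆ v) , yv))
    ... | yes av | tv@(p , p∈ , vp) with second r (all-zip r r∉ (none-all r none))
    -- The walk is a single edge, and its two ends form the part of 2.
    ... | inj₁ refl =
      certify S ax (inj₂ yv) (inj₁ refl) off offv offv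
        (all-end r r∉) v∉ v∉ xY vY vY (p , p∈ , inj₂ (inj₁ vp)) (q , q∈ , inj₁ xq)
    -- The inner vertex `b` touches neither set and becomes the new `a`; the part of 2 is now the
    -- path from `x` through the old `a` to `v`.
    ... | inj₂ (b , xb , (offb , bY , ¬bY) , (bX , ¬bX)) =
      certify (setting-move S offb bX bY ¬bX ¬bY) (trans (sy b x) xb)
        (inj₂ (trans (sy x a) ax)) (inj₂ av)
        (proj₁ off , proj₁ (proj₂ off) , untouched-≢ ¬bY tY)
        (¬da , d≢a , proj₂ (proj₂ offb) ∘ sym)
        (proj₁ offv , proj₁ (proj₂ offv) , untouched-≢ ¬bX tv)
        (λ x∈X → proj₁ (X-clear x∈X) ax) (λ a∈X → proj₁ (proj₂ (X-clear a∈X)) refl) v∉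
        xY (λ a∈Y → proj₁ (proj₂ (Y-clear a∈Y)) refl) vY
        (p , p∈ , inj₂ (inj₂ vp)) (q , q∈ , inj₁ xq)
      where open Setting S

    mutual
      -- Shortening leaves a walk whose last vertex is the first to touch one of the two sets;
      -- swapping `X` and `Y` if necessary, `extend` may call that set `Y`.
      one-ended : ∀ {X Y b x} → Setting a d X Y → A a b ≡ true → Off A a d b →
                  (r : Reach A (Off A a d) b x) → AllR (_∉ X) r → AllR (_∉ Y) r →
                  AnyR (Touch X) r → AnyR (Touch Y) r → KiteCertificate A
      one-ended S ab off here bX bY tX tY = certify-one S ab off bX bY tX tY
      one-ended {X} {Y} S ab off (step r e offx) (rX , xX) (rY , xY) anyX anyY
        with anyR? (touch? X) r | anyR? (touch? Y) r
      ... | yes aX | yes aY = one-ended S ab off r rX rY aX aY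
      ... | _ | no ¬Y = extend S ab off r e offx rX rY xX xY ([ (λ h → contradiction h ¬Y) , (λ h → h) ]′ anyY) ¬Y anyX
      ... | no ¬X | _ = extend (setting-swap S) ab off r e offx rY rX xY xX ([ (λ h → contradiction h ¬X) , (λ h → h) ]′ anyX) ¬X anyY

      extend : ∀ {X Y b y x} → Setting a d X Y → A a b ≡ true → Off A a d b →
               (r : Reach A (Off A a d) b y) → A y x ≡ true → Off A a d x →
               AllR (_∉ X) r → AllR (_∉ Y) r → x ∉ X → x ∉ Y → Touch Y x → ¬ AnyR (Touch Y) r →
               AnyR (Touch X) r ⊎ Touch X x → KiteCertificate A
      extend {X} {Y} {b} {y} {x} S ab off r yx offx rX rY xX xY tY ¬Y any
        with A a x ≟ᵇ true | any
      ... | yes ax | inj₂ tX = certify-one S ax offx xX xY tX tY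
      -- As `x` is in N(a) and alone touches `Y`, the walk read backwards from `x` to a vertex that
      -- touches `X` fits `two-ended`.
      ... | yes ax | inj₁ aX =
        let w , tw , qw , wy = any-suffix {T = Touch X} r
              (all-zip r rX (all-zip r (all-reach off r) (all-zip r rY (none-all r ¬Y)))) aX
        in turn-back tw (reach-trans (step here (trans (sy x y) yx) (reach-end qw wy)) (reach-sym sy qw wy))
        where
        turn-back : ∀ {w} → Touch X w → Reach A (λ z → z ∉ X × Beyond Y z) x w → KiteCertificate A
        turn-back tw q = two-ended S ax offx xY tY (reach-mono proj₂ q)
          (all-mono proj₂ proj₁ xX q) (any-end (reach-mono proj₂ q) tw)
      ... | no ¬ax | _ with anyR? (touch? X) r
      -- `Y` absorbs `x`, its predecessor `y` touches the enlarged set, and the shorter walk still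
      -- touches `X`.
      ... | yes aX = one-ended (setting-absorb S offx ¬ax xX tY) ab off r rX
              (all-map {Q = λ z → z ∉ Y × ¬ Touch Y z} (λ (z∉ , ¬t) → ∉-absorb z∉ (untouched-≢ ¬t tY)) r (all-zip r rY (none-all r ¬Y)))
              aX (any-end r (x , ∪ʳ {X = Y} (x∈⁅x⁆ x) , yx))
      -- Nothing before `x` touches either set, so `x` touches both and is the whole part of 2, with
      -- its predecessor `y` as the new `a`.
      ... | no ¬X =
        certify-one (setting-move S offy (all-end r rX) (all-end r rY) ¬tX ¬tY) yx
          (proj₁ offx , proj₁ (proj₂ offx) , untouched-≢ ¬tY tY) xX xY
          ([ (λ h → contradiction h ¬X) , (λ h → h) ]′ any) tY
        where
        offy = all-end r (all-reach off r)
        ¬tX = all-end r (none-all r ¬X)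
        ¬tY = all-end r (none-all r ¬Y)

any-mono : ∀ {n} {A : Adj n} {Ψ Ψ′ Q : Fin n → Set} {s t} (f : ∀ {z} → Ψ z → Ψ′ z) →
           (r : Reach A Ψ s t) → AnyR Q r → AnyR Q (reach-mono f r)
any-mono f here q = q
any-mono f (step r _ _) (inj₁ any) = inj₁ (any-mono f r any)
any-mono f (step r _ _) (inj₂ q) = inj₂ q

any-trans : ∀ {n} {A : Adj n} {Ψ Q : Fin n → Set} {s t u} (r : Reach A Ψ s t) (r′ : Reach A Ψ t u) →
            AnyR Q r → AnyR Q (reach-trans r r′)
any-trans r here any = any
any-trans r (step r′ _ _) any = inj₁ (any-trans r r′ any)

module _ {n : ℕ} {A : Adj n} (sy : Symmetric A) (M : Model kiteAdj A) where
  private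
    in? : ∀ i x → Dec (part M x ≡ just i)
    in? i x = ≡-dec _≟_ (part M x) (just i)

    V : Fin 5 → Subset n
    V i = collect (in? i)

    V-conn : ∀ i → Connected A (V i)
    V-conn i x∈ y∈ = reach-mono (∈-collect⁺ (in? i)) (conn M (∈-collect⁻ (in? i) x∈) (∈-collect⁻ (in? i) y∈))

    V-disjoint : ∀ i j → i ≢ j → Disjoint (V i) (V j)
    V-disjoint i j ne x∈ y∈ =
      ne (just-injective (trans (sym (∈-collect⁻ (in? i) x∈)) (∈-collect⁻ (in? j) y∈)))

    V-edge : ∀ i j → kiteAdj i j ≡ true → Σ (Fin n) λ x → x ∈ V i × Touch sy (V j) x
    V-edge i j h = let x , y , px , py , xy = edge M h in
      x , ∈-collect⁺ (in? i) px , y , ∈-collect⁺ (in? j) py , xy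

    V-nonedge : ∀ i j → i ≢ j → kiteAdj i j ≡ false → ∀ {x y} → x ∈ V i → y ∈ V j → ¬ A x y ≡ true
    V-nonedge i j ne h x∈ y∈ e = true≢false e (nonedge M ne h (∈-collect⁻ (in? i) x∈) (∈-collect⁻ (in? j) y∈))

    Shrunk : Set
    Shrunk = Σ (Fin n) λ d → Σ (Subset n) λ X → d ∈ V 4F × Touch sy (V 3F) d × Touch sy X d × d ∉ X ×
      Connected A X × V 2F ⊆ X × (∀ {z} → z ∈ X → z ∈ V 2F ⊎ z ∈ V 4F)

    -- The part of 5 shrinks to its first vertex d with a neighbour in the part of 4, on a walk
    -- from a neighbour of the part of 3; what precedes d joins the part of 3.
    shrink : Shrunk
    shrink = let p , p∈ , f , f∈ , pf = V-edge 2F 4F refl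
                 e , e∈ , te = V-edge 4F 3F refl
             in conclude te (walk p∈ f∈ pf (V-conn 4F f∈ e∈))
      where
      Prefix : Fin n → Set
      Prefix x = ¬ Touch sy (V 3F) x × Σ (Subset n) λ X → x ∈ X × Connected A X × V 2F ⊆ X ×
        (∀ {z} → z ∈ X → z ∈ V 2F ⊎ (z ∈ V 4F × ¬ Touch sy (V 3F) z))
      advance : ∀ {X y x} → y ∈ X → A y x ≡ true → x ∈ V 4F → Connected A X → V 2F ⊆ X →
                (∀ {z} → z ∈ X → z ∈ V 2F ⊎ (z ∈ V 4F × ¬ Touch sy (V 3F) z)) → Prefix x ⊎ Shrunk
      advance {X} {y} {x} y∈ yx x∈ c sup sub with touch? sy (V 3F) x
      ... | yes t = inj₂ (x , X , x∈ , t , (y , y∈ , trans (sy x y) yx) ,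
              (λ x∈X → [ (λ x∈2 → V-disjoint 2F 4F (λ ()) x∈2 x∈) , (λ (_ , ¬t) → ¬t t) ]′ (sub x∈X)) ,
              c , sup , λ z∈ → [ inj₁ , inj₂ ∘ proj₁ ]′ (sub z∈))
      ... | no ¬t = inj₁ (¬t , X ∪ ⁅ x ⁆ , ∪ʳ {X = X} (x∈⁅x⁆ x) , connected-snoc sy c y∈ yx , ∪ˡ ∘ sup ,
              ∪-elim {X = X} {P = λ z → z ∈ V 2F ⊎ (z ∈ V 4F × ¬ Touch sy (V 3F) z)} sub
                (⁅⁆-elim {P = λ z → z ∈ V 2F ⊎ (z ∈ V 4F × ¬ Touch sy (V 3F) z)} (inj₂ (x∈ , ¬t))))
      walk : ∀ {p f x} → p ∈ V 2F → f ∈ V 4F → A p f ≡ true → Reach A (_∈ V 4F) f x → Prefix x ⊎ Shrunk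
      walk p∈ f∈ pf here = advance p∈ pf f∈ (V-conn 2F) (λ h → h) inj₁
      walk p∈ f∈ pf (step r e x∈) with walk p∈ f∈ pf r
      ... | inj₂ shrunk = inj₂ shrunk
      ... | inj₁ (_ , X , y∈ , c , sup , sub) = advance y∈ e x∈ c sup sub
      conclude : ∀ {e} → Touch sy (V 3F) e → Prefix e ⊎ Shrunk → Shrunk
      conclude t (inj₁ (¬t , _)) = contradiction t ¬t
      conclude t (inj₂ shrunk) = shrunk

  -- The walk inside the part of 2 starts at a neighbour of `a`, passes a vertex that touches the
  -- part of 3 and ends at one that touches the part of 4. Connectedness of the part supplies both
  -- halves.
  model⇒certificate : KiteCertificate A
  model⇒certificate with shrink | V-edge 0F 1F refl
  ... | d , X , d∈ , dY , dX , d∉X , X-conn , sup , sub | a , a∈ , b , b∈ , ab =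
    one-ended sy setting ab (proj₁ (free b∈)) (reach-mono proj₁ r)
      (all-mono proj₁ (proj₁ ∘ proj₂) (proj₁ (proj₂ (free b∈))) r)
      (all-mono proj₁ (proj₂ ∘ proj₂) (proj₂ (proj₂ (free b∈))) r)
      (any-mono proj₁ r (any-trans r₁ r₂ (any-end r₁ (touch-mono sy sup (proj₂ (proj₂ (V-edge 1F 2F refl)))))))
      (any-end (reach-mono proj₁ r) (proj₂ (proj₂ (V-edge 1F 3F refl))))
    where
    distinct : ∀ i j → i ≢ j → ∀ {x y} → x ∈ V i → y ∈ V j → ¬ x ≡ y
    distinct i j ne x∈ y∈ refl = V-disjoint i j ne x∈ y∈
    X-apart : ∀ {i} → i ≢ 2F → i ≢ 4F → Disjoint (V i) X
    X-apart ne₂ ne₄ z∈ z∈X = [ V-disjoint _ 2F ne₂ z∈ , V-disjoint _ 4F ne₄ z∈ ]′ (sub z∈X)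
    setting : Setting sy a d X (V 3F)
    setting = record
      { ¬da = V-nonedge 4F 0F (λ ()) refl d∈ a∈ ; d≢a = distinct 4F 0F (λ ()) d∈ a∈
      ; X-conn = X-conn ; Y-conn = V-conn 3F
      ; dis = λ z∈X z∈3 → X-apart (λ ()) (λ ()) z∈3 z∈X
      ; bridge = let p , p∈ , t = V-edge 2F 3F refl in p , sup p∈ , t
      ; dX = dX ; dY = dY
      ; X-clear = λ z∈ → (λ e → [ (λ z∈2 → V-nonedge 0F 2F (λ ()) refl a∈ z∈2 e)
                                , (λ z∈4 → V-nonedge 0F 4F (λ ()) refl a∈ z∈4 e) ]′ (sub z∈)) ,
                         (λ { refl → X-apart (λ ()) (λ ()) a∈ z∈ }) , (λ { refl → d∉X z∈ })
      ; Y-clear = λ z∈ → V-nonedge 0F 3F (λ ()) refl a∈ z∈ , distinct 0F 3F (λ ()) a∈ z∈ ,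
                         distinct 4F 3F (λ ()) d∈ z∈ }
    Free : Fin n → Set
    Free z = Off A a d z × z ∉ X × z ∉ V 3F
    free : ∀ {z} → z ∈ V 1F → Free z
    free z∈ = (V-nonedge 4F 1F (λ ()) refl d∈ z∈ , distinct 4F 1F (λ ()) d∈ z∈ , distinct 0F 1F (λ ()) a∈ z∈) ,
              X-apart (λ ()) (λ ()) z∈ , V-disjoint 1F 3F (λ ()) z∈
    r₁ : Reach A Free b (proj₁ (V-edge 1F 2F refl))
    r₁ = reach-mono free (V-conn 1F b∈ (proj₁ (proj₂ (V-edge 1F 2F refl))))
    r₂ : Reach A Free (proj₁ (V-edge 1F 2F refl)) (proj₁ (V-edge 1F 3F refl))
    r₂ = reach-mono free (V-conn 1F (proj₁ (proj₂ (V-edge 1F 2F refl))) (proj₁ (proj₂ (V-edge 1F 3F refl))))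
    r : Reach A Free b (proj₁ (V-edge 1F 3F refl))
    r = reach-trans r₁ r₂

-- The decision procedure

private
  Track : Set
  Track = Fin 17

  -- Reachability tests use the tracks after that of the last bound variable, adjacency tests 14 to 16.
  a# d# u# v# w# r# z# s# t# : Track
  a# = # 1
  d# = # 2
  u# = # 3
  v# = # 4
  w# = # 5
  r# = # 6
  z# = # 7
  s# = # 8
  t# = # 9

  auto : ∀ {m n} {le : True (m ≤? n)} → m ≤ n
  auto {le = le} = toWitness le

  adjacentP equalP : Track → Track → Program {17}
  adjacentP x y = adjP (# 14) (# 15) (# 16) x y
  equalP x y = meet x y

  notP : Program {17} → Program {17}
  notP p = p ⨾ setReg not

  regionP : Track → Program {17}
  regionP x = andP (notP (adjacentP a# x)) (andP (notP (equalP a# x)) (andP (notP (equalP d# x))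
    (andP (notP (equalP u# x)) (andP (notP (equalP v# x)) (notP (equalP w# x))))))

  andPoly : Poly → Poly → Poly
  andPoly T U = T ⊕ (cst 1 ⊕ (cst 1 ⊕ U))

  regionPoly : Poly
  regionPoly = andPoly (adjPoly {16} ⊕ cst 1) (andPoly E (andPoly E (andPoly E (andPoly E E))))
    where E = sweepPoly {16} ⊕ cst 1

module Logic (G : Graph) where
  n = Graph.size G
  A = Graph.adj G
  n< : n < length (encode G)
  n< = encode-length G
  ba = encode-bit G

  Dec′ : ℕ → Program {17} → Poly → Memory {17} → Set → Set
  Dec′ = Decides {w = encode G} A n< ba

  eqᴰ : ∀ {k M a b} (x y : Track) → toℕ x < k → toℕ y < k →
        M x ≡ pt (toℕ a) → M y ≡ pt (toℕ b) → Dec′ k (equalP x y) (sweepPoly {16}) M (a ≡ b)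
  eqᴰ x y x< y< mx my = decides-eq A n< ba x y x< y< (cong-app mx) (cong-app my)

  adjᴰ : ∀ {k M a b} (x y : Track) → toℕ x < k → toℕ y < k → 0 < k → k ≤ 14 →
         M zero ≡ pt n → M x ≡ pt (toℕ a) → M y ≡ pt (toℕ b) →
         Dec′ k (adjacentP x y) (adjPoly {16}) M (A a b ≡ true)
  adjᴰ x y x< y< 0<k k≤ m0 mx my = decides-adj A n< ba (# 14) (# 15) (# 16) x y
    k≤ auto auto 0<k x< y< (cong-app m0) (cong-app mx) (cong-app my)

  infixr 5 _andᴰ_
  infixr 4 _orᴰ_

  _andᴰ_ : ∀ {k M p q T U Φ Ψ} → Dec′ k p T M Φ → Dec′ k q U M Ψ →
           Dec′ k (andP p q) (andPoly T U) M (Φ × Ψ)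
  _andᴰ_ = decides-and A n< ba

  _orᴰ_ : ∀ {k M p q T U Φ Ψ} → Dec′ k p T M Φ → Dec′ k q U M Ψ →
          Dec′ k (orP p q) (andPoly T U) M (Φ ⊎ Ψ)
  _orᴰ_ = decides-or A n< ba

  notᴰ : ∀ {k M p T Φ} → Dec′ k p T M Φ → Dec′ k (notP p) (T ⊕ cst 1) M (¬ Φ)
  notᴰ = decides-not A n< ba

  regionᴰ : ∀ {k M a d u v w y} (x : Track) → 6 ≤ k → toℕ x < k → k ≤ 14 →
            M zero ≡ pt n → M a# ≡ pt (toℕ a) → M d# ≡ pt (toℕ d) → M u# ≡ pt (toℕ u) → M v# ≡ pt (toℕ v) →
            M w# ≡ pt (toℕ w) → M x ≡ pt (toℕ y) → Dec′ k (regionP x) regionPoly M (Region A a d u v w y)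
  regionᴰ x 6≤k x< k≤ m0 ma md mu mv mw mx =
    notᴰ (adjᴰ a# x (≤-trans auto 6≤k) x< (≤-trans auto 6≤k) k≤ m0 ma mx) andᴰ
    notᴰ (eqᴰ a# x (≤-trans auto 6≤k) x< ma mx) andᴰ notᴰ (eqᴰ d# x (≤-trans auto 6≤k) x< md mx) andᴰ
    notᴰ (eqᴰ u# x (≤-trans auto 6≤k) x< mu mx) andᴰ notᴰ (eqᴰ v# x (≤-trans auto 6≤k) x< mv mx) andᴰ
    notᴰ (eqᴰ w# x 6≤k x< mw mx)

  offᴰ : ∀ {M a d y} (x : Track) → toℕ x < 6 → M zero ≡ pt n → M a# ≡ pt (toℕ a) → M d# ≡ pt (toℕ d) →
         M x ≡ pt (toℕ y) →
         Dec′ 6 (andP (notP (adjacentP d# x)) (andP (notP (equalP d# x)) (notP (equalP a# x))))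
           (andPoly (adjPoly {16} ⊕ cst 1) (andPoly (sweepPoly {16} ⊕ cst 1) (sweepPoly {16} ⊕ cst 1))) M (Off A a d y)
  offᴰ x x< m0 ma md mx =
    notᴰ (adjᴰ d# x auto x< auto auto m0 md mx) andᴰ notᴰ (eqᴰ d# x auto x< md mx) andᴰ
    notᴰ (eqᴰ a# x auto x< ma mx)

  exᴰ : ∀ {M p T} {Φ : Fin n → Set} (x : Track) → 0 < toℕ x → M zero ≡ pt n →
        (∀ i → Dec′ (suc (toℕ x)) p T (M [ x ↦ pt (toℕ i) ]) (Φ i)) →
        Dec′ (toℕ x) (search x p) (searchPoly {16} T) M (Σ (Fin n) Φ)
  exᴰ x 0<x m0 = decides-ex A n< ba x refl 0<x (cong-app m0)

  allᴰ : ∀ {M p T} {Φ : Fin n → Set} (x : Track) → 0 < toℕ x → M zero ≡ pt n →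
         (∀ i → Dec′ (suc (toℕ x)) p T (M [ x ↦ pt (toℕ i) ]) (Φ i)) →
         Dec′ (toℕ x) (notP (search x (notP p))) (searchPoly {16} (T ⊕ cst 1) ⊕ cst 1) M (∀ i → Φ i)
  allᴰ x 0<x m0 = decides-all A n< ba x refl 0<x (cong-app m0)

-- Program and polynomial are left to unification, since the combinators follow `KiteCertificate`
-- clause by clause. Each variable sits on the track numbered by its depth; on such concrete tracks
-- the mark conditions hold by computation.
kite-program : Σ (Program {17}) λ p → Σ Poly λ T → ∀ G →
  Logic.Dec′ G 1 p T (initialMemory (Graph.size G)) (KiteCertificate (Graph.adj G))
kite-program = _ , _ , λ G → let open Logic G in
  exᴰ a# auto refl λ a → exᴰ d# auto refl λ d → exᴰ u# auto refl λ u → exᴰ v# auto refl λ v → exᴰ w# auto refl λ w →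
  (adjᴰ a# u# auto auto auto auto refl refl refl andᴰ
   (eqᴰ u# v# auto auto refl refl orᴰ adjᴰ u# v# auto auto auto auto refl refl refl) andᴰ
   (eqᴰ v# w# auto auto refl refl orᴰ adjᴰ v# w# auto auto auto auto refl refl refl) andᴰ
   notᴰ (adjᴰ d# a# auto auto auto auto refl refl refl) andᴰ notᴰ (eqᴰ d# a# auto auto refl refl) andᴰ
   offᴰ u# auto refl refl refl refl andᴰ offᴰ v# auto refl refl refl refl andᴰ offᴰ w# auto refl refl refl refl) andᴰ
  exᴰ r# auto refl λ r → regionᴰ r# auto auto auto refl refl refl refl refl refl refl andᴰ
  allᴰ z# auto refl λ z → exᴰ s# auto refl λ s →
    adjᴰ d# s# auto auto auto auto refl refl refl andᴰ
    notᴰ (eqᴰ z# s# auto auto refl refl) andᴰ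
    -- The set, the counter and the two scanning pointers occupy tracks 9 to 12; `t` is not bound
    -- yet, so its track 9 is free.
    decides-reach A n< ba (# 9) (# 10) (# 11) (# 12) (# 14) (# 15) (# 16) r# s# refl refl refl refl
      auto auto auto auto auto auto (λ _ → refl) (λ _ → refl) (λ _ → refl)
      (λ _ _ _ → regionᴰ (# 11) auto auto auto refl refl refl refl refl refl refl) andᴰ
    exᴰ t# auto refl λ t →
      (adjᴰ u# t# auto auto auto auto refl refl refl orᴰ
       (adjᴰ v# t# auto auto auto auto refl refl refl orᴰ adjᴰ w# t# auto auto auto auto refl refl refl)) andᴰ
      -- With `t` bound, the same four tracks are 10 to 13, which is why adjacency tests begin at
      -- 14.
      decides-reach A n< ba (# 10) (# 11) (# 12) (# 13) (# 14) (# 15) (# 16) s# t# refl refl refl refl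
        auto auto auto auto auto auto (λ _ → refl) (λ _ → refl) (λ _ → refl)
        (λ _ _ _ → regionᴰ (# 12) auto auto auto refl refl refl refl refl refl refl andᴰ
                   notᴰ (eqᴰ z# (# 12) auto auto refl refl))

certificate-minor : ∀ G → KiteCertificate (Graph.adj G) ⇔ HInducedMinor kite G
certificate-minor G = mk⇔
  (λ c → model⇒minor (Graph.irrefl kite) (Graph.sym G) (Graph.irrefl G) (certificate⇒model (Graph.sym G) c))
  (λ im → model⇒certificate (Graph.sym G) (minor⇒model (Graph.irrefl kite) (Graph.sym G) (Graph.irrefl G) im))

theorem7 : PolyTimeDecidable (HInducedMinor kite)
theorem7 = decides-poly-time λ G → decides-map (Graph.adj G) (encode-length G) (encode-bit G)
  (Equivalence.to (certificate-minor G)) (Equivalence.from (certificate-minor G))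
  (proj₂ (proj₂ kite-program) G)
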